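{- Define integers $u2(n)$, $n\in\mathbb{N}_0$, by \[ \sum_{n\ge0}u2(n)q^n:=\sum_{n\ge1}\frac{\left(-q^2;q^2\right)_{n-1}^2q^{2n}}{\left(q;q^2\right)_{n}}\qquad(|q|<1). \] Then $u2(n)$ is odd if and only if $8n-1=3^b\ell^2p^c$, where $p$ is a prime congruent to $5$ or $23$ modulo $24$, $p\nmid\ell$, $b\in\mathbb{N}_0$, $\ell\in\mathbb{N}$, and $c\equiv1\pmod 4$.
   Context: For $n\in\mathbb{N}_0\cup\{\infty\}$, $(a;q)_n:=\prod_{j=0}^{n-1}(1-aq^j)$. Combinatorially, $u2(n)$ counts unimodal sequences of size $n$ whose largest part is even, all of whose odd parts appear to the left of the peak, and whose subsequence of even parts is strongly unimodal. -}

module Defs where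

open import Data.Nat using (ℕ; zero; suc; _+_; _*_; _∸_; _≤?_)
open import Relation.Nullary using (yes; no)

-- Formal power series over ℕ, represented by their coefficient sequence:
-- f n is the coefficient of q^n.
Series : Set
Series = ℕ → ℕ

sumTo : ℕ → (ℕ → ℕ) → ℕ
sumTo zero    f = f 0
sumTo (suc n) f = sumTo n f + f (suc n)

one : Series
one zero    = 1
one (suc _) = 0

_⊛_ : Series → Series → Series
(f ⊛ g) n = sumTo n (λ i → f i * g (n ∸ i))

shift : ℕ → Series → Series
shift k f n with k ≤? n
... | yes _ = f (n ∸ k)
... | no  _ = 0

onePlus : ℕ → Series → Series
onePlus k f n = f n + shift k f n

-- multiplication by 1/(1 - q^k) = Σ_{j≥0} q^{jk}, for k ≥ 1
-- (the coefficient of q^n only involves j ≤ n)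
geomDiv : ℕ → Series → Series
geomDiv k f n = sumTo n (λ j → shift (j * k) f n)

negq2q2 : ℕ → Series
negq2q2 zero    = one
negq2q2 (suc m) = onePlus (2 * m + 2) (negq2q2 m)

invqq2 : ℕ → Series
invqq2 zero    = one
invqq2 (suc m) = geomDiv (2 * m + 1) (invqq2 m)

-- the n-th summand (n ≥ 1, written n = suc m):
-- (-q^2;q^2)_{n-1}^2 q^{2n} / (q;q^2)_n
term : ℕ → Series
term m = shift (2 * suc m) ((negq2q2 m ⊛ negq2q2 m) ⊛ invqq2 (suc m))

-- u2(N) = coefficient of q^N in Σ_{n≥1} term; the n-th term has order 2n,
-- so only n ≤ N contribute (the extra summands below are zero).
u2 : ℕ → ℕ
u2 N = sumTo N (λ m → term m N)

{-# OPTIONS --safe #-}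

-- Modulo 2 the generating function is Σ_n (Q;Q)²_(n-1) Q^n / (q;Q)_n with Q = q².
-- A Bailey pair expands 1/(q;Q)_n over z ≤ n, and summing over n first gives
--   Σ_z Σ_(0 ≤ j < 2z) q^(3z² - j(j+1)/2);
-- both steps are telescoping sums over a ring of characteristic 2. With x = 2j + 1 it
-- follows that u2(n) has the parity of the number H(m) of solutions of m = 24z² - x²,
-- 0 < x < 4z, where m = 8n - 1.
--
-- The parity of H(m) is found from involutions. H(m) counts the fixed points a = c of
-- the swap on the points 24ac - x² = m of a polygon that is cut into three triangles,
-- and an interior point of the triangle occurs in exactly two of the three pieces, as
-- two of the three vertices of the corresponding quadratic form are even. Only the edges
-- remain: the solutions of 12A² - X² = m, X < 3A, which a second dissection (four
-- triangles, two vertices divisible by 3) reduces to the factorisations m = de, d < e,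
-- when m ≡ 2 modulo 3; and, when m = 3m₁, the factorisations of m₁. Moreover
-- H(9m) = H(m), and H(m) = H(3m) = 0 for m ≡ 1 modulo 3. Finally, the number of
-- factorisations d < e of p^c k, with p ∤ k and c odd, is (c + 1)/2 times the number of
-- divisors of k, and this is odd just when c ≡ 1 modulo 4 and k is a square.

module Submission where

open import Defs
open import Algebra.Bundles using (CommutativeMonoid; CommutativeRing)
open import Algebra.Solver.Ring.AlmostCommutativeRing using (fromCommutativeRing; _-Raw-AlmostCommutative⟶_; Induced-equivalence)
import Algebra.Properties.Ring as RingProperties
import Algebra.Properties.Semiring.Exp as Exp
import Algebra.Solver.CommutativeMonoid as MonoidSolver
import Algebra.Solver.Ring as Solver
open import Data.Bool as Bool using (Bool; true; false; _∧_; _xor_; not)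
open import Data.Bool.Properties using (xor-∧-commutativeRing; not-distribˡ-xor; ∧-comm; ∧-assoc; ∧-zeroʳ; ∧-identityʳ; xor-comm; xor-assoc; xor-identityʳ; xor-same)
open import Data.Empty using (⊥; ⊥-elim)
open import Data.Maybe using (just; nothing)
open import Data.Nat as ℕ using (ℕ; zero; suc; z≤n; s≤s; z<s)
import Data.Nat.Properties as ℕₚ
open import Data.Nat.Tactic.RingSolver using (solve-∀)
open import Data.Product as Product using (Σ; ∃; _×_; _,_; proj₁; proj₂)
open import Data.Sum using (_⊎_; inj₁; inj₂)
open import Function using (_∘_; mk⇔; _⇔_)
open import Level using (0ℓ)
open import Relation.Binary using (DecidableEquality; WeaklyDecidable; tri<; tri≈; tri>)
open import Relation.Binary.PropositionalEquality as ≡ using (_≡_)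
import Relation.Binary.Reasoning.Setoid as SetoidReasoning
open import Relation.Nullary using (¬_; yes; no; does)
open import Relation.Nullary.Decidable using (_×-dec_; _→-dec_; dec-true; dec-false; from-yes)
open import Relation.Unary using (Decidable)

-- Both dissections rest on a binary form of discriminant -m. A point of 12AC - x² = m is the form
-- Au² - xuv + 3Cv². As -m is 1 modulo 8, this form has two distinct linear factors over 𝔽₂, so
-- exactly two of its values A, 3C, A - x + 3C on the three points of the projective line are even.
-- A point of 4AC - x² = m is the form Au² - xuv + Cv²; for m = 2 modulo 3 its discriminant is a
-- nonzero square modulo 3, and two of the values A, C, A ± x + C on the four points of the line
-- over 𝔽₃ are divisible by 3. Hence three triangles for the prime 2 and four for the prime 3, and
-- hence the separate treatment of the other classes of m modulo 3. Each triangle is used once per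
-- vertex, with that vertex moved to the place of A and required to be divisible by the prime.
-- Dividing the prime out of A makes the two outer coefficients interchangeable, and the polygon is
-- chosen so that its inequalities are symmetric as well. On the side of the series, characteristic
-- 2 turns 1 + Q^(2z) into the square of 1 + Q^z, exactly the denominator produced by the sum over
-- n; so no denominators survive.

-- Commutative rings of characteristic 2

module CharTwo (R : CommutativeRing 0ℓ 0ℓ)
  (1+1≈0 : CommutativeRing._≈_ R (CommutativeRing._+_ R (CommutativeRing.1# R) (CommutativeRing.1# R)) (CommutativeRing.0# R))
  where

  open CommutativeRing R
  open Exp semiring using (_^_; ^-homo-*)
  open RingProperties ring using (+-inverseˡ-unique)
  open SetoidReasoning setoid

  fromBool : Bool → Carrier
  fromBool true  = 1#
  fromBool false = 0#

  -- Coefficients in 𝔽₂ let the ring solver use 1 + 1 = 0, so the certificates below are checked by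
  -- normalising polynomials, with no signs to track.
  fromBool-morphism : CommutativeRing.rawRing xor-∧-commutativeRing -Raw-AlmostCommutative⟶ fromCommutativeRing R
  fromBool-morphism = record
    { ⟦_⟧    = fromBool
    ; +-homo = λ { false y → sym (+-identityˡ _) ; true false → sym (+-identityʳ _) ; true true → sym 1+1≈0 }
    ; *-homo = λ { false y → sym (zeroˡ _) ; true y → sym (*-identityˡ _) }
    ; -‿homo = λ { false → trans (sym (-‿inverseʳ 0#)) (+-identityˡ _) ; true → +-inverseˡ-unique 1# 1# 1+1≈0 }
    ; 0-homo = refl
    ; 1-homo = refl
    }

  fromBool-≟ : WeaklyDecidable (Induced-equivalence fromBool-morphism)
  fromBool-≟ false false = just refl
  fromBool-≟ true  true  = just refl
  fromBool-≟ _     _     = nothing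

  open Solver (CommutativeRing.rawRing xor-∧-commutativeRing) (fromCommutativeRing R) fromBool-morphism fromBool-≟
    using (solve; _:=_; _:+_; _:*_; con)

  x+x≈0 : ∀ x → x + x ≈ 0#
  x+x≈0 = solve 1 (λ x → x :+ x := con false) refl

  +≈0⇒≈ : ∀ {x y} → x + y ≈ 0# → x ≈ y
  +≈0⇒≈ {x} {y} p = begin
    x           ≈⟨ solve 2 (λ x y → x := (x :+ y) :+ y) refl x y ⟩
    (x + y) + y ≈⟨ +-congʳ p ⟩
    0# + y      ≈⟨ +-identityˡ y ⟩
    y           ∎

  cancel-unit : ∀ {a b x y} → a * b ≈ 1# → a * x ≈ a * y → x ≈ y
  cancel-unit {a} {b} {x} {y} ab p = begin
    x           ≈⟨ lem x ⟩
    b * (a * x) ≈⟨ *-congˡ p ⟩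
    b * (a * y) ≈⟨ lem y ⟨
    y           ∎
    where
    lem : ∀ z → z ≈ b * (a * z)
    lem z = begin
      z           ≈⟨ *-identityˡ z ⟨
      1# * z      ≈⟨ *-congʳ ab ⟨
      a * b * z   ≈⟨ solve 3 (λ a b z → a :* b :* z := b :* (a :* z)) refl a b z ⟩
      b * (a * z) ∎

  ∑ : ℕ → (ℕ → Carrier) → Carrier
  ∑ zero    f = f 0
  ∑ (suc n) f = ∑ n f + f (suc n)

  ∑-cong : ∀ n {f g : ℕ → Carrier} → (∀ i → i ℕ.≤ n → f i ≈ g i) → ∑ n f ≈ ∑ n g
  ∑-cong zero    p = p 0 z≤n
  ∑-cong (suc n) p = +-cong (∑-cong n (λ i i≤n → p i (ℕₚ.m≤n⇒m≤1+n i≤n))) (p (suc n) ℕₚ.≤-refl)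

  ∑-+ : ∀ n (f g : ℕ → Carrier) → ∑ n (λ i → f i + g i) ≈ ∑ n f + ∑ n g
  ∑-+ zero    f g = refl
  ∑-+ (suc n) f g = trans (+-congʳ (∑-+ n f g))
    (solve 4 (λ a b x y → (a :+ b) :+ (x :+ y) := (a :+ x) :+ (b :+ y)) refl _ _ _ _)

  ∑-*ˡ : ∀ n c (f : ℕ → Carrier) → ∑ n (λ i → c * f i) ≈ c * ∑ n f
  ∑-*ˡ zero    c f = refl
  ∑-*ˡ (suc n) c f = trans (+-congʳ (∑-*ˡ n c f)) (sym (distribˡ c _ _))

  ∑-swap : ∀ m n (f : ℕ → ℕ → Carrier) → ∑ m (λ i → ∑ n (f i)) ≈ ∑ n (λ j → ∑ m (λ i → f i j))
  ∑-swap zero    n f = refl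
  ∑-swap (suc m) n f = trans (+-congʳ (∑-swap m n f)) (sym (∑-+ n _ _))

  ∑-zero-tail : ∀ n k (f : ℕ → Carrier) → (∀ i → n ℕ.< i → f i ≈ 0#) → ∑ (k ℕ.+ n) f ≈ ∑ n f
  ∑-zero-tail n zero    f p = refl
  ∑-zero-tail n (suc k) f p = trans (+-cong (∑-zero-tail n k f p) (p _ (s≤s (ℕₚ.m≤n+m n k)))) (+-identityʳ _)

  -- Q denotes q².
  module HeckeSum (q : Carrier) (u v : ℕ → Carrier)
    (u-inverse : ∀ k → (1# + (q * q) ^ suc k) * u k ≈ 1#)
    (v-inverse : ∀ k → (1# + q * (q * q) ^ k) * v k ≈ 1#)
    where

    -- A Bailey pair for 1/(q;Q)_n

    Q^ : ℕ → Carrier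
    Q^ k = (q * q) ^ k

    Q^-+ : ∀ m n → Q^ (m ℕ.+ n) ≈ Q^ m * Q^ n
    Q^-+ = ^-homo-* (q * q)

    -- (Q;Q)_n, its inverse, and 1/(q;Q)_n
    poch ι κ : ℕ → Carrier
    poch zero    = 1#
    poch (suc n) = (1# + Q^ (suc n)) * poch n
    ι zero       = 1#
    ι (suc n)    = u n * ι n
    κ zero       = 1#
    κ (suc n)    = v n * κ n

    ι-suc : ∀ n → ι n ≈ (1# + Q^ (suc n)) * ι (suc n)
    ι-suc n = begin
      ι n                             ≈⟨ *-identityˡ _ ⟨
      1# * ι n                        ≈⟨ *-congʳ (u-inverse n) ⟨
      (1# + Q^ (suc n)) * u n * ι n   ≈⟨ *-assoc _ _ _ ⟩
      (1# + Q^ (suc n)) * (u n * ι n) ∎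

    κ-suc : ∀ n → κ n ≈ (1# + q * Q^ n) * κ (suc n)
    κ-suc n = begin
      κ n                            ≈⟨ *-identityˡ _ ⟨
      1# * κ n                       ≈⟨ *-congʳ (v-inverse n) ⟨
      (1# + q * Q^ n) * v n * κ n    ≈⟨ *-assoc _ _ _ ⟩
      (1# + q * Q^ n) * (v n * κ n)  ∎

    -- 1/(Q;Q)_(n-z), with the convention that it vanishes for z > n
    ι⁻ : ℕ → ℕ → Carrier
    ι⁻ n       zero    = ι n
    ι⁻ zero    (suc z) = 0#
    ι⁻ (suc n) (suc z) = ι⁻ n z

    ι⁻-+ : ∀ m z → ι⁻ (m ℕ.+ z) z ≡ ι m
    ι⁻-+ m zero    = ≡.cong ι (ℕₚ.+-identityʳ m)
    ι⁻-+ m (suc z) = ≡.trans (≡.cong (λ n → ι⁻ n (suc z)) (ℕₚ.+-suc m z)) (ι⁻-+ m z)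

    ι⁻-zero : ∀ {n z} → n ℕ.< z → ι⁻ n z ≡ 0#
    ι⁻-zero {zero}  {suc z} p       = ≡.refl
    ι⁻-zero {suc n} {suc z} (s≤s p) = ι⁻-zero p

    -- The Bailey kernel 1/((Q;Q)_(n-z) (Q;Q)_(n+z)), relative to a = 1.
    D : ℕ → ℕ → Carrier
    D n z = ι⁻ n z * ι (n ℕ.+ z)

    D-+ : ∀ m z {k} → m ℕ.+ z ℕ.+ z ≡ k → D (m ℕ.+ z) z ≡ ι m * ι k
    D-+ m z p = ≡.cong₂ _*_ (ι⁻-+ m z) (≡.cong ι p)

    D-zero : ∀ {n z} → n ℕ.< z → D n z ≈ 0#
    D-zero {n} {z} p = trans (*-congʳ (reflexive (ι⁻-zero p))) (zeroˡ _)

    -- θ z = q^(z² + z), and P z = Σ_(j < 2z) q^(3z² - 2z - j(j+1)/2)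
    θ P : ℕ → Carrier
    θ zero    = 1#
    θ (suc z) = Q^ (suc z) * θ z
    P zero    = 0#
    P (suc z) = q * (Q^ z * Q^ z * Q^ z) * P z + θ z * (1# + q * Q^ z)

    -- The terms α_z `D n z` of a Bailey pair modulo 2 with β_n = 1/(q;Q)_n for n ≥ 1; here α_z = P
    -- z (1 + Q^(2z)).
    r : ℕ → ℕ → Carrier
    r n z = P z * (1# + Q^ z * Q^ z) * D n z

    -- The n-recurrence of Σ_z r n z = κ n is telescoped twice: first with
    -- certificate G, which leaves Θ, and then with certificate h.
    τ G Θ h : ℕ → ℕ → Carrier
    τ n z = (1# + q * Q^ n) * r (suc n) z + r n z
    G m w = P (suc w) * Q^ m * (1# + q * Q^ w) * (ι m * ι (suc (m ℕ.+ w ℕ.+ w)))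
    Θ m w = Q^ m * θ w * (1# + q * q * (Q^ w * Q^ w)) * (ι m * ι (suc (m ℕ.+ w ℕ.+ w)))
    h m w = Q^ m * θ w * (1# + Q^ w) * (ι m * ι (m ℕ.+ w ℕ.+ w))

    τ-zero : ∀ n → τ n 0 ≈ 0#
    τ-zero n = solve 4 (λ q N x y → (con true :+ q :* N) :* (con false :* (con true :+ con true :* con true) :* x) :+ con false :* (con true :+ con true :* con true) :* y := con false)
      refl q (Q^ n) (D (suc n) 0) (D n 0)

    idx₁ : ∀ m k → suc m ℕ.+ suc k ℕ.+ suc k ≡ 3 ℕ.+ (m ℕ.+ k ℕ.+ k)
    idx₁ m k = ≡.cong suc (≡.trans (ℕₚ.+-suc (m ℕ.+ suc k) k) (≡.cong (λ x → suc (x ℕ.+ k)) (ℕₚ.+-suc m k)))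

    idx₀ : ∀ m k → m ℕ.+ suc k ℕ.+ suc k ≡ 2 ℕ.+ (m ℕ.+ k ℕ.+ k)
    idx₀ m k = ℕₚ.suc-injective (idx₁ m k)

    Q^-idx : ∀ m k → Q^ (m ℕ.+ k ℕ.+ k) ≈ Q^ m * Q^ k * Q^ k
    Q^-idx m k = trans (Q^-+ (m ℕ.+ k) k) (*-congʳ (Q^-+ m k))

    -- With n = m + k + 1 and z = k + 1, `G (suc m) k` and `G m (suc k)` are the certificate at the
    -- same n and at neighbouring z. The coordinate m = n - z avoids subtraction; once every `ι` is
    -- a multiple of i or j, a polynomial identity remains.
    τ-suc : ∀ m k → τ (m ℕ.+ suc k) (suc k) ≈ G (suc m) k + (G m (suc k) + Θ m (suc k))
    τ-suc m k = begin
      τ (m ℕ.+ suc k) (suc k)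
        ≡⟨ ≡.cong₂ (λ x y → (1# + q * Q^ (m ℕ.+ suc k)) * (p * w * x) + p * w * y) (D-+ (suc m) (suc k) (idx₁ m k)) (D-+ m (suc k) (idx₀ m k)) ⟩
      (1# + q * Q^ (m ℕ.+ suc k)) * (p * w * (i * j)) + p * w * (ι m * ι (2 ℕ.+ s))
        ≈⟨ +-cong (*-congʳ (+-congˡ (*-congˡ (Q^-+ m (suc k))))) (*-congˡ (*-cong ιm j₁)) ⟩
      (1# + q * (ν * (q * q * W))) * (p * w * (i * j)) + p * w * ((1# + q * q * ν) * i * ((1# + q * q * (q * q * (q * q * (ν * W * W)))) * j))
        ≈⟨ solve 7 (λ q ν W p t i j →
             let Z = q :* q :* W ; w = con true :+ Z :* Z
                 im = (con true :+ q :* q :* ν) :* i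
                 j1 = (con true :+ q :* q :* (q :* q :* (q :* q :* (ν :* W :* W)))) :* j
             in (con true :+ q :* (ν :* Z)) :* (p :* w :* (i :* j)) :+ p :* w :* (im :* j1)
             := p :* (q :* q :* ν) :* (con true :+ q :* W) :* (i :* j1)
                :+ ((q :* (Z :* Z :* Z) :* p :+ t :* (con true :+ q :* Z)) :* ν :* (con true :+ q :* Z) :* (im :* j)
                :+ ν :* t :* (con true :+ q :* q :* (Z :* Z)) :* (im :* j)))
             refl q ν W p (θ (suc k)) i j ⟩
      p * (q * q * ν) * (1# + q * W) * (i * ((1# + q * q * (q * q * (q * q * (ν * W * W)))) * j))
        + (P (suc (suc k)) * ν * (1# + q * (q * q * W)) * ((1# + q * q * ν) * i * j)
        + ν * θ (suc k) * (1# + q * q * (q * q * W * (q * q * W))) * ((1# + q * q * ν) * i * j))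
        ≈⟨ +-cong (*-congˡ (*-congˡ j₁)) (+-cong (*-congˡ (*-cong ιm j₀)) (*-congˡ (*-cong ιm j₀))) ⟨
      G (suc m) k + (G m (suc k) + Θ m (suc k)) ∎
      where
      s = m ℕ.+ k ℕ.+ k
      ν = Q^ m
      W = Q^ k
      p = P (suc k)
      w = 1# + Q^ (suc k) * Q^ (suc k)
      i = ι (suc m)
      j = ι (3 ℕ.+ s)
      ιm : ι m ≈ (1# + q * q * ν) * i
      ιm = ι-suc m
      j₁ : ι (2 ℕ.+ s) ≈ (1# + q * q * (q * q * (q * q * (ν * W * W)))) * j
      j₁ = trans (ι-suc (2 ℕ.+ s)) (*-congʳ (+-congˡ (*-congˡ (*-congˡ (*-congˡ (Q^-idx m k))))))
      j₀ : ι (suc (m ℕ.+ suc k ℕ.+ suc k)) ≈ j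
      j₀ = reflexive (≡.cong (λ x → ι (suc x)) (idx₀ m k))

    -- `Θ` is a difference in z only after multiplication by 1 + Q^n, where n = m + k + 1 stays
    -- fixed.
    h-suc : ∀ m k → (1# + Q^ (m ℕ.+ suc k)) * Θ (suc m) k + h (suc m) k ≈ h m (suc k)
    h-suc m k = begin
      (1# + Q^ (m ℕ.+ suc k)) * Θ (suc m) k + h (suc m) k
        ≈⟨ +-cong (*-cong (+-congˡ (Q^-+ m (suc k))) (*-congˡ refl)) (*-congˡ (*-congˡ j₁)) ⟩
      (1# + ν * (q * q * W)) * Θ (suc m) k + q * q * ν * t * (1# + W) * (i * ((1# + q * q * (q * q * (ν * W * W))) * j))
        ≈⟨ solve 6 (λ q ν W t i j →
             let Z = q :* q :* W in
             (con true :+ ν :* Z) :* (q :* q :* ν :* t :* (con true :+ q :* q :* (W :* W)) :* (i :* j))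
               :+ q :* q :* ν :* t :* (con true :+ W) :* (i :* ((con true :+ q :* q :* (q :* q :* (ν :* W :* W))) :* j))
             := ν :* (Z :* t) :* (con true :+ Z) :* ((con true :+ q :* q :* ν) :* i :* j))
             refl q ν W t i j ⟩
      ν * (q * q * W * t) * (1# + q * q * W) * ((1# + q * q * ν) * i * j)
        ≈⟨ *-congˡ (*-cong (ι-suc m) (reflexive (≡.cong ι (idx₀ m k)))) ⟨
      h m (suc k) ∎
      where
      s = m ℕ.+ k ℕ.+ k
      ν = Q^ m
      W = Q^ k
      t = θ k
      i = ι (suc m)
      j = ι (2 ℕ.+ s)
      j₁ : ι (suc s) ≈ (1# + q * q * (q * q * (ν * W * W))) * j
      j₁ = trans (ι-suc (suc s)) (*-congʳ (+-congˡ (*-congˡ (*-congˡ (Q^-idx m k)))))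

    -- By `τ-suc` the bracket is the sum of `Θ` over z < k for the fixed n = m + k, because `G` and
    -- `Θ` cancel at z = 0. There `h` starts from zero, thanks to its factor 1 + Q^z.
    telescope : ∀ m k → (1# + Q^ (m ℕ.+ k)) * (∑ k (τ (m ℕ.+ k)) + G m k + Θ m k) ≈ h m k
    telescope m zero = begin
      (1# + Q^ (m ℕ.+ 0)) * (τ (m ℕ.+ 0) 0 + G m 0 + Θ m 0)
        ≈⟨ *-congˡ (+-congʳ (+-congʳ (τ-zero (m ℕ.+ 0)))) ⟩
      (1# + Q^ (m ℕ.+ 0)) * (0# + G m 0 + Θ m 0)
        ≈⟨ solve 6 (λ q N M i j k →
             let o = con true ; P₁ = q :* (o :* o :* o) :* con false :+ o :* (o :+ q :* o) in
             (o :+ N) :* (con false :+ P₁ :* M :* (o :+ q :* o) :* (i :* j) :+ M :* o :* (o :+ q :* q :* (o :* o)) :* (i :* j))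
             := M :* o :* (o :+ o) :* (i :* k))
             refl q (Q^ (m ℕ.+ 0)) (Q^ m) (ι m) (ι (suc (m ℕ.+ 0 ℕ.+ 0))) (ι (m ℕ.+ 0 ℕ.+ 0)) ⟩
      h m 0 ∎
    telescope m (suc k) = begin
      a * (∑ k (τ n) + τ n (suc k) + G m (suc k) + Θ m (suc k))
        ≈⟨ *-congˡ (+-congʳ (+-congʳ (+-congˡ (τ-suc m k)))) ⟩
      a * (∑ k (τ n) + (G (suc m) k + (G m (suc k) + Θ m (suc k))) + G m (suc k) + Θ m (suc k))
        ≈⟨ solve 6 (λ a s g e t u → a :* (s :+ (g :+ (e :+ t)) :+ e :+ t) := a :* (s :+ g :+ u) :+ a :* u) refl a _ _ _ _ (Θ (suc m) k) ⟩
      a * (∑ k (τ n) + G (suc m) k + Θ (suc m) k) + a * Θ (suc m) k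
        ≈⟨ +-congʳ (≡.subst (λ x → (1# + Q^ x) * (∑ k (τ x) + G (suc m) k + Θ (suc m) k) ≈ h (suc m) k) (≡.sym (ℕₚ.+-suc m k)) (telescope (suc m) k)) ⟩
      h (suc m) k + a * Θ (suc m) k
        ≈⟨ +-comm _ _ ⟩
      a * Θ (suc m) k + h (suc m) k
        ≈⟨ h-suc m k ⟩
      h m (suc k) ∎
      where
      n = m ℕ.+ suc k
      a = 1# + Q^ n

    -- At z = n + 1 the kernel `D n z` vanishes, and only the left half of the certificate is left
    -- to close the telescope.
    τ-diagonal : ∀ n → τ n (suc n) ≈ G 0 n
    τ-diagonal n = begin
      (1# + q * N) * (p * w * D (suc n) (suc n)) + p * w * D n (suc n)
        ≈⟨ +-cong (*-congˡ (*-congˡ (reflexive (D-+ 0 (suc n) (idx₀ 0 n))))) (*-congˡ (D-zero (ℕₚ.n<1+n n))) ⟩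
      (1# + q * N) * (p * w * (1# * j)) + p * w * 0#
        ≈⟨ solve 4 (λ q N p j → let o = con true ; w = o :+ (q :* q :* N) :* (q :* q :* N) in
             (o :+ q :* N) :* (p :* w :* (o :* j)) :+ p :* w :* con false
             := p :* o :* (o :+ q :* N) :* (o :* ((o :+ q :* q :* (q :* q :* (N :* N))) :* j))) refl q N p j ⟩
      p * 1# * (1# + q * N) * (1# * ((1# + q * q * (q * q * (N * N))) * j))
        ≈⟨ *-congˡ (*-congˡ (trans (ι-suc (suc (n ℕ.+ n))) (*-congʳ (+-congˡ (*-congˡ (*-congˡ (Q^-+ n n))))))) ⟨
      G 0 n ∎
      where
      N = Q^ n
      p = P (suc n)
      w = 1# + Q^ (suc n) * Q^ (suc n)
      j = ι (2 ℕ.+ (n ℕ.+ n))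

    h-diagonal : ∀ n → h 0 n ≈ (1# + Q^ n) * Θ 0 n
    h-diagonal n = begin
      1# * θ n * (1# + N) * (1# * ι (n ℕ.+ n))
        ≈⟨ *-congˡ (*-congˡ (trans (ι-suc (n ℕ.+ n)) (*-congʳ (+-congˡ (*-congˡ (Q^-+ n n)))))) ⟩
      1# * θ n * (1# + N) * (1# * ((1# + q * q * (N * N)) * ι (suc (n ℕ.+ n))))
        ≈⟨ solve 4 (λ q N t j → let o = con true in
             o :* t :* (o :+ N) :* (o :* ((o :+ q :* q :* (N :* N)) :* j))
             := (o :+ N) :* (o :* t :* (o :+ q :* q :* (N :* N)) :* (o :* j))) refl q N (θ n) _ ⟩
      (1# + N) * Θ 0 n ∎
      where N = Q^ n

    -- The index is `suc n` because the factor 1 + Q^n, which has to be cancelled, is zero at n = 0.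
    ∑τ≈0 : ∀ n → ∑ (2 ℕ.+ n) (τ (suc n)) ≈ 0#
    ∑τ≈0 n = cancel-unit (u-inverse n) (begin
      a * (s + τ N (suc N))
        ≈⟨ *-congˡ (+-congˡ (τ-diagonal N)) ⟩
      a * (s + G 0 N)
        ≈⟨ solve 4 (λ a s g t → a :* (s :+ g) := a :* (s :+ g :+ t) :+ a :* t) refl a s (G 0 N) (Θ 0 N) ⟩
      a * (s + G 0 N + Θ 0 N) + a * Θ 0 N
        ≈⟨ +-cong (telescope 0 N) (sym (h-diagonal N)) ⟩
      h 0 N + h 0 N
        ≈⟨ x+x≈0 _ ⟩
      0#
        ≈⟨ zeroʳ a ⟨
      a * 0# ∎)
      where
      N = suc n
      a = 1# + Q^ N
      s = ∑ N (τ N)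

    -- Both sides satisfy (1 + q Q^n) y_(n+1) = y_n for n ≥ 1. The induction starts at index 1: at
    -- index 0 the sum would be 0, while `κ 0` is 1.
    κ-expansion : ∀ n → ∑ (suc n) (r (suc n)) ≈ κ (suc n)
    κ-expansion zero = cancel-unit (v-inverse 0) (begin
      (1# + q * 1#) * (0# * (1# + 1# * 1#) * D 1 0 + (q * (1# * 1# * 1#) * 0# + 1# * (1# + q * 1#)) * (1# + q * q * 1# * (q * q * 1#)) * (1# * ι 2))
        ≈⟨ solve 3 (λ q d j → let o = con true ; z = con false in
             (o :+ q :* o) :* (z :* (o :+ o :* o) :* d :+ (q :* (o :* o :* o) :* z :+ o :* (o :+ q :* o)) :* (o :+ q :* q :* o :* (q :* q :* o)) :* (o :* j))
             := (o :+ q :* q :* o) :* ((o :+ q :* q :* (q :* q :* o)) :* j)) refl q (D 1 0) (ι 2) ⟩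
      (1# + Q^ 1) * ((1# + Q^ 2) * ι 2)
        ≈⟨ *-congˡ (ι-suc 1) ⟨
      (1# + Q^ 1) * ι 1
        ≈⟨ ι-suc 0 ⟨
      1#
        ≈⟨ κ-suc 0 ⟩
      (1# + q * 1#) * κ 1 ∎)
    κ-expansion (suc n) = cancel-unit (v-inverse (suc n)) (begin
      a * ∑ (2 ℕ.+ n) (r (2 ℕ.+ n))
        ≈⟨ +≈0⇒≈ (trans (+-cong (sym (∑-*ˡ (2 ℕ.+ n) a _)) tail) (trans (sym (∑-+ (2 ℕ.+ n) _ _)) (∑τ≈0 n))) ⟩
      ∑ (suc n) (r (suc n))
        ≈⟨ κ-expansion n ⟩
      κ (suc n)
        ≈⟨ κ-suc (suc n) ⟩
      a * κ (2 ℕ.+ n) ∎)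
      where
      a = 1# + q * Q^ (suc n)
      tail : ∑ (suc n) (r (suc n)) ≈ ∑ (2 ℕ.+ n) (r (suc n))
      tail = sym (∑-zero-tail (suc n) 1 (r (suc n)) (λ z p → trans (*-congˡ (D-zero p)) (zeroʳ _)))

    -- Summation over n

    weight : ℕ → Carrier
    weight n = poch n * poch n * Q^ (suc n)

    -- For M → ∞, S-recurrence gives Σ_n (Q;Q)²_(n-1) Q^n D n z = Q^z / (1 + Q^z)².
    S : ℕ → ℕ → Carrier
    S zero    z = 0#
    S (suc M) z = S M z + weight M * D (suc M) z

    sq : ℕ → Carrier
    sq z = (1# + Q^ z) * (1# + Q^ z)

    -- The boundary term of the sum over n in the z-recurrence. It contains `weight M`, hence
    -- Q^(M+1), and so disappears in the limit.
    B : ℕ → ℕ → Carrier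
    B M z = weight M * (1# + q * q * (Q^ z * Q^ z)) * (ι⁻ M z * ι (suc (M ℕ.+ z)))

    B-zero : ∀ {M z} → M ℕ.< z → B M z ≈ 0#
    B-zero p = trans (*-congˡ (trans (*-congʳ (reflexive (ι⁻-zero p))) (zeroˡ _))) (zeroʳ _)

    S-step-below : ∀ m z → let M = m ℕ.+ z in
      sq (suc z) * (weight M * D (suc M) (suc z)) + q * q * sq z * (weight M * D (suc M) z) ≈ B (suc M) z + B M z
    S-step-below m z = begin
      sq (suc z) * (weight M * D (suc M) (suc z)) + q * q * sq z * (weight M * D (suc M) z)
        ≈⟨ +-cong (*-congˡ (*-cong w≈ (*-cong ιm (reflexive (≡.cong (λ x → ι (suc x)) (ℕₚ.+-suc M z))))))
                  (*-congˡ (*-cong w≈ (*-cong (reflexive (ι⁻-+ (suc m) z)) j₁))) ⟩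
      sq (suc z) * (p * p * (q * q * (ν * Z)) * ((1# + q * q * ν) * i * j))
        + q * q * sq z * (p * p * (q * q * (ν * Z)) * (i * ((1# + q * q * (q * q * (ν * Z * Z))) * j)))
        ≈⟨ solve 6 (λ q ν Z p i j → let o = con true ; Z′ = q :* q :* Z ; N = q :* q :* (ν :* Z) ; w = p :* p :* N
                                        im = (o :+ q :* q :* ν) :* i ; j1 = (o :+ q :* q :* (q :* q :* (ν :* Z :* Z))) :* j in
             (o :+ Z′) :* (o :+ Z′) :* (w :* (im :* j)) :+ q :* q :* ((o :+ Z) :* (o :+ Z)) :* (w :* (i :* j1))
             := ((o :+ N) :* p) :* ((o :+ N) :* p) :* (q :* q :* N) :* (o :+ q :* q :* (Z :* Z)) :* (i :* j)
                :+ w :* (o :+ q :* q :* (Z :* Z)) :* (im :* j1)) refl q ν Z p i j ⟩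
      (1# + q * q * (ν * Z)) * p * ((1# + q * q * (ν * Z)) * p) * (q * q * (q * q * (ν * Z))) * (1# + q * q * (Z * Z)) * (i * j)
        + p * p * (q * q * (ν * Z)) * (1# + q * q * (Z * Z)) * ((1# + q * q * ν) * i * ((1# + q * q * (q * q * (ν * Z * Z))) * j))
        ≈⟨ +-cong (*-cong (*-congʳ (*-cong (*-cong (*-congʳ (+-congˡ N≈)) (*-congʳ (+-congˡ N≈))) (*-congˡ N≈))) (*-congʳ (reflexive (ι⁻-+ (suc m) z))))
                  (*-cong (*-congʳ w≈) (*-cong ιm j₁)) ⟨
      B (suc M) z + B M z ∎
      where
      M = m ℕ.+ z
      ν = Q^ m
      Z = Q^ z
      p = poch M
      i = ι (suc m)
      j = ι (2 ℕ.+ (M ℕ.+ z))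
      N≈ : Q^ (suc M) ≈ q * q * (ν * Z)
      N≈ = *-congˡ (Q^-+ m z)
      w≈ : weight M ≈ p * p * (q * q * (ν * Z))
      w≈ = *-congˡ N≈
      ιm : ι⁻ M z ≈ (1# + q * q * ν) * i
      ιm = trans (reflexive (ι⁻-+ m z)) (ι-suc m)
      j₁ : ι (suc (M ℕ.+ z)) ≈ (1# + q * q * (q * q * (ν * Z * Z))) * j
      j₁ = trans (ι-suc _) (*-congʳ (+-congˡ (*-congˡ (*-congˡ (Q^-idx m z)))))

    S-step-diagonal : ∀ M → let z = suc M in
      sq (suc z) * (weight M * D (suc M) (suc z)) + q * q * sq z * (weight M * D (suc M) z) ≈ B (suc M) z + B M z
    S-step-diagonal M = begin
      sq (2 ℕ.+ M) * (weight M * D (suc M) (2 ℕ.+ M)) + q * q * sq (suc M) * (weight M * D (suc M) (suc M))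
        ≈⟨ +-cong (*-congˡ (*-congˡ (D-zero (ℕₚ.n<1+n (suc M)))))
                  (*-congˡ (*-congˡ (*-cong (reflexive (ι⁻-+ 0 M)) (trans (ι-suc _) (*-congʳ (+-congˡ (*-congˡ (Q^-+ (suc M) (suc M))))))))) ⟩
      sq (2 ℕ.+ M) * (weight M * 0#) + q * q * sq (suc M) * (weight M * (1# * ((1# + q * q * (q * q * N * (q * q * N))) * j)))
        ≈⟨ solve 5 (λ a q N p j → let o = con true ; Z = q :* q :* N ; w = p :* p :* Z in
             a :* (w :* con false) :+ q :* q :* ((o :+ Z) :* (o :+ Z)) :* (w :* (o :* ((o :+ q :* q :* (Z :* Z)) :* j)))
             := ((o :+ Z) :* p) :* ((o :+ Z) :* p) :* (q :* q :* Z) :* (o :+ q :* q :* (Z :* Z)) :* (o :* j) :+ con false)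
             refl (sq (2 ℕ.+ M)) q N (poch M) j ⟩
      weight (suc M) * (1# + q * q * (Q^ (suc M) * Q^ (suc M))) * (1# * j) + 0#
        ≈⟨ +-cong (*-congˡ (*-congʳ (reflexive (ι⁻-+ 0 M)))) (B-zero (ℕₚ.n<1+n M)) ⟨
      B (suc M) (suc M) + B M (suc M) ∎
      where
      N = Q^ M
      j = ι (suc (suc M ℕ.+ suc M))

    S-step-above : ∀ {M z} → suc M ℕ.< z →
      sq (suc z) * (weight M * D (suc M) (suc z)) + q * q * sq z * (weight M * D (suc M) z) ≈ B (suc M) z + B M z
    S-step-above {M} {z} p = begin
      sq (suc z) * (weight M * D (suc M) (suc z)) + q * q * sq z * (weight M * D (suc M) z)
        ≈⟨ +-cong (*-congˡ (*-congˡ (D-zero (ℕₚ.m<n⇒m<1+n p)))) (*-congˡ (*-congˡ (D-zero p))) ⟩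
      sq (suc z) * (weight M * 0#) + q * q * sq z * (weight M * 0#)
        ≈⟨ solve 3 (λ a b c → a :* (b :* con false) :+ c :* (b :* con false) := con false :+ con false) refl _ _ _ ⟩
      0# + 0#
        ≈⟨ +-cong (B-zero p) (B-zero (ℕₚ.<⇒≤ p)) ⟨
      B (suc M) z + B M z ∎

    -- The increment of `S-recurrence` from M to M + 1. The cases come from the convention in `ι⁻`:
    -- the polynomial certificate covers z ≤ M, one kernel survives at z = M + 1, and none beyond.
    S-step : ∀ M z →
      sq (suc z) * (weight M * D (suc M) (suc z)) + q * q * sq z * (weight M * D (suc M) z) ≈ B (suc M) z + B M z
    S-step M z with ℕₚ.<-cmp (suc M) z
    ... | tri< p _ _      = S-step-above p
    ... | tri≈ _ ≡.refl _ = S-step-diagonal M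
    ... | tri> _ _ (s≤s p) with ℕₚ.m≤n⇒∃[o]m+o≡n p
    ...   | m , ≡.refl rewrite ℕₚ.+-comm z m = S-step-below m z

    -- At z = 0 the recurrence has the extra term Q, which starts the induction.
    [Q] : ℕ → Carrier
    [Q] zero    = q * q
    [Q] (suc _) = 0#

    S-recurrence : ∀ M z → sq (suc z) * S M (suc z) + q * q * sq z * S M z ≈ B M z + [Q] z
    S-recurrence zero zero = begin
      sq 1 * 0# + q * q * sq 0 * 0#
        -- Zero is written as `B 0 0` plus a second copy of it, which is then evaluated to Q.
        ≈⟨ solve 4 (λ a b q j → let o = con true in a :* con false :+ b :* con false
             := o :* o :* (q :* q :* o) :* (o :+ q :* q :* (o :* o)) :* (o :* j)
                :+ o :* o :* (q :* q :* o) :* (o :+ q :* q :* (o :* o)) :* (o :* j)) refl (sq 1) (q * q * sq 0) q (ι 1) ⟩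
      B 0 0 + 1# * 1# * Q^ 1 * (1# + q * q * (1# * 1#)) * (1# * ι 1)
        ≈⟨ +-congˡ (begin
             1# * 1# * Q^ 1 * (1# + q * q * (1# * 1#)) * (1# * ι 1)
               ≈⟨ solve 2 (λ q j → let o = con true in o :* o :* (q :* q :* o) :* (o :+ q :* q :* (o :* o)) :* (o :* j)
                    := q :* q :* ((o :+ q :* q :* o) :* j)) refl q (ι 1) ⟩
             q * q * ((1# + Q^ 1) * ι 1)
               ≈⟨ *-congˡ (ι-suc 0) ⟨
             q * q * 1#
               ≈⟨ *-identityʳ _ ⟩
             q * q ∎) ⟩
      B 0 0 + q * q ∎
    S-recurrence zero (suc z) = begin
      sq (2 ℕ.+ z) * 0# + q * q * sq (suc z) * 0#
        ≈⟨ +-cong (zeroʳ _) (zeroʳ _) ⟩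
      0# + 0#
        ≈⟨ +-congʳ (B-zero (s≤s z≤n)) ⟨
      B 0 (suc z) + 0# ∎
    S-recurrence (suc M) z = begin
      sq (suc z) * (S M (suc z) + weight M * D (suc M) (suc z)) + q * q * sq z * (S M z + weight M * D (suc M) z)
        ≈⟨ solve 6 (λ a s x b s′ y → a :* (s :+ x) :+ b :* (s′ :+ y) := (a :* s :+ b :* s′) :+ (a :* x :+ b :* y)) refl
             (sq (suc z)) (S M (suc z)) (weight M * D (suc M) (suc z)) (q * q * sq z) (S M z) (weight M * D (suc M) z) ⟩
      (sq (suc z) * S M (suc z) + q * q * sq z * S M z) + (sq (suc z) * (weight M * D (suc M) (suc z)) + q * q * sq z * (weight M * D (suc M) z))
        ≈⟨ +-cong (S-recurrence M z) (S-step M z) ⟩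
      (B M z + [Q] z) + (B (suc M) z + B M z)
        ≈⟨ solve 3 (λ a e b → (a :+ e) :+ (b :+ a) := b :+ e) refl (B M z) ([Q] z) (B (suc M) z) ⟩
      B (suc M) z + [Q] z ∎

    -- Congruences modulo powers of Q

    infix 4 _≈_[mod_]
    _≈_[mod_] : Carrier → Carrier → ℕ → Set
    x ≈ y [mod M ] = Σ Carrier λ e → x ≈ y + Q^ M * e

    -- The value of `S M 0` never matters, since its coefficient contains (1 + 1)² = 0; the term
    -- `[Q]` starts the induction, and each further step multiplies by Q up to a boundary term.
    sq-S : ∀ M z → sq (suc z) * S M (suc z) ≈ Q^ (suc z) [mod suc M ]
    sq-S M zero = e , (begin
      sq 1 * S M 1
        ≈⟨ solve 3 (λ x q s → x := (x :+ q :* q :* ((con true :+ con true) :* (con true :+ con true)) :* s)) refl (sq 1 * S M 1) q (S M 0) ⟩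
      sq 1 * S M 1 + q * q * sq 0 * S M 0
        ≈⟨ S-recurrence M 0 ⟩
      B M 0 + q * q
        ≈⟨ solve 5 (λ p N a b q → p :* p :* N :* a :* b :+ q :* q := q :* q :* con true :+ N :* (p :* p :* a :* b)) refl (poch M) (Q^ (suc M)) (1# + q * q * (1# * 1#)) (ι M * ι (suc (M ℕ.+ 0))) q ⟩
      Q^ 1 + Q^ (suc M) * e ∎)
      where e = poch M * poch M * (1# + q * q * (1# * 1#)) * (ι M * ι (suc (M ℕ.+ 0)))
    sq-S M (suc z) with sq-S M z
    ... | e , p = e′ , (begin
      sq (2 ℕ.+ z) * S M (2 ℕ.+ z)
        ≈⟨ +≈0⇒≈ (begin
             sq (2 ℕ.+ z) * S M (2 ℕ.+ z) + (q * q * (sq (suc z) * S M (suc z)) + B M (suc z))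
               ≈⟨ solve 5 (λ x a b c d → x :+ (a :* (b :* c) :+ d) := (x :+ a :* b :* c) :+ d) refl (sq (2 ℕ.+ z) * S M (2 ℕ.+ z)) (q * q) (sq (suc z)) (S M (suc z)) (B M (suc z)) ⟩
             (sq (2 ℕ.+ z) * S M (2 ℕ.+ z) + q * q * sq (suc z) * S M (suc z)) + B M (suc z)
               ≈⟨ +-congʳ (S-recurrence M (suc z)) ⟩
             (B M (suc z) + 0#) + B M (suc z)
               ≈⟨ solve 1 (λ b → (b :+ con false) :+ b := con false) refl (B M (suc z)) ⟩
             0# ∎) ⟩
      q * q * (sq (suc z) * S M (suc z)) + B M (suc z)
        ≈⟨ +-congʳ (*-congˡ p) ⟩
      q * q * (Q^ (suc z) + Q^ (suc M) * e) + B M (suc z)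
        ≈⟨ solve 7 (λ q Z e P N a b → q :* q :* (Z :+ N :* e) :+ P :* P :* N :* a :* b := q :* q :* Z :+ N :* (q :* q :* e :+ P :* P :* a :* b)) refl q (Q^ (suc z)) e (poch M) (Q^ (suc M)) (1# + q * q * (Q^ (suc z) * Q^ (suc z))) (ι⁻ M (suc z) * ι (suc (M ℕ.+ suc z))) ⟩
      Q^ (2 ℕ.+ z) + Q^ (suc M) * e′ ∎)
      where e′ = q * q * e + poch M * poch M * (1# + q * q * (Q^ (suc z) * Q^ (suc z))) * (ι⁻ M (suc z) * ι (suc (M ℕ.+ suc z)))

    ∑-mod : ∀ n M {f g : ℕ → Carrier} → (∀ i → f i ≈ g i [mod M ]) → ∑ n f ≈ ∑ n g [mod M ]
    ∑-mod zero    M p = p 0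
    ∑-mod (suc n) M {f} {g} p with ∑-mod n M p | p (suc n)
    ... | e , x | e′ , y = e + e′ , trans (+-cong x y)
      (solve 5 (λ a b c e e′ → (a :+ c :* e) :+ (b :+ c :* e′) := (a :+ b) :+ c :* (e :+ e′)) refl (∑ n g) (g (suc n)) (Q^ M) e e′)

    PQ : ℕ → Carrier
    PQ z = P z * Q^ z

    -- In characteristic 2 the factor 1 + Q^(2z) is `sq z`, so `sq-S` applies; at z = 0 the factor
    -- `P 0` is zero.
    summand : ∀ M z → P z * (1# + Q^ z * Q^ z) * S M z ≈ PQ z [mod suc M ]
    summand M zero = 0# , solve 3 (λ a s m → con false :* a :* s := con false :* con true :+ m :* con false) refl (1# + 1# * 1#) (S M 0) (Q^ (suc M))
    summand M (suc z) with sq-S M z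
    ... | e , p = P (suc z) * e , (begin
      P (suc z) * (1# + Z * Z) * S M (suc z)
        ≈⟨ solve 3 (λ p z s → p :* (con true :+ z :* z) :* s := p :* ((con true :+ z) :* (con true :+ z) :* s)) refl (P (suc z)) Z (S M (suc z)) ⟩
      P (suc z) * (sq (suc z) * S M (suc z))
        ≈⟨ *-congˡ p ⟩
      P (suc z) * (Z + Q^ (suc M) * e)
        ≈⟨ solve 4 (λ p z m e → p :* (z :+ m :* e) := p :* z :+ m :* (p :* e)) refl (P (suc z)) Z (Q^ (suc M)) e ⟩
      P (suc z) * Z + Q^ (suc M) * (P (suc z) * e) ∎)
      where Z = Q^ (suc z)

    S≈∑ : ∀ M z → S (suc M) z ≈ ∑ M (λ n → weight n * D (suc n) z)
    S≈∑ zero    z = +-identityˡ _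
    S≈∑ (suc M) z = +-congʳ (S≈∑ M z)

    κ-sum : ∀ n k → κ (suc n) ≈ ∑ (k ℕ.+ suc n) (r (suc n))
    κ-sum n k = sym (trans (∑-zero-tail (suc n) k _ (λ z p → trans (*-congˡ (D-zero p)) (zeroʳ _))) (κ-expansion n))

    -- Every row is padded with zeros up to z = M + 1, so the double sum is rectangular and its
    -- order can be exchanged.
    hecke-expansion : ∀ M → ∑ M (λ n → weight n * κ (suc n)) ≈ ∑ (suc M) PQ [mod 2 ℕ.+ M ]
    hecke-expansion M = proj₁ PS≈PQ , trans exact (proj₂ PS≈PQ)
      where
      PS : ℕ → Carrier
      PS z = P z * (1# + Q^ z * Q^ z) * S (suc M) z

      PS≈PQ : ∑ (suc M) PS ≈ ∑ (suc M) PQ [mod 2 ℕ.+ M ]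
      PS≈PQ = ∑-mod (suc M) (2 ℕ.+ M) {PS} {PQ} (summand (suc M))

      wr : ℕ → ℕ → Carrier
      wr n z = weight n * r (suc n) z

      row : ∀ n → n ℕ.≤ M → weight n * κ (suc n) ≈ ∑ (suc M) (wr n)
      row n n≤M with ℕₚ.m≤n⇒∃[o]m+o≡n (s≤s n≤M)
      ... | k , eq = begin
        weight n * κ (suc n)
          ≈⟨ *-congˡ (κ-sum n k) ⟩
        weight n * ∑ (k ℕ.+ suc n) (r (suc n))
          ≡⟨ ≡.cong (λ x → weight n * ∑ x (r (suc n))) (≡.trans (ℕₚ.+-comm k (suc n)) eq) ⟩
        weight n * ∑ (suc M) (r (suc n))
          ≈⟨ ∑-*ˡ (suc M) (weight n) (r (suc n)) ⟨
        ∑ (suc M) (wr n) ∎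

      column : ∀ z → ∑ M (λ n → wr n z) ≈ PS z
      column z = begin
        ∑ M (λ n → wr n z)
          ≈⟨ ∑-cong M {λ n → wr n z} {λ n → a * (weight n * D (suc n) z)} (λ n _ → solve 3 (λ a b c → a :* (b :* c) := b :* (a :* c)) refl (weight n) a (D (suc n) z)) ⟩
        ∑ M (λ n → a * (weight n * D (suc n) z))
          ≈⟨ ∑-*ˡ M a (λ n → weight n * D (suc n) z) ⟩
        a * ∑ M (λ n → weight n * D (suc n) z)
          ≈⟨ *-congˡ (S≈∑ M z) ⟨
        PS z ∎
        where a = P z * (1# + Q^ z * Q^ z)

      exact : ∑ M (λ n → weight n * κ (suc n)) ≈ ∑ (suc M) PS
      exact = begin
        ∑ M (λ n → weight n * κ (suc n))
          ≈⟨ ∑-cong M {λ n → weight n * κ (suc n)} {λ n → ∑ (suc M) (wr n)} row ⟩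
        ∑ M (λ n → ∑ (suc M) (wr n))
          ≈⟨ ∑-swap M (suc M) wr ⟩
        ∑ (suc M) (λ z → ∑ M (λ n → wr n z))
          ≈⟨ ∑-cong (suc M) {λ z → ∑ M (λ n → wr n z)} {PS} (λ z _ → column z) ⟩
        ∑ (suc M) PS ∎

    PQ-suc : ∀ z → PQ (suc z) ≈ q * (q * (q * (Q^ z * (Q^ z * Q^ z)))) * PQ z + (q * (q * (Q^ z * θ z)) + q * (q * (q * (Q^ z * (Q^ z * θ z)))))
    PQ-suc z = solve 4 (λ q W p t → (q :* (W :* W :* W) :* p :+ t :* (con true :+ q :* W)) :* (q :* q :* W)
      := q :* (q :* (q :* (W :* (W :* W)))) :* (p :* W) :+ (q :* (q :* (W :* t)) :+ q :* (q :* (q :* (W :* (W :* t)))))) refl q (Q^ z) (P z) (θ z)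

open import Relation.Binary.PropositionalEquality hiding ([_])

-- Parity as a homomorphism to 𝔽₂

module 𝔹 = CommutativeRing xor-∧-commutativeRing
open import Algebra.Properties.CommutativeSemigroup (CommutativeMonoid.commutativeSemigroup 𝔹.+-commutativeMonoid) using (interchange)

odd : ℕ → Bool
odd zero    = false
odd (suc n) = not (odd n)

odd-+ : ∀ m n → odd (m ℕ.+ n) ≡ odd m xor odd n
odd-+ zero    n = refl
odd-+ (suc m) n = trans (cong not (odd-+ m n)) (not-distribˡ-xor (odd m) (odd n))

odd-* : ∀ m n → odd (m ℕ.* n) ≡ odd m ∧ odd n
odd-* zero    n = refl
odd-* (suc m) n = trans (odd-+ n (m ℕ.* n)) (trans (cong (odd n xor_) (odd-* m n)) (lem (odd m) (odd n)))
  where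
  lem : ∀ x y → y xor (x ∧ y) ≡ not x ∧ y
  lem false y     = xor-identityʳ y
  lem true  false = refl
  lem true  true  = refl

-- Power series over 𝔽₂

module 𝔽₂-Series where

  open import Data.Nat using (_∸_; _≤?_; _<_; _≤_)

  Ser : Set
  Ser = ℕ → Bool

  tail : Ser → Ser
  tail f n = f (suc n)

  infixl 6 _⊕_
  infixl 7 _⊛₂_

  -- The Cauchy product by recursion on the degree, splitting off the constant term of the left
  -- factor; the ring laws then follow by induction, without double sums.
  _⊕_ _⊛₂_ : Ser → Ser → Ser
  (f ⊕ g) n        = f n xor g n
  (f ⊛₂ g) zero    = f 0 ∧ g 0
  (f ⊛₂ g) (suc n) = (f 0 ∧ g (suc n)) xor (tail f ⊛₂ g) n

  0ₛ 1ₛ q : Ser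
  0ₛ _       = false
  1ₛ zero    = true
  1ₛ (suc _) = false
  q zero     = false
  q (suc n)  = 1ₛ n

  ⊛₂-cong : ∀ {f f′ g g′} → f ≗ f′ → g ≗ g′ → f ⊛₂ g ≗ f′ ⊛₂ g′
  ⊛₂-cong p r zero    = cong₂ _∧_ (p 0) (r 0)
  ⊛₂-cong p r (suc n) = cong₂ _xor_ (cong₂ _∧_ (p 0) (r (suc n))) (⊛₂-cong (p ∘ suc) r n)

  ⊛₂-sucʳ : ∀ f g n → (f ⊛₂ g) (suc n) ≡ (f ⊛₂ tail g) n xor (f (suc n) ∧ g 0)
  ⊛₂-sucʳ f g zero    = refl
  ⊛₂-sucʳ f g (suc n) = trans (cong ((f 0 ∧ g (2 ℕ.+ n)) xor_) (⊛₂-sucʳ (tail f) g n)) (sym (xor-assoc (f 0 ∧ g (2 ℕ.+ n)) _ _))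

  ⊛₂-comm : ∀ f g → f ⊛₂ g ≗ g ⊛₂ f
  ⊛₂-comm f g zero    = ∧-comm (f 0) (g 0)
  ⊛₂-comm f g (suc n) = begin
    (f 0 ∧ g (suc n)) xor (tail f ⊛₂ g) n ≡⟨ cong₂ _xor_ (∧-comm (f 0) _) (⊛₂-comm (tail f) g n) ⟩
    (g (suc n) ∧ f 0) xor (g ⊛₂ tail f) n ≡⟨ xor-comm (g (suc n) ∧ f 0) _ ⟩
    (g ⊛₂ tail f) n xor (g (suc n) ∧ f 0) ≡⟨ ⊛₂-sucʳ g f n ⟨
    (g ⊛₂ f) (suc n) ∎
    where open ≡-Reasoning

  ⊛₂-distribʳ : ∀ h f g → (f ⊕ g) ⊛₂ h ≗ (f ⊛₂ h) ⊕ (g ⊛₂ h)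
  ⊛₂-distribʳ h f g zero    = 𝔹.distribʳ (h 0) (f 0) (g 0)
  ⊛₂-distribʳ h f g (suc n) = begin
    ((f 0 xor g 0) ∧ h (suc n)) xor ((tail f ⊕ tail g) ⊛₂ h) n
      ≡⟨ cong₂ _xor_ (𝔹.distribʳ (h (suc n)) (f 0) (g 0)) (⊛₂-distribʳ h (tail f) (tail g) n) ⟩
    ((f 0 ∧ h (suc n)) xor (g 0 ∧ h (suc n))) xor ((tail f ⊛₂ h) n xor (tail g ⊛₂ h) n)
      ≡⟨ interchange (f 0 ∧ h (suc n)) _ _ _ ⟩
    (f ⊛₂ h) (suc n) xor (g ⊛₂ h) (suc n) ∎
    where open ≡-Reasoning

  ⊛₂-scale : ∀ a f g n → ((λ k → a ∧ f k) ⊛₂ g) n ≡ a ∧ (f ⊛₂ g) n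
  ⊛₂-scale a f g zero    = ∧-assoc a (f 0) (g 0)
  ⊛₂-scale a f g (suc n) = trans (cong₂ _xor_ (∧-assoc a (f 0) _) (⊛₂-scale a (tail f) g n)) (sym (𝔹.distribˡ a _ _))

  ⊛₂-assoc : ∀ f g h → (f ⊛₂ g) ⊛₂ h ≗ f ⊛₂ (g ⊛₂ h)
  ⊛₂-assoc f g h zero    = ∧-assoc (f 0) (g 0) (h 0)
  ⊛₂-assoc f g h (suc n) = begin
    ((f 0 ∧ g 0) ∧ h (suc n)) xor (((λ k → f 0 ∧ tail g k) ⊕ (tail f ⊛₂ g)) ⊛₂ h) n
      ≡⟨ cong₂ _xor_ (∧-assoc (f 0) _ _) (⊛₂-distribʳ h _ (tail f ⊛₂ g) n) ⟩
    (f 0 ∧ (g 0 ∧ h (suc n))) xor (((λ k → f 0 ∧ tail g k) ⊛₂ h) n xor ((tail f ⊛₂ g) ⊛₂ h) n)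
      ≡⟨ cong ((f 0 ∧ (g 0 ∧ h (suc n))) xor_) (cong₂ _xor_ (⊛₂-scale (f 0) (tail g) h n) (⊛₂-assoc (tail f) g h n)) ⟩
    (f 0 ∧ (g 0 ∧ h (suc n))) xor ((f 0 ∧ (tail g ⊛₂ h) n) xor (tail f ⊛₂ (g ⊛₂ h)) n)
      ≡⟨ xor-assoc (f 0 ∧ (g 0 ∧ h (suc n))) _ _ ⟨
    ((f 0 ∧ (g 0 ∧ h (suc n))) xor (f 0 ∧ (tail g ⊛₂ h) n)) xor (tail f ⊛₂ (g ⊛₂ h)) n
      ≡⟨ cong (_xor (tail f ⊛₂ (g ⊛₂ h)) n) (𝔹.distribˡ (f 0) _ _) ⟨
    (f ⊛₂ (g ⊛₂ h)) (suc n) ∎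
    where open ≡-Reasoning

  ⊛₂-zeroˡ : ∀ f → 0ₛ ⊛₂ f ≗ 0ₛ
  ⊛₂-zeroˡ f zero    = refl
  ⊛₂-zeroˡ f (suc n) = ⊛₂-zeroˡ f n

  ⊛₂-identityˡ : ∀ f → 1ₛ ⊛₂ f ≗ f
  ⊛₂-identityˡ f zero    = refl
  ⊛₂-identityˡ f (suc n) = trans (cong (f (suc n) xor_) (⊛₂-zeroˡ f n)) (xor-identityʳ _)

  𝔽₂[[q]] : CommutativeRing 0ℓ 0ℓ
  𝔽₂[[q]] = record
    { Carrier = Ser
    ; _≈_ = _≗_
    ; _+_ = _⊕_
    ; _*_ = _⊛₂_
    ; -_ = λ f → f
    ; 0# = 0ₛ
    ; 1# = 1ₛ
    ; isCommutativeRing = record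
      { isRing = record
        { +-isAbelianGroup = record
          { isGroup = record
            { isMonoid = record
              { isSemigroup = record
                { isMagma = record
                  { isEquivalence = record { refl = λ _ → refl ; sym = λ p n → sym (p n) ; trans = λ p r n → trans (p n) (r n) }
                  ; ∙-cong = λ p r n → cong₂ _xor_ (p n) (r n) }
                ; assoc = λ f g h n → xor-assoc (f n) (g n) (h n) }
              ; identity = (λ f n → refl) , (λ f n → xor-identityʳ (f n)) }
            ; inverse = (λ f n → xor-same (f n)) , (λ f n → xor-same (f n))
            ; ⁻¹-cong = λ p → p }
          ; comm = λ f g n → xor-comm (f n) (g n) }
        ; *-cong = ⊛₂-cong
        ; *-assoc = ⊛₂-assoc
        ; *-identity = ⊛₂-identityˡ , λ f n → trans (⊛₂-comm f 1ₛ n) (⊛₂-identityˡ f n)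
        ; distrib = (λ f g h n → trans (⊛₂-comm f (g ⊕ h) n) (trans (⊛₂-distribʳ f g h n) (cong₂ _xor_ (⊛₂-comm g f n) (⊛₂-comm h f n)))) , ⊛₂-distribʳ
        }
      ; *-comm = ⊛₂-comm
      }
    }

  module R = CommutativeRing 𝔽₂[[q]]
  open import Algebra.Properties.Semiring.Exp R.semiring using (_^_; ^-homo-*) public

  1+1≗0 : 1ₛ ⊕ 1ₛ ≗ 0ₛ
  1+1≗0 zero    = refl
  1+1≗0 (suc _) = refl

  open CharTwo 𝔽₂[[q]] 1+1≗0 using (cancel-unit; ∑; module HeckeSum) public

  -- The defining series modulo 2

  shift-< : ∀ {k n} (f : Series) → n < k → shift k f n ≡ 0
  shift-< {k} {n} f n<k with k ≤? n
  ... | yes k≤n = ⊥-elim (ℕₚ.<⇒≱ n<k k≤n)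
  ... | no  _   = refl

  shift-+ : ∀ k n (f : Series) → shift k f (k ℕ.+ n) ≡ f n
  shift-+ k n f with k ≤? k ℕ.+ n
  ... | yes _ = cong f (ℕₚ.m+n∸m≡n k n)
  ... | no ¬p = ⊥-elim (¬p (ℕₚ.m≤m+n k n))

  shift₂ : ℕ → Ser → Ser
  shift₂ zero    f         = f
  shift₂ (suc k) f zero    = false
  shift₂ (suc k) f (suc n) = shift₂ k f n

  shift₂-< : ∀ {k n} (f : Ser) → n < k → shift₂ k f n ≡ false
  shift₂-< {suc k} {zero}  f _       = refl
  shift₂-< {suc k} {suc n} f (s≤s p) = shift₂-< f p

  shift₂-+ : ∀ k n (f : Ser) → shift₂ k f (k ℕ.+ n) ≡ f n
  shift₂-+ zero    n f = refl
  shift₂-+ (suc k) n f = shift₂-+ k n f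

  data Position (k : ℕ) : ℕ → Set where
    before : ∀ {n} → n < k → Position k n
    beyond : ∀ m → Position k (k ℕ.+ m)

  position : ∀ k n → Position k n
  position k n with ℕₚ.<-≤-connex n k
  ... | inj₁ n<k = before n<k
  ... | inj₂ k≤n with ℕₚ.m≤n⇒∃[o]m+o≡n k≤n
  ...   | m , refl = beyond m

  odd-shift : ∀ k f → odd ∘ shift k f ≗ shift₂ k (odd ∘ f)
  odd-shift k f n with position k n
  ... | before n<k = trans (cong odd (shift-< f n<k)) (sym (shift₂-< (odd ∘ f) n<k))
  ... | beyond m   = trans (cong odd (shift-+ k m f)) (sym (shift₂-+ k m (odd ∘ f)))

  q-⊛₂ : ∀ f → q ⊛₂ f ≗ shift₂ 1 f
  q-⊛₂ f zero    = refl
  q-⊛₂ f (suc n) = ⊛₂-identityˡ f n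

  q^-⊛₂ : ∀ k f → (q ^ k) ⊛₂ f ≗ shift₂ k f
  q^-⊛₂ zero    f n = ⊛₂-identityˡ f n
  q^-⊛₂ (suc k) f n = trans (⊛₂-assoc q (q ^ k) f n) (trans (q-⊛₂ (q ^ k ⊛₂ f) n) (lem n))
    where
    lem : shift₂ 1 (q ^ k ⊛₂ f) ≗ shift₂ (suc k) f
    lem zero    = refl
    lem (suc n) = q^-⊛₂ k f n

  Q^≗q^ : ∀ k → (q ⊛₂ q) ^ k ≗ q ^ (2 ℕ.* k)
  Q^≗q^ zero    = R.refl
  Q^≗q^ (suc k) = begin
    q ⊛₂ q ⊛₂ (q ⊛₂ q) ^ k ≈⟨ R.*-congˡ {q ⊛₂ q} (Q^≗q^ k) ⟩
    q ⊛₂ q ⊛₂ q ^ (2 ℕ.* k) ≈⟨ R.*-assoc q q _ ⟩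
    q ^ (2 ℕ.+ 2 ℕ.* k)     ≡⟨ cong (q ^_) (ℕₚ.*-suc 2 k) ⟨
    q ^ (2 ℕ.* suc k)       ∎
    where open SetoidReasoning R.setoid

  odd-onePlus : ∀ k f → odd ∘ onePlus k f ≗ (1ₛ ⊕ q ^ k) ⊛₂ (odd ∘ f)
  odd-onePlus k f n = begin
    odd (f n ℕ.+ shift k f n)                          ≡⟨ odd-+ (f n) _ ⟩
    odd (f n) xor odd (shift k f n)                    ≡⟨ cong₂ _xor_ (sym (⊛₂-identityˡ (odd ∘ f) n)) (trans (odd-shift k f n) (sym (q^-⊛₂ k (odd ∘ f) n))) ⟩
    (1ₛ ⊛₂ (odd ∘ f)) n xor (q ^ k ⊛₂ (odd ∘ f)) n      ≡⟨ ⊛₂-distribʳ (odd ∘ f) 1ₛ (q ^ k) n ⟨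
    ((1ₛ ⊕ q ^ k) ⊛₂ (odd ∘ f)) n                      ∎
    where open ≡-Reasoning

  sumTo-cong : ∀ n {f g : ℕ → ℕ} → (∀ i → i ≤ n → f i ≡ g i) → sumTo n f ≡ sumTo n g
  sumTo-cong zero    p = p 0 z≤n
  sumTo-cong (suc n) p = cong₂ ℕ._+_ (sumTo-cong n (λ i i≤n → p i (ℕₚ.m≤n⇒m≤1+n i≤n))) (p (suc n) ℕₚ.≤-refl)

  sumTo-suc : ∀ n (f : ℕ → ℕ) → sumTo (suc n) f ≡ f 0 ℕ.+ sumTo n (f ∘ suc)
  sumTo-suc zero    f = refl
  sumTo-suc (suc n) f = trans (cong (ℕ._+ f (2 ℕ.+ n)) (sumTo-suc n f)) (ℕₚ.+-assoc (f 0) _ _)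

  sumTo-zero : ∀ n {f : ℕ → ℕ} → (∀ i → f i ≡ 0) → sumTo n f ≡ 0
  sumTo-zero zero    p = p 0
  sumTo-zero (suc n) p = cong₂ ℕ._+_ (sumTo-zero n p) (p (suc n))

  sumTo-zero-tail : ∀ n k {f : ℕ → ℕ} → (∀ i → n < i → f i ≡ 0) → sumTo (k ℕ.+ n) f ≡ sumTo n f
  sumTo-zero-tail n zero    p = refl
  sumTo-zero-tail n (suc k) p = trans (cong₂ ℕ._+_ (sumTo-zero-tail n k p) (p _ (s≤s (ℕₚ.m≤n+m n k)))) (ℕₚ.+-identityʳ _)

  odd-⊛ : ∀ f g → odd ∘ (f ⊛ g) ≗ (odd ∘ f) ⊛₂ (odd ∘ g)
  odd-⊛ f g zero    = odd-* (f 0) (g 0)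
  odd-⊛ f g (suc n) = begin
    odd ((f ⊛ g) (suc n))                                          ≡⟨ cong odd (sumTo-suc n (λ i → f i ℕ.* g (suc n ∸ i))) ⟩
    odd (f 0 ℕ.* g (suc n) ℕ.+ ((f ∘ suc) ⊛ g) n)                  ≡⟨ odd-+ (f 0 ℕ.* g (suc n)) _ ⟩
    odd (f 0 ℕ.* g (suc n)) xor odd (((f ∘ suc) ⊛ g) n)            ≡⟨ cong₂ _xor_ (odd-* (f 0) _) (odd-⊛ (f ∘ suc) g n) ⟩
    ((odd ∘ f) ⊛₂ (odd ∘ g)) (suc n)                               ∎
    where open ≡-Reasoning

  shift-shift : ∀ a b (f : Series) n → shift (a ℕ.+ b) f n ≡ shift a (shift b f) n
  shift-shift a b f n with position a n
  ... | before n<a = trans (shift-< f (ℕₚ.<-≤-trans n<a (ℕₚ.m≤m+n a b))) (sym (shift-< (shift b f) n<a))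
  ... | beyond m with position b m
  ...   | before m<b = trans (shift-< f (ℕₚ.+-monoʳ-< a m<b)) (sym (trans (shift-+ a m (shift b f)) (shift-< f m<b)))
  ...   | beyond l   = begin
    shift (a ℕ.+ b) f (a ℕ.+ (b ℕ.+ l)) ≡⟨ cong (shift (a ℕ.+ b) f) (ℕₚ.+-assoc a b l) ⟨
    shift (a ℕ.+ b) f (a ℕ.+ b ℕ.+ l)   ≡⟨ shift-+ (a ℕ.+ b) l f ⟩
    f l                                 ≡⟨ shift-+ b l f ⟨
    shift b f (b ℕ.+ l)                 ≡⟨ shift-+ a (b ℕ.+ l) (shift b f) ⟨
    shift a (shift b f) (a ℕ.+ (b ℕ.+ l)) ∎
    where open ≡-Reasoning

  -- The summand j = 0 is f, and the remaining ones are the same sum shifted by k + 1: this is (1 -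
  -- q^(k+1)) g = f without subtraction.
  geomDiv-recurrence : ∀ k f n → geomDiv (suc k) f n ≡ f n ℕ.+ shift (suc k) (geomDiv (suc k) f) n
  geomDiv-recurrence k f zero    = sym (ℕₚ.+-identityʳ _)
  geomDiv-recurrence k f (suc n) = begin
    sumTo (suc n) (λ j → shift (j ℕ.* K) f (suc n))                ≡⟨ sumTo-suc n (λ j → shift (j ℕ.* K) f (suc n)) ⟩
    f (suc n) ℕ.+ sumTo n (λ j → shift (K ℕ.+ j ℕ.* K) f (suc n))  ≡⟨ cong (f (suc n) ℕ.+_) (sumTo-cong n (λ j _ → shift-shift K (j ℕ.* K) f (suc n))) ⟩
    f (suc n) ℕ.+ sumTo n (λ j → shift K (shift (j ℕ.* K) f) (suc n)) ≡⟨ cong (f (suc n) ℕ.+_) rest ⟩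
    f (suc n) ℕ.+ shift K (geomDiv K f) (suc n) ∎
    where
    open ≡-Reasoning
    K = suc k
    rest : sumTo n (λ j → shift K (shift (j ℕ.* K) f) (suc n)) ≡ shift K (geomDiv K f) (suc n)
    rest with suc n in eq | position K (suc n)
    ... | N | before N<K = trans (sumTo-zero n (λ j → shift-< (shift (j ℕ.* K) f) N<K)) (sym (shift-< (geomDiv K f) N<K))
    ... | .(K ℕ.+ m) | beyond m with ℕₚ.suc-injective eq
    ...   | refl = begin
      sumTo (k ℕ.+ m) (λ j → shift K (shift (j ℕ.* K) f) (K ℕ.+ m)) ≡⟨ sumTo-cong (k ℕ.+ m) (λ j _ → shift-+ K m (shift (j ℕ.* K) f)) ⟩
      -- Indices above m contribute nothing in degree m, so the range shrinks to the one in
      -- `geomDiv K f m`.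
      sumTo (k ℕ.+ m) (λ j → shift (j ℕ.* K) f m)                   ≡⟨ sumTo-zero-tail m k (λ j m<j → shift-< f (ℕₚ.<-≤-trans m<j (ℕₚ.m≤m*n j K))) ⟩
      geomDiv K f m                                                 ≡⟨ shift-+ K m (geomDiv K f) ⟨
      shift K (geomDiv K f) (K ℕ.+ m)                               ∎

  odd-geomDiv : ∀ k f → (1ₛ ⊕ q ^ suc k) ⊛₂ (odd ∘ geomDiv (suc k) f) ≗ odd ∘ f
  odd-geomDiv k f n = begin
    ((1ₛ ⊕ q ^ suc k) ⊛₂ (odd ∘ g)) n                          ≡⟨ odd-onePlus (suc k) g n ⟨
    odd (g n ℕ.+ shift (suc k) g n)                            ≡⟨ cong (λ x → odd (x ℕ.+ shift (suc k) g n)) (geomDiv-recurrence k f n) ⟩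
    odd (f n ℕ.+ shift (suc k) g n ℕ.+ shift (suc k) g n)      ≡⟨ trans (odd-+ (f n ℕ.+ s) s) (cong (_xor odd s) (odd-+ (f n) s)) ⟩
    (odd (f n) xor odd s) xor odd s                            ≡⟨ xor-assoc (odd (f n)) (odd s) (odd s) ⟩
    odd (f n) xor (odd s xor odd s)                            ≡⟨ cong (odd (f n) xor_) (xor-same (odd s)) ⟩
    odd (f n) xor false                                        ≡⟨ xor-identityʳ (odd (f n)) ⟩
    odd (f n) ∎
    where
    open ≡-Reasoning
    g = geomDiv (suc k) f
    s = shift (suc k) g n

  odd-one : odd ∘ one ≗ 1ₛ
  odd-one zero    = refl
  odd-one (suc _) = refl

  -- The geometric series of 1/(1 - q^(2k+2)) and 1/(1 - q^(2k+1)) supply the inverses that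
  -- `HeckeSum` asks for.
  u v : ℕ → Ser
  u k = odd ∘ geomDiv (2 ℕ.* suc k) one
  v k = odd ∘ geomDiv (suc (2 ℕ.* k)) one

  u-inverse : ∀ k → (1ₛ ⊕ (q ⊛₂ q) ^ suc k) ⊛₂ u k ≗ 1ₛ
  u-inverse k = R.trans (R.*-congʳ (R.+-congˡ {1ₛ} (Q^≗q^ (suc k)))) (R.trans (odd-geomDiv _ one) odd-one)

  v-inverse : ∀ k → (1ₛ ⊕ q ⊛₂ (q ⊛₂ q) ^ k) ⊛₂ v k ≗ 1ₛ
  v-inverse k = R.trans (R.*-congʳ (R.+-congˡ {1ₛ} (R.*-congˡ {q} (Q^≗q^ k)))) (R.trans (odd-geomDiv _ one) odd-one)

  open HeckeSum q u v u-inverse v-inverse using (Q^; poch; κ; κ-suc; weight; θ; PQ; PQ-suc; hecke-expansion) public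

  -- Modulo 2 the sign is lost, and (-q²;q²)_n becomes (Q;Q)_n.
  odd-negq2q2 : ∀ n → odd ∘ negq2q2 n ≗ poch n
  odd-negq2q2 zero    = odd-one
  odd-negq2q2 (suc n) = begin
    odd ∘ onePlus (2 ℕ.* n ℕ.+ 2) (negq2q2 n)          ≈⟨ odd-onePlus (2 ℕ.* n ℕ.+ 2) (negq2q2 n) ⟩
    (1ₛ ⊕ q ^ (2 ℕ.* n ℕ.+ 2)) ⊛₂ (odd ∘ negq2q2 n)    ≈⟨ R.*-cong (R.+-congˡ {1ₛ} (R.reflexive (cong (q ^_) (trans (ℕₚ.+-comm (2 ℕ.* n) 2) (sym (ℕₚ.*-suc 2 n)))))) (odd-negq2q2 n) ⟩
    (1ₛ ⊕ q ^ (2 ℕ.* suc n)) ⊛₂ poch n                 ≈⟨ R.*-congʳ (R.+-congˡ {1ₛ} (Q^≗q^ (suc n))) ⟨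
    poch (suc n) ∎
    where open SetoidReasoning R.setoid

  odd-invqq2 : ∀ n → odd ∘ invqq2 n ≗ κ n
  odd-invqq2 zero    = odd-one
  odd-invqq2 (suc n) = cancel-unit (v-inverse n) (begin
    (1ₛ ⊕ q ⊛₂ (q ⊛₂ q) ^ n) ⊛₂ (odd ∘ invqq2 (suc n))   ≈⟨ R.*-cong (R.+-congˡ {1ₛ} (R.*-congˡ {q} (Q^≗q^ n))) (R.reflexive (cong (λ k → odd ∘ geomDiv k (invqq2 n)) (ℕₚ.+-comm (2 ℕ.* n) 1))) ⟩
    (1ₛ ⊕ q ^ suc (2 ℕ.* n)) ⊛₂ (odd ∘ geomDiv (suc (2 ℕ.* n)) (invqq2 n)) ≈⟨ odd-geomDiv (2 ℕ.* n) (invqq2 n) ⟩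
    odd ∘ invqq2 n                                       ≈⟨ odd-invqq2 n ⟩
    κ n                                                  ≈⟨ κ-suc n ⟩
    (1ₛ ⊕ q ⊛₂ (q ⊛₂ q) ^ n) ⊛₂ κ (suc n)                 ∎)
    where open SetoidReasoning R.setoid

  odd-term : ∀ m → odd ∘ term m ≗ weight m ⊛₂ κ (suc m)
  odd-term m = begin
    odd ∘ term m
      ≈⟨ odd-shift (2 ℕ.* suc m) ((a ⊛ a) ⊛ b) ⟩
    shift₂ (2 ℕ.* suc m) (odd ∘ ((a ⊛ a) ⊛ b))
      ≈⟨ q^-⊛₂ (2 ℕ.* suc m) (odd ∘ ((a ⊛ a) ⊛ b)) ⟨
    q ^ (2 ℕ.* suc m) ⊛₂ (odd ∘ ((a ⊛ a) ⊛ b))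
      ≈⟨ R.*-cong (R.sym (Q^≗q^ (suc m))) (R.trans (odd-⊛ (a ⊛ a) b) (R.*-cong (R.trans (odd-⊛ a a) (R.*-cong (odd-negq2q2 m) (odd-negq2q2 m))) (odd-invqq2 (suc m)))) ⟩
    Q^ (suc m) ⊛₂ (poch m ⊛₂ poch m ⊛₂ κ (suc m))
      ≈⟨ R.*-assoc (Q^ (suc m)) (poch m ⊛₂ poch m) (κ (suc m)) ⟨
    Q^ (suc m) ⊛₂ (poch m ⊛₂ poch m) ⊛₂ κ (suc m)
      ≈⟨ R.*-congʳ (R.*-comm (Q^ (suc m)) (poch m ⊛₂ poch m)) ⟩
    weight m ⊛₂ κ (suc m) ∎
    where
    open SetoidReasoning R.setoid
    a = negq2q2 m
    b = invqq2 (suc m)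

  ∑-coefficient : ∀ M n {F : ℕ → Ser} {f : ℕ → ℕ} → (∀ i → odd (f i) ≡ F i n) → odd (sumTo M f) ≡ ∑ M F n
  ∑-coefficient zero    n p = p 0
  ∑-coefficient (suc M) n {f = f} p = trans (odd-+ (sumTo M f) (f (suc M))) (cong₂ _xor_ (∑-coefficient M n p) (p (suc M)))

  -- The error in `hecke-expansion` at M = n is a multiple of q^(2n+4) and does not reach degree n.
  odd-u2 : ∀ n → odd (u2 n) ≡ ∑ (suc n) PQ n
  odd-u2 n = begin
    odd (u2 n)                                       ≡⟨ ∑-coefficient n n (λ m → odd-term m n) ⟩
    ∑ n (λ m → weight m ⊛₂ κ (suc m)) n              ≡⟨ proj₂ (hecke-expansion n) n ⟩
    ∑ (suc n) PQ n xor (Q^ (2 ℕ.+ n) ⊛₂ e) n         ≡⟨ cong (∑ (suc n) PQ n xor_) small ⟩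
    ∑ (suc n) PQ n xor false                         ≡⟨ xor-identityʳ _ ⟩
    ∑ (suc n) PQ n                                   ∎
    where
    open ≡-Reasoning
    e = proj₁ (hecke-expansion n)
    small : (Q^ (2 ℕ.+ n) ⊛₂ e) n ≡ false
    small = trans (R.*-congʳ {e} (Q^≗q^ (2 ℕ.+ n)) n) (trans (q^-⊛₂ (2 ℕ.* (2 ℕ.+ n)) e n)
      (shift₂-< e (ℕₚ.≤-trans (s≤s (ℕₚ.n≤1+n n)) (ℕₚ.m≤m+n (2 ℕ.+ n) _))))

  θ≗q^ : ∀ z → θ z ≗ q ^ (z ℕ.* z ℕ.+ z)
  θ≗q^ zero    = R.refl
  θ≗q^ (suc z) = begin
    Q^ (suc z) ⊛₂ θ z                              ≈⟨ R.*-cong (Q^≗q^ (suc z)) (θ≗q^ z) ⟩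
    q ^ (2 ℕ.* suc z) ⊛₂ q ^ (z ℕ.* z ℕ.+ z)       ≈⟨ ^-homo-* q (2 ℕ.* suc z) (z ℕ.* z ℕ.+ z) ⟨
    q ^ (2 ℕ.* suc z ℕ.+ (z ℕ.* z ℕ.+ z))          ≡⟨ cong (q ^_) (lem z) ⟩
    q ^ (suc z ℕ.* suc z ℕ.+ suc z)                ∎
    where
    open SetoidReasoning R.setoid
    lem : ∀ z → 2 ℕ.* suc z ℕ.+ (z ℕ.* z ℕ.+ z) ≡ suc z ℕ.* suc z ℕ.+ suc z
    lem = solve-∀

  -- The step z ↦ z + 1 adds 6z + 3 to each exponent 3z² - j(j+1)/2 with j < 2z, and
  -- contributes those of j = 2z + 1 and j = 2z.
  PQ-coefficient : ∀ z n → PQ (suc z) n ≡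
    shift₂ (6 ℕ.* z ℕ.+ 3) (PQ z) n xor ((q ^ (z ℕ.* z ℕ.+ 3 ℕ.* z ℕ.+ 2)) n xor (q ^ (z ℕ.* z ℕ.+ 5 ℕ.* z ℕ.+ 3)) n)
  PQ-coefficient z n = trans (PQ-suc z n)
    (cong₂ _xor_ (trans (R.*-congʳ {PQ z} old n) (q^-⊛₂ (6 ℕ.* z ℕ.+ 3) (PQ z) n)) (cong₂ _xor_ (new₁ n) (new₂ n)))
    where
    open SetoidReasoning R.setoid
    W = Q^ z
    w = 2 ℕ.* z
    t = z ℕ.* z ℕ.+ z
    times-W : ∀ {f} k → f ≗ q ^ k → W ⊛₂ f ≗ q ^ (w ℕ.+ k)
    times-W {f} k p = R.trans (R.*-cong (Q^≗q^ z) p) (R.sym (^-homo-* q w k))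
    times-q : ∀ {f g} → f ≗ g → q ⊛₂ f ≗ q ⊛₂ g
    times-q p = R.*-congˡ {q} p
    old : q ⊛₂ (q ⊛₂ (q ⊛₂ (W ⊛₂ (W ⊛₂ W)))) ≗ q ^ (6 ℕ.* z ℕ.+ 3)
    old = R.trans (times-q (times-q (times-q (times-W (w ℕ.+ w) (times-W w (Q^≗q^ z)))))) (R.reflexive (cong (q ^_) (eq z)))
      where
      eq : ∀ z → 3 ℕ.+ (2 ℕ.* z ℕ.+ (2 ℕ.* z ℕ.+ 2 ℕ.* z)) ≡ 6 ℕ.* z ℕ.+ 3
      eq = solve-∀
    new₁ : q ⊛₂ (q ⊛₂ (W ⊛₂ θ z)) ≗ q ^ (z ℕ.* z ℕ.+ 3 ℕ.* z ℕ.+ 2)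
    new₁ = R.trans (times-q (times-q (times-W t (θ≗q^ z)))) (R.reflexive (cong (q ^_) (eq z)))
      where
      eq : ∀ z → 2 ℕ.+ (2 ℕ.* z ℕ.+ (z ℕ.* z ℕ.+ z)) ≡ z ℕ.* z ℕ.+ 3 ℕ.* z ℕ.+ 2
      eq = solve-∀
    new₂ : q ⊛₂ (q ⊛₂ (q ⊛₂ (W ⊛₂ (W ⊛₂ θ z)))) ≗ q ^ (z ℕ.* z ℕ.+ 5 ℕ.* z ℕ.+ 3)
    new₂ = R.trans (times-q (times-q (times-q (times-W (w ℕ.+ t) (times-W t (θ≗q^ z)))))) (R.reflexive (cong (q ^_) (eq z)))
      where
      eq : ∀ z → 3 ℕ.+ (2 ℕ.* z ℕ.+ (2 ℕ.* z ℕ.+ (z ℕ.* z ℕ.+ z))) ≡ z ℕ.* z ℕ.+ 5 ℕ.* z ℕ.+ 3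
      eq = solve-∀

-- Parities of finite sets

open import Data.List using (List; []; _∷_; _++_; length; map; filter; upTo; cartesianProduct)
open import Data.List.Properties using (length-map; length-++)
open import Data.List.Membership.Propositional using (_∈_)
open import Data.List.Membership.Propositional.Properties using (∈-map⁺; ∈-map⁻; ∈-++⁺ˡ; ∈-++⁺ʳ; ∈-++⁻; ∈-filter⁺; ∈-filter⁻; ∈-upTo⁺; ∈-cartesianProduct⁺)
open import Data.List.Membership.Propositional.Properties.WithK using (unique∧set⇒bag)
open import Data.List.Relation.Binary.BagAndSetEquality using (∼bag⇒↭)
open import Data.List.Relation.Binary.Permutation.Propositional.Properties using (↭-length)
open import Data.List.Relation.Unary.All as All using ([]; _∷_)
open import Data.List.Relation.Unary.AllPairs using ([]; _∷_)
open import Data.List.Relation.Unary.Any using (here; there)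
open import Data.List.Relation.Unary.Unique.Propositional using (Unique)
import Data.List.Relation.Unary.Unique.Propositional.Properties as Unique
open import Data.Nat
open import Data.Nat.Properties

-- Par P b: the set { i | P i } is finite, and b tells whether its cardinality is odd.
record Par {A : Set} (P : A → Set) (b : Bool) : Set where
  constructor par
  field
    elements : List A
    unique   : Unique elements
    sound    : ∀ {i} → i ∈ elements → P i
    complete : ∀ {i} → P i → i ∈ elements
    odd-size : odd (length elements) ≡ b

module _ {A : Set} where

  par-≡ : ∀ {P : A → Set} {b b′} → b ≡ b′ → Par P b → Par P b′
  par-≡ refl p = p

  par-⇔ : ∀ {P Q : A → Set} {b} → (∀ {i} → P i → Q i) → (∀ {i} → Q i → P i) → Par P b → Par Q b
  par-⇔ f g (par l u s c e) = par l u (f ∘ s) (c ∘ g) e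

  -- Duplicate-free lists with the same members are permutations of each other, so the parity
  -- depends on the set alone; two evaluations of one set are compared through this.
  par-unique : ∀ {P : A → Set} {b b′} → Par P b → Par P b′ → b ≡ b′
  par-unique (par l u s c e) (par l′ u′ s′ c′ e′) =
    trans (sym e) (trans (cong odd (↭-length (∼bag⇒↭ (unique∧set⇒bag u u′ (mk⇔ (c′ ∘ s) (c ∘ s′)))))) e′)

  par-∅ : ∀ {P : A → Set} → (∀ {i} → ¬ P i) → Par P false
  par-∅ ¬p = par [] [] (λ ()) (⊥-elim ∘ ¬p) refl

  par-singleton : ∀ {P : A → Set} a → P a → (∀ {i} → P i → i ≡ a) → Par P true
  par-singleton a pa only = par (a ∷ []) ([] ∷ []) (λ { (here refl) → pa }) (here ∘ only) refl

  par-⊎ : ∀ {P Q : A → Set} {b b′} → (∀ {i} → P i → Q i → ⊥) → Par P b → Par Q b′ → Par (λ i → P i ⊎ Q i) (b xor b′)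
  par-⊎ {P} {Q} disjoint (par l u s c e) (par l′ u′ s′ c′ e′) = par (l ++ l′)
    (Unique.++⁺ u u′ (λ { (i∈l , i∈l′) → disjoint (s i∈l) (s′ i∈l′) }))
    (λ i∈ → split (∈-++⁻ l i∈))
    (λ { (inj₁ p) → ∈-++⁺ˡ (c p) ; (inj₂ p) → ∈-++⁺ʳ l (c′ p) })
    (trans (cong odd (length-++ l)) (trans (odd-+ (length l) (length l′)) (cong₂ _xor_ e e′)))
    where
    split : ∀ {i} → i ∈ l ⊎ i ∈ l′ → P i ⊎ Q i
    split (inj₁ p) = inj₁ (s p)
    split (inj₂ p) = inj₂ (s′ p)

  par-dec : ∀ {P D : A → Set} {b b′} → Decidable D →
    Par (λ i → P i × D i) b → Par (λ i → P i × ¬ D i) b′ → Par P (b xor b′)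
  par-dec {P} {D} D? p p′ = par-⇔ (λ { (inj₁ x) → proj₁ x ; (inj₂ x) → proj₁ x }) case (par-⊎ (λ x y → proj₂ y (proj₂ x)) p p′)
    where
    case : ∀ {i} → P i → (P i × D i) ⊎ (P i × ¬ D i)
    case {i} pi with D? i
    ... | yes d = inj₁ (pi , d)
    ... | no ¬d = inj₂ (pi , ¬d)

  par-tri : ∀ {P : A → Set} {b b′ b″} (f g : A → ℕ) →
    Par (λ i → P i × f i < g i) b → Par (λ i → P i × f i ≡ g i) b′ → Par (λ i → P i × g i < f i) b″ →
    Par P (b xor (b′ xor b″))
  par-tri {P} f g p p′ p″ = par-dec (λ i → f i <? g i) p
    (par-⇔ (λ { (inj₁ (x , e)) → x , <-irrefl e ; (inj₂ (x , l)) → x , <-asym l }) case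
      (par-⊎ (λ x y → <-irrefl (sym (proj₂ x)) (proj₂ y)) p′ p″))
    where
    case : ∀ {i} → P i × ¬ f i < g i → (P i × f i ≡ g i) ⊎ (P i × g i < f i)
    case {i} (pi , ≮) with <-cmp (f i) (g i)
    ... | tri< l _ _ = ⊥-elim (≮ l)
    ... | tri≈ _ e _ = inj₁ (pi , e)
    ... | tri> _ _ l = inj₂ (pi , l)

  count : (A → Bool) → List A → Bool
  count e []      = false
  count e (x ∷ l) = e x xor count e l

  odd-length-filter : ∀ {E : A → Set} (E? : Decidable E) l → odd (length (filter E? l)) ≡ count (does ∘ E?) l
  odd-length-filter E? []      = refl
  odd-length-filter E? (x ∷ l) with does (E? x)
  ... | true  = cong not (odd-length-filter E? l)
  ... | false = odd-length-filter E? l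

  count-xor : ∀ e f l → count (λ i → e i xor f i) l ≡ count e l xor count f l
  count-xor e f []      = refl
  count-xor e f (x ∷ l) = trans (cong ((e x xor f x) xor_) (count-xor e f l)) (interchange (e x) (f x) _ _)

  count-cong : ∀ {e f} l → (∀ {i} → i ∈ l → e i ≡ f i) → count e l ≡ count f l
  count-cong []      p = refl
  count-cong (x ∷ l) p = cong₂ _xor_ (p (here refl)) (count-cong l (p ∘ there))

  count-false : ∀ {e} l → (∀ {i} → i ∈ l → e i ≡ false) → count e l ≡ false
  count-false []      p = refl
  count-false (x ∷ l) p = cong₂ _xor_ (p (here refl)) (count-false l (p ∘ there))

  count-true : ∀ l → count (λ _ → true) l ≡ odd (length l)
  count-true []      = refl
  count-true (x ∷ l) = cong not (count-true l)

  par-filter : ∀ {P E : A → Set} {b} (E? : Decidable E) (p : Par P b) → Par (λ i → P i × E i) (count (does ∘ E?) (Par.elements p))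
  par-filter E? (par l u s c e) = par (filter E? l) (Unique.filter⁺ E? u)
    (λ i∈ → s (proj₁ (∈-filter⁻ E? i∈)) , proj₂ (∈-filter⁻ E? {xs = l} i∈))
    (λ { (pi , ei) → ∈-filter⁺ E? (c pi) ei })
    (odd-length-filter E? l)

  -- Over 𝔽₂ the off-diagonal entries of a symmetric matrix cancel in pairs, leaving the trace.
  count-symmetric : ∀ (M : A → A → Bool) l → (∀ {i j} → i ∈ l → j ∈ l → M i j ≡ M j i) →
    count (λ i → count (M i) l) l ≡ count (λ i → M i i) l
  count-symmetric M []      sy = refl
  count-symmetric M (x ∷ l) sy = begin
    (M x x xor count (M x) l) xor count (λ i → M i x xor count (M i) l) l
      ≡⟨ cong ((M x x xor count (M x) l) xor_) (count-xor (λ i → M i x) (λ i → count (M i) l) l) ⟩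
    (M x x xor count (M x) l) xor (count (λ i → M i x) l xor count (λ i → count (M i) l) l)
      ≡⟨ cong₂ (λ a b → (M x x xor count (M x) l) xor (a xor b)) (count-cong l (λ i∈ → sy (there i∈) (here refl))) (count-symmetric M l (λ i∈ j∈ → sy (there i∈) (there j∈))) ⟩
    (M x x xor count (M x) l) xor (count (M x) l xor count (λ i → M i i) l)
      ≡⟨ lem (M x x) (count (M x) l) _ ⟩
    M x x xor count (λ i → M i i) l ∎
    where
    open ≡-Reasoning
    lem : ∀ a b c → (a xor b) xor (b xor c) ≡ a xor c
    lem a b c = trans (xor-assoc a b (b xor c)) (cong (a xor_) (trans (sym (xor-assoc b b c)) (cong (_xor c) (xor-same b))))

  module _ (_≟_ : DecidableEquality A) where

    count-≟ : ∀ a {l} → Unique l → a ∈ l → count (λ j → does (a ≟ j)) l ≡ true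
    count-≟ a {x ∷ l} (x∉l ∷ u) (here refl) = trans (cong₂ _xor_ (dec-true (a ≟ a) refl)
      (count-false l (λ {i} i∈ → dec-false (a ≟ i) (All.lookup x∉l i∈)))) refl
    count-≟ a {x ∷ l} (x∉l ∷ u) (there a∈) = trans (cong (_xor count (λ j → does (a ≟ j)) l) (dec-false (a ≟ x) (λ { refl → All.lookup x∉l a∈ refl }))) (count-≟ a u a∈)

    -- The matrix with entry 1 where φ i = j is symmetric as φ is an involution; its rows sum to 1,
    -- so its total is the parity of P, and its trace counts the fixed points.
    par-involution : ∀ {P : A → Set} {b} (φ : A → A) → (∀ {i} → P i → P (φ i)) → (∀ {i} → P i → φ (φ i) ≡ i) →
      Par P b → Par (λ i → P i × φ i ≡ i) b
    par-involution {P} {b} φ closed invol p@(par l u s c e) = par-≡ eq (par-filter (λ i → φ i ≟ i) p)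
      where
      M : A → A → Bool
      M i j = does (φ i ≟ j)
      M-symmetric : ∀ {i j} → i ∈ l → j ∈ l → M i j ≡ M j i
      M-symmetric {i} {j} i∈ j∈ with φ j ≟ i
      ... | yes refl = dec-true (φ (φ j) ≟ j) (invol (s j∈))
      ... | no φj≢i  = dec-false (φ i ≟ j) (λ { refl → φj≢i (invol (s i∈)) })
      eq : count (λ i → M i i) l ≡ b
      eq = begin
        count (λ i → M i i) l         ≡⟨ count-symmetric M l M-symmetric ⟨
        count (λ i → count (M i) l) l ≡⟨ count-cong l (λ {i} i∈ → count-≟ (φ i) u (c (closed (s i∈)))) ⟩
        count (λ _ → true) l          ≡⟨ trans (count-true l) e ⟩
        b                             ∎
        where open ≡-Reasoning

module _ {A B : Set} {P : A → Set} {Q : B → Set} (φ : A → B)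
  (φ-P : ∀ {i} → P i → Q (φ i))
  (φ-injective : ∀ {i j} → P i → P j → φ i ≡ φ j → i ≡ j)
  (φ-surjective : ∀ {j} → Q j → ∃ λ i → P i × φ i ≡ j)
  where

  par-image : ∀ {b} → Par P b → Par Q b
  par-image (par l u s c e) = par (map φ l) (unique-map l u s)
    (λ j∈ → let (i , i∈ , eq) = ∈-map⁻ φ j∈ in subst Q (sym eq) (φ-P (s i∈)))
    (λ qj → let (i , pi , eq) = φ-surjective qj in subst (_∈ map φ l) eq (∈-map⁺ φ (c pi)))
    (trans (cong odd (length-map φ l)) e)
    where
    unique-map : ∀ l → Unique l → (∀ {i} → i ∈ l → P i) → Unique (map φ l)
    unique-map []      []        s = []
    unique-map (x ∷ l) (x∉l ∷ u) s = All.tabulate (λ {j} j∈ φx≡j →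
        let (i , i∈ , j≡φi) = ∈-map⁻ φ j∈ in
        All.lookup x∉l i∈ (φ-injective (s (here refl)) (s (there i∈)) (trans φx≡j j≡φi)))
      ∷ unique-map l u (s ∘ there)

  -- The list is assembled from the witnesses of surjectivity, so no inverse map has to be defined.
  par-preimage : ∀ {b} → Par Q b → Par P b
  par-preimage (par l u s c e) = par l′ (Unique.map⁻ (subst Unique (sym (map-choose l s)) u))
    (choose-sound l s)
    (λ {i} pi → let (i′ , i′∈ , eq) = ∈-map⁻ φ (subst (φ i ∈_) (sym (map-choose l s)) (c (φ-P pi))) in
      subst (_∈ l′) (sym (φ-injective pi (choose-sound l s i′∈) eq)) i′∈)
    (trans (cong odd (trans (sym (length-map φ l′)) (cong length (map-choose l s)))) e)
    where
    choose : ∀ l → (∀ {j} → j ∈ l → Q j) → List A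
    choose []      s = []
    choose (j ∷ l) s = proj₁ (φ-surjective (s (here refl))) ∷ choose l (s ∘ there)
    l′ = choose l s
    map-choose : ∀ l (s : ∀ {j} → j ∈ l → Q j) → map φ (choose l s) ≡ l
    map-choose []      s = refl
    map-choose (j ∷ l) s = cong₂ _∷_ (proj₂ (proj₂ (φ-surjective (s (here refl))))) (map-choose l (s ∘ there))
    choose-sound : ∀ l (s : ∀ {j} → j ∈ l → Q j) {i} → i ∈ choose l s → P i
    choose-sound (j ∷ l) s (here refl) = proj₁ (proj₂ (φ-surjective (s (here refl))))
    choose-sound (j ∷ l) s (there i∈)  = choose-sound l (s ∘ there) i∈

par-cover : ∀ {A : Set} {P : A → Set} (P? : Decidable P) {l} → Unique l → (∀ {i} → P i → i ∈ l) → ∃ (Par P)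
par-cover P? {l} u c = _ , par (filter P? l) (Unique.filter⁺ P? u)
  (λ i∈ → proj₂ (∈-filter⁻ P? {xs = l} i∈)) (λ p → ∈-filter⁺ P? (c p) p) refl

par-bounded₂ : ∀ {P : ℕ × ℕ → Set} (P? : Decidable P) n → (∀ {a b} → P (a , b) → a < n × b < n) → ∃ (Par P)
par-bounded₂ P? n bound = par-cover P? (Unique.cartesianProduct⁺ (Unique.upTo⁺ n) (Unique.upTo⁺ n))
  (λ p → let (a< , b<) = bound p in ∈-cartesianProduct⁺ (∈-upTo⁺ a<) (∈-upTo⁺ b<))

par-bounded₃ : ∀ {P : ℕ × ℕ × ℕ → Set} (P? : Decidable P) n → (∀ {a b c} → P (a , b , c) → a < n × b < n × c < n) → ∃ (Par P)
par-bounded₃ P? n bound = par-cover P? (Unique.cartesianProduct⁺ (Unique.upTo⁺ n) (Unique.cartesianProduct⁺ (Unique.upTo⁺ n) (Unique.upTo⁺ n)))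
  (λ p → let (a< , b< , c<) = bound p in ∈-cartesianProduct⁺ (∈-upTo⁺ a<) (∈-cartesianProduct⁺ (∈-upTo⁺ b<) (∈-upTo⁺ c<)))

par-true⇒∃ : ∀ {A : Set} {P : A → Set} → Par P true → ∃ P
par-true⇒∃ (par (i ∷ _) _ s _ _) = i , s (here refl)

-- The sum in terms of the form 24z² - x²

open import Data.Fin using (Fin; toℕ; fromℕ<)
open import Data.Fin.Properties using (all?; toℕ-fromℕ<)
open import Data.Nat.Divisibility
open import Data.Nat.DivMod
open import Data.Nat.Induction using (<-wellFounded; Acc; acc)
import Data.Nat.ListAction as ListAction
open import Data.Nat.Primality using (Prime; prime?; euclidsLemma; prime⇒nonZero; prime⇒nonTrivial; prime⇒irreducible)
open import Data.Nat.Primality.Factorisation using (factorise)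
open import Data.Product.Properties using (≡-dec)
open 𝔽₂-Series using (shift₂; shift₂-<; shift₂-+; Position; before; beyond; position; q-⊛₂; ⊛₂-zeroˡ; odd-u2; PQ-coefficient; PQ; ∑) renaming (q to 𝐪; _^_ to _^ₛ_)

shiftEquation : ∀ {a b c d} k → c ≡ a + k → d ≡ b + k → a ≡ b → c ≡ d
shiftEquation k p r e = trans p (trans (cong (_+ k) e) (sym r))

unshiftEquation : ∀ {a b c d} k → c ≡ a + k → d ≡ b + k → c ≡ d → a ≡ b
unshiftEquation {a} {b} k p r e = +-cancelʳ-≡ k a b (trans (sym p) (trans e r))

q^-diagonal : ∀ n → (𝐪 ^ₛ n) n ≡ true
q^-diagonal zero    = refl
q^-diagonal (suc n) = trans (q-⊛₂ (𝐪 ^ₛ n) (suc n)) (q^-diagonal n)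

q^-off-diagonal : ∀ k n → ¬ n ≡ k → (𝐪 ^ₛ k) n ≡ false
q^-off-diagonal zero    zero    p = ⊥-elim (p refl)
q^-off-diagonal zero    (suc n) p = refl
q^-off-diagonal (suc k) zero    p = refl
q^-off-diagonal (suc k) (suc n) p = trans (q-⊛₂ (𝐪 ^ₛ k) (suc n)) (q^-off-diagonal k n (λ e → p (cong suc e)))

par-monomial : ∀ {A : Set} {P : A → Set} k n a → (n ≡ k → P a) → (∀ {i} → P i → n ≡ k × i ≡ a) → Par P ((𝐪 ^ₛ k) n)
par-monomial k n a f g with n ≟ k
... | yes refl = par-≡ (sym (q^-diagonal n)) (par-singleton a (f refl) (λ p → proj₂ (g p)))
... | no n≢k   = par-≡ (sym (q^-off-diagonal k n n≢k)) (par-∅ (λ p → n≢k (proj₁ (g p))))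

-- The equation n = 3z² - j(j+1)/2 multiplied by 8, with x = 2j + 1; the range 0 < x < 4z is 0 ≤ j <
-- 2z. That x is odd follows from the equation.
Rep : ℕ → ℕ → ℕ → Set
Rep z n x = (0 < x × x < 4 * z) × 8 * n + x * x ≡ 24 * (z * z) + 1

odd-square : ∀ {n x c} → 8 * n + x * x ≡ 24 * c + 1 → odd x ≡ true
odd-square {n} {x} {c} e = begin
  odd x                    ≡⟨ lem (odd x) ⟨
  odd x ∧ odd x          ≡⟨ odd-* x x ⟨
  odd (x * x)              ≡⟨ cong (_xor odd (x * x)) (odd-* 8 n) ⟨
  odd (8 * n) xor odd (x * x) ≡⟨ odd-+ (8 * n) (x * x) ⟨
  odd (8 * n + x * x)      ≡⟨ cong odd e ⟩
  odd (24 * c + 1)         ≡⟨ trans (odd-+ (24 * c) 1) (cong (_xor true) (odd-* 24 c)) ⟩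
  true                     ∎
  where
  open ≡-Reasoning
  lem : ∀ b → b ∧ b ≡ b
  lem false = refl
  lem true  = refl

-- Follows the recursion of `PQ-coefficient`: solutions with x < 4z come from z with n lowered by 6z
-- + 3, and among the four new values of x only the odd ones, 4z + 3 and 4z + 1, can occur.
par-Rep : ∀ z n → Par (Rep z n) (PQ z n)
par-Rep zero    n = par-≡ (sym (⊛₂-zeroˡ _ n)) (par-∅ (λ { ((_ , ()) , _) }))
par-Rep (suc z) n = par-≡ (sym (PQ-coefficient z n)) (par-dec (λ x → x <? 4 * z) old
  (par-dec (λ x → x ≟ 4 * z + 3) new₁ new₂))
  where
  old : Par (λ x → Rep (suc z) n x × x < 4 * z) (shift₂ (6 * z + 3) (PQ z) n)
  old with position (6 * z + 3) n
  ... | before n< = par-≡ (sym (shift₂-< _ n<)) (par-∅ (λ { {x} ((_ , e) , x<) → <-irrefl e (begin-strict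
      8 * n + x * x                           ≤⟨ +-mono-≤ (*-monoʳ-≤ 8 (<⇒≤ n<)) (*-mono-≤ (<⇒≤ x<) (<⇒≤ x<)) ⟩
      8 * (6 * z + 3) + 4 * z * (4 * z)       <⟨ m<m+n _ (s≤s z≤n) ⟩
      8 * (6 * z + 3) + 4 * z * (4 * z) + (1 + 8 * (z * z)) ≡⟨ eq z ⟩
      24 * (suc z * suc z) + 1                ∎) }))
    where
    open ≤-Reasoning
    eq : ∀ z → 8 * (6 * z + 3) + 4 * z * (4 * z) + (1 + 8 * (z * z)) ≡ 24 * (suc z * suc z) + 1
    eq = solve-∀
  ... | beyond m = par-≡ (sym (shift₂-+ (6 * z + 3) m _)) (par-⇔
    (λ { {x} ((x>0 , x<) , e) → ((x>0 , ≤-trans x< (*-monoʳ-≤ 4 (n≤1+n z))) , shiftEquation (48 * z + 24) (eq₁ z m x) (eq₂ z) e) , x< })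
    (λ { {x} (((x>0 , _) , e) , x<) → (x>0 , x<) , unshiftEquation (48 * z + 24) (eq₁ z m x) (eq₂ z) e })
    (par-Rep z m))
    where
    eq₁ : ∀ z m x → 8 * (6 * z + 3 + m) + x * x ≡ 8 * m + x * x + (48 * z + 24)
    eq₁ = solve-∀
    eq₂ : ∀ z → 24 * (suc z * suc z) + 1 ≡ 24 * (z * z) + 1 + (48 * z + 24)
    eq₂ = solve-∀

  New : ℕ → Set
  New x = Rep (suc z) n x × ¬ x < 4 * z

  solution₁ : ∀ z → 8 * (z * z + 3 * z + 2) + (4 * z + 3) * (4 * z + 3) ≡ 24 * (suc z * suc z) + 1
  solution₁ = solve-∀
  solution₂ : ∀ z → 8 * (z * z + 5 * z + 3) + (4 * z + 1) * (4 * z + 1) ≡ 24 * (suc z * suc z) + 1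
  solution₂ = solve-∀

  determined : ∀ k x → 8 * n + x * x ≡ 24 * (suc z * suc z) + 1 → 8 * k + x * x ≡ 24 * (suc z * suc z) + 1 → n ≡ k
  determined k x e e′ = *-cancelˡ-≡ n k 8 (+-cancelʳ-≡ (x * x) (8 * n) (8 * k) (trans e (sym e′)))

  in-range : ∀ r → suc r < 4 → 0 < 4 * z + suc r × 4 * z + suc r < 4 * suc z
  in-range r r<4 = subst (0 <_) (sym (+-suc (4 * z) r)) z<s , subst (4 * z + suc r <_) (trans (+-comm (4 * z) 4) (sym (*-suc 4 z))) (+-monoʳ-< (4 * z) r<4)

  not-even : ∀ k → odd k ≡ false → ¬ 8 * n + (4 * z + k) * (4 * z + k) ≡ 24 * (suc z * suc z) + 1
  not-even k k-even e with trans (sym (odd-square {n} {4 * z + k} {suc z * suc z} e)) (trans (odd-+ (4 * z) k) (trans (cong (_xor odd k) (odd-* 4 z)) k-even))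
  ... | ()

  new₁ : Par (λ x → New x × x ≡ 4 * z + 3) ((𝐪 ^ₛ (z * z + 3 * z + 2)) n)
  new₁ = par-monomial (z * z + 3 * z + 2) n (4 * z + 3)
    (λ { refl → ((in-range 2 ≤-refl , solution₁ z) , m+n≮m (4 * z) 3) , refl })
    (λ { (((_ , e) , _) , refl) → determined (z * z + 3 * z + 2) (4 * z + 3) e (solution₁ z) , refl })

  new₂ : Par (λ x → New x × ¬ x ≡ 4 * z + 3) ((𝐪 ^ₛ (z * z + 5 * z + 3)) n)
  new₂ = par-monomial (z * z + 5 * z + 3) n (4 * z + 1)
    (λ { refl → ((in-range 0 (s≤s (s≤s z≤n)) , solution₂ z) , m+n≮m (4 * z) 1) , λ e → 1≢3 (+-cancelˡ-≡ (4 * z) 1 3 e) })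
    (λ { {x} ((((r , e) , x≮) , x≢)) → first {x} r e x≮ x≢ })
    where
    1≢3 : ¬ 1 ≡ 3
    1≢3 ()
    first : ∀ {x} → 0 < x × x < 4 * suc z → 8 * n + x * x ≡ 24 * (suc z * suc z) + 1 → ¬ x < 4 * z → ¬ x ≡ 4 * z + 3 →
      n ≡ z * z + 5 * z + 3 × x ≡ 4 * z + 1
    first {x} (_ , x<) e x≮ x≢ with m≤n⇒∃[o]m+o≡n (≮⇒≥ x≮)
    ... | k , refl with +-cancelˡ-< (4 * z) k 4 (subst (4 * z + k <_) (trans (*-suc 4 z) (+-comm 4 (4 * z))) x<)
    first {x} (_ , x<) e x≮ x≢ | 0 , refl | _ = ⊥-elim (not-even 0 refl e)
    first {x} (_ , x<) e x≮ x≢ | 1 , refl | _ = determined (z * z + 5 * z + 3) (4 * z + 1) e (solution₂ z) , refl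
    first {x} (_ , x<) e x≮ x≢ | 2 , refl | _ = ⊥-elim (not-even 2 refl e)
    first {x} (_ , x<) e x≮ x≢ | 3 , refl | _ = ⊥-elim (x≢ refl)
    first {x} (_ , x<) e x≮ x≢ | suc (suc (suc (suc _))) , refl | s≤s (s≤s (s≤s (s≤s ())))

Reps Only : ℕ → ℕ → ℕ × ℕ → Set
Reps M n (z , x) = z ≤ M × Rep z n x
Only M n (z , x) = z ≡ M × Rep z n x

par-Only : ∀ M n → Par (Only M n) (PQ M n)
par-Only M n = par-image {Q = Only M n} (M ,_) (λ r → refl , r) (λ { _ _ refl → refl }) (λ { {_ , x} (refl , r) → x , r , refl }) (par-Rep M n)

par-Reps : ∀ M n → Par (Reps M n) (∑ M PQ n)
par-Reps zero    n = par-⇔ {P = Only 0 n} (λ { (refl , r) → z≤n , r }) (λ { (z≤n , r) → refl , r }) (par-Only 0 n)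
par-Reps (suc M) n = par-⇔ {P = λ i → Reps M n i ⊎ Only (suc M) n i} {Q = Reps (suc M) n}
  (λ { (inj₁ (p , r)) → m≤n⇒m≤1+n p , r ; (inj₂ (refl , r)) → ≤-refl , r })
  split
  (par-⊎ {P = Reps M n} {Q = Only (suc M) n} (λ { (p , _) (refl , _) → 1+n≰n p }) (par-Reps M n) (par-Only (suc M) n))
  where
  split : ∀ {i} → Reps (suc M) n i → Reps M n i ⊎ Only (suc M) n i
  split (p , r) with m≤n⇒m<n∨m≡n p
  ... | inj₁ (s≤s q) = inj₁ (q , r)
  ... | inj₂ e       = inj₂ (e , r)

H : ℕ → ℕ × ℕ → Set
H m (z , x) = 24 * (z * z) ≡ m + x * x × 0 < x × x < 4 * z

par-u2 : ∀ m n → 8 * n ≡ suc m → Par (H m) (odd (u2 n))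
par-u2 m n 8n = par-≡ (sym (odd-u2 n)) (par-⇔ {P = Reps (suc n) n} {Q = H m}
  (λ { {z , x} (_ , (r , e)) → suc-injective (trans (+-comm 1 _) (trans (sym e) (cong (_+ x * x) 8n))) , r })
  (λ { {z , x} (e , r) → let e′ = trans (cong (_+ x * x) 8n) (trans (cong suc (sym e)) (+-comm 1 _)) in bound {z} {x} r e′ , (r , e′) })
  (par-Reps (suc n) n))
  where
  -- As x² ≤ 16z², the equation gives 8z² ≤ 8n, so the range z ≤ n + 1 in `odd-u2` misses no
  -- solution.
  bound : ∀ {z x} → 0 < x × x < 4 * z → 8 * n + x * x ≡ 24 * (z * z) + 1 → z ≤ suc n
  bound {zero}  _ _ = z≤n
  bound {z@(suc _)} {x} (_ , x<) e = m≤n⇒m≤1+n (≤-trans (m≤m*n z z) (*-cancelˡ-≤ 8 (+-cancelʳ-≤ (4 * z * (4 * z)) _ _ (begin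
    8 * (z * z) + 4 * z * (4 * z) ≡⟨ eq z ⟩
    24 * (z * z)                  ≤⟨ m≤m+n _ 1 ⟩
    24 * (z * z) + 1              ≡⟨ e ⟨
    8 * n + x * x                 ≤⟨ +-monoʳ-≤ (8 * n) (*-mono-≤ (<⇒≤ x<) (<⇒≤ x<)) ⟩
    8 * n + 4 * z * (4 * z)       ∎))))
    where
    open ≤-Reasoning
    eq : ∀ z → 8 * (z * z) + 4 * z * (4 * z) ≡ 24 * (z * z)
    eq = solve-∀

-- The dissection for the prime 2

Triple : Set
Triple = ℕ × ℕ × ℕ

_≟₃_ : DecidableEquality Triple
_≟₃_ = ≡-dec _≟_ (≡-dec _≟_ _≟_)

m<n⇒∃ : ∀ {m n} → m < n → ∃ λ k → 0 < k × m + k ≡ n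
m<n⇒∃ {m} m<n with m≤n⇒∃[o]m+o≡n m<n
... | k , refl = suc k , z<s , +-suc m k

odd⇒ : ∀ n → odd n ≡ true → ∃ λ k → n ≡ suc (k + k)
even⇒ : ∀ n → odd n ≡ false → ∃ λ k → n ≡ k + k
odd⇒ (suc n) e with even⇒ n (notfalse (odd n) e)
  where
  notfalse : ∀ b → not b ≡ true → b ≡ false
  notfalse false _ = refl
... | k , refl = k , refl
even⇒ zero    e = 0 , refl
even⇒ (suc n) e with odd⇒ n (nottrue (odd n) e)
  where
  nottrue : ∀ b → not b ≡ false → b ≡ true
  nottrue true _ = refl
... | k , refl = suc k , cong suc (sym (+-suc k k))

odd⇒>0 : ∀ n → odd n ≡ true → 0 < n
odd⇒>0 (suc n) _ = z<s

∧-idem-true : ∀ {b} → b ∧ b ≡ true → b ≡ true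
∧-idem-true {true} _ = refl

odd-root : ∀ {m} n s l X → 8 * n ≡ suc m → 12 * (s * l) ≡ m + X * X → odd X ≡ true
odd-root {m} n s l X 8n e = ∧-idem-true (trans (sym (odd-* X X)) (lem (odd m) (odd (X * X))
  (trans (cong odd (sym 8n)) (odd-* 8 n)) (trans (sym (odd-+ m (X * X))) (trans (cong odd (sym e)) (odd-* 12 (s * l))))))
  where
  lem : ∀ a b → not a ≡ false → a xor b ≡ false → b ≡ true
  lem true true _ _ = refl

-- X is odd, so X² is 1 modulo 8; with m = 7 modulo 8 this makes 12sl divisible by 8.
even-product : ∀ {m} n s l X → 8 * n ≡ suc m → 12 * (s * l) ≡ m + X * X → odd s ∧ odd l ≡ false
even-product {m} n s l X 8n e with odd⇒ X (odd-root n s l X 8n e)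
... | y , refl = begin
  odd s ∧ odd l                 ≡⟨ trans (odd-* 3 (s * l)) (odd-* s l) ⟨
  odd (3 * (s * l))             ≡⟨ cong odd (*-cancelˡ-≡ (3 * (s * l)) (2 * n + y * suc y) 4 (suc-injective eq)) ⟩
  odd (2 * n + y * suc y)       ≡⟨ trans (odd-+ (2 * n) (y * suc y)) (cong₂ _xor_ (odd-* 2 n) (odd-* y (suc y))) ⟩
  odd y ∧ not (odd y)           ≡⟨ lem (odd y) ⟩
  false                         ∎
  where
  open ≡-Reasoning
  lem : ∀ b → b ∧ not b ≡ false
  lem false = refl
  lem true  = refl
  eq₁ : ∀ s l → suc (4 * (3 * (s * l))) ≡ suc (12 * (s * l))
  eq₁ = solve-∀
  eq₂ : ∀ n y → 8 * n + suc (y + y) * suc (y + y) ≡ suc (4 * (2 * n + y * suc y))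
  eq₂ = solve-∀
  eq : suc (4 * (3 * (s * l))) ≡ suc (4 * (2 * n + y * suc y))
  eq = trans (eq₁ s l) (trans (cong suc e) (trans (cong (_+ suc (y + y) * suc (y + y)) (sym 8n)) (eq₂ n y)))

does-even : ∀ b → does (b Bool.≟ false) ≡ not b
does-even false = refl
does-even true  = refl

-- The lines x = 3C and A = C cut the region Q₁ into three images of the triangle
-- T₁, indexed by the vertex of the triangle that becomes A; L₁ and L₂ are the
-- points on these lines.
T₁ Q₁ : ℕ → Triple → Set
T₁ m (s , l , X) = 12 * (s * l) ≡ m + X * X × X < 3 * s × s < l
Q₁ m (A , C , x) = 12 * (A * C) ≡ m + x * x × odd A ≡ false × x < 3 * A × x < 6 * C × x < A + 2 * C

L₁ L₂ : ℕ → ℕ × ℕ → Set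
L₁ m (A , X) = 12 * (A * A) ≡ m + X * X × X < 3 * A
L₂ m (A , C) = 12 * (A * C) ≡ m + 3 * C * (3 * C) × C < A

-- On the triangle X² ≤ 9sl, hence 3sl ≤ m, which bounds all three coordinates.
T₁-finite : ∀ m → ∃ (Par (T₁ m))
T₁-finite m = par-bounded₃
  (λ { (s , l , X) → (12 * (s * l) ≟ m + X * X) ×-dec (X <? 3 * s) ×-dec (s <? l) }) (suc m)
  (λ { {s} {l} {X} (e , X< , s<l) → bound s l X e X< s<l })
  where
  bound : ∀ s l X → 12 * (s * l) ≡ m + X * X → X < 3 * s → s < l → s < suc m × l < suc m × X < suc m
  bound s@(suc _) l@(suc _) X e X< s<l = s≤s (≤-trans (m≤m*n s l) sl≤m) , s≤s (≤-trans (m≤n*m l s) sl≤m) ,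
    s≤s (≤-trans (<⇒≤ X<) (≤-trans (*-monoʳ-≤ 3 (m≤m*n s l)) 3sl≤m))
    where
    open ≤-Reasoning
    eq₁ : ∀ s l → 3 * (s * l) + 3 * s * (3 * l) ≡ 12 * (s * l)
    eq₁ = solve-∀
    3sl≤m : 3 * (s * l) ≤ m
    3sl≤m = +-cancelʳ-≤ (3 * s * (3 * l)) _ _ (begin
      3 * (s * l) + 3 * s * (3 * l) ≡⟨ eq₁ s l ⟩
      12 * (s * l)                  ≡⟨ e ⟩
      m + X * X                     ≤⟨ +-monoʳ-≤ m (*-mono-≤ (<⇒≤ X<) (≤-trans (<⇒≤ X<) (*-monoʳ-≤ 3 (<⇒≤ s<l)))) ⟩
      m + 3 * s * (3 * l)           ∎)
    sl≤m : s * l ≤ m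
    sl≤m = ≤-trans (m≤n*m (s * l) 3) 3sl≤m

-- The vertices A, C and A - x + 3C of a triangle, of which two are even.
E₁ E₂ E₃ : Triple → Set
E₁ (s , l , X) = odd s ≡ false
E₂ (s , l , X) = odd l ≡ false
E₃ (s , l , X) = odd (l + (3 * s ∸ X)) ≡ false

E₁? : Decidable E₁
E₁? (s , l , X) = odd s Bool.≟ false
E₂? : Decidable E₂
E₂? (s , l , X) = odd l Bool.≟ false
E₃? : Decidable E₃
E₃? (s , l , X) = odd (l + (3 * s ∸ X)) Bool.≟ false

monus : ∀ X y {k} → X + y ≡ k → k ∸ X ≡ y
monus X y refl = m+n∸m≡n X y

-- Since X is odd, y = 3s - X and s have opposite parity; as sl is even, only three patterns of
-- parities remain.
two-even : ∀ {m} n → 8 * n ≡ suc m → ∀ {i} → T₁ m i → does (E₁? i) xor (does (E₂? i) xor does (E₃? i)) ≡ false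
two-even n 8n {s , l , X} (e , X< , _) with m<n⇒∃ X<
... | y , _ , X+y = begin
  does (odd s Bool.≟ false) xor (does (odd l Bool.≟ false) xor does (odd (l + (3 * s ∸ X)) Bool.≟ false))
    ≡⟨ cong₂ _xor_ (does-even (odd s)) (cong₂ _xor_ (does-even (odd l)) (trans (does-even _) (cong not (trans (cong (λ k → odd (l + k)) (monus X y X+y)) (odd-+ l y))))) ⟩
  not (odd s) xor (not (odd l) xor not (odd l xor odd y))
    ≡⟨ lem (odd s) (odd l) (odd y) (even-product n s l X 8n e) (trans (cong (_xor odd y) (sym (odd-root n s l X 8n e))) (trans (sym (odd-+ X y)) (trans (cong odd X+y) (odd-* 3 s)))) ⟩
  false ∎
  where
  open ≡-Reasoning
  lem : ∀ a b c → a ∧ b ≡ false → not c ≡ a → not a xor (not b xor not (b xor c)) ≡ false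
  lem .true  false false _ refl = refl
  lem .false false true  _ refl = refl
  lem .false true  true  _ refl = refl

module _ {m n : ℕ} (8n : 8 * n ≡ suc m) where

  R₁ R₂ R₃ R₄ R₅ : Triple → Set
  R₁ i@(A , C , x) = (Q₁ m i × x < 3 * C) × A < C
  R₂ i@(A , C , x) = (Q₁ m i × x < 3 * C) × C < A
  R₃ i@(A , C , x) = Q₁ m i × 3 * C < x
  R₄ i@(A , C , x) = (Q₁ m i × x < 3 * C) × A ≡ C
  R₅ i@(A , C , x) = Q₁ m i × x ≡ 3 * C

  3*< : ∀ a b {x} → x < 3 * a → a < b → x < a + 2 * b
  3*< a b x< a<b = <-≤-trans x< (+-monoʳ-≤ a (*-monoʳ-≤ 2 (<⇒≤ a<b)))

  Q₁-E₁ : ∀ {b} → Par (λ i → T₁ m i × E₁ i) b → Par R₁ b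
  Q₁-E₁ = par-⇔ {Q = R₁}
    (λ { {A , C , x} ((e , x< , A<C) , ev) → let x<3C = <-≤-trans x< (*-monoʳ-≤ 3 (<⇒≤ A<C)) in
      ((e , ev , x< , <-≤-trans x<3C (*-monoˡ-≤ C {3} {6} (s≤s (s≤s (s≤s z≤n)))) , 3*< A C x< A<C) , x<3C) , A<C })
    (λ { (((e , ev , x< , _) , _) , A<C) → (e , x< , A<C) , ev })

  Q₁-E₂ : ∀ {b} → Par (λ i → T₁ m i × E₂ i) b → Par R₂ b
  Q₁-E₂ = par-image {Q = R₂} (λ { (s , l , X) → l , s , X })
    (λ { {s , l , X} ((e , X< , s<l) , ev) →
      ((trans (cong (12 *_) (*-comm l s)) e , ev , <-≤-trans X< (*-monoʳ-≤ 3 (<⇒≤ s<l)) , <-≤-trans X< (*-monoˡ-≤ s {3} {6} (s≤s (s≤s (s≤s z≤n)))) ,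
        <-≤-trans X< (+-monoˡ-≤ (2 * s) (<⇒≤ s<l))) , X<) , s<l })
    (λ { _ _ refl → refl })
    (λ { {A , C , x} (((e , ev , _) , x<) , C<A) → (C , A , x) , (((trans (cong (12 *_) (*-comm C A)) e) , x< , C<A) , ev) , refl })

  -- The reflection x ↦ 6C - x, A ↦ A - x + 3C in the line x = 3C, applied with C = s and A = l.
  -- Everything is expressed by y = 3s - X to stay within ℕ.
  reflect : Triple → Triple
  reflect (s , l , X) = l + (3 * s ∸ X) , s , 3 * s + (3 * s ∸ X)

  reflect-+ : ∀ s l X y → X + y ≡ 3 * s → reflect (s , l , X) ≡ (l + y , s , 3 * s + y)
  reflect-+ s l X y p = cong (λ z → l + z , s , 3 * s + z) (monus X y p)

  reflect-eq₁ : ∀ s l y → 12 * ((l + y) * s) ≡ 12 * (s * l) + 12 * (y * s)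
  reflect-eq₁ = solve-∀

  reflect-eq₂ : ∀ s X y → X + y ≡ 3 * s → m + (3 * s + y) * (3 * s + y) ≡ m + X * X + 12 * (y * s)
  reflect-eq₂ s X y p = begin
    m + (3 * s + y) * (3 * s + y)    ≡⟨ cong (λ k → m + (k + y) * (k + y)) p ⟨
    m + (X + y + y) * (X + y + y)    ≡⟨ eq₁ m X y ⟩
    m + X * X + 4 * (y * (X + y))    ≡⟨ cong (λ k → m + X * X + 4 * (y * k)) p ⟩
    m + X * X + 4 * (y * (3 * s))    ≡⟨ eq₂ m X y s ⟩
    m + X * X + 12 * (y * s)         ∎
    where
    open ≡-Reasoning
    eq₁ : ∀ m X y → m + (X + y + y) * (X + y + y) ≡ m + X * X + 4 * (y * (X + y))
    eq₁ = solve-∀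
    eq₂ : ∀ m X y s → m + X * X + 4 * (y * (3 * s)) ≡ m + X * X + 12 * (y * s)
    eq₂ = solve-∀

  3+3 : ∀ s → 3 * s + 3 * s ≡ 6 * s
  3+3 = solve-∀

  1+2 : ∀ s y → 3 * s + y ≡ s + y + 2 * s
  1+2 = solve-∀

  -- Under the reflection X < 3s becomes 3C < x, X > 0 becomes x < 6C, and s < l becomes x < A + 2C:
  -- the last two inequalities of `Q₁` originate here.
  Q₁-E₃ : ∀ {b} → Par (λ i → T₁ m i × E₃ i) b → Par R₃ b
  Q₁-E₃ = par-image {Q = R₃} reflect
    (λ { {s , l , X} (t , ev) → forward s l X t ev })
    (λ { {s , l , X} {s′ , l′ , X′} ((_ , X< , _) , _) ((_ , X′< , _) , _) e → inj s l X s′ l′ X′ X< X′< e })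
    (λ { {A , C , x} ((e , ev , _ , x<6C , x<) , 3C<x) → backward A C x e ev x<6C x< 3C<x })
    where
    forward : ∀ s l X → T₁ m (s , l , X) → E₃ (s , l , X) → R₃ (reflect (s , l , X))
    forward s l X (e , X< , s<l) ev with m<n⇒∃ X<
    ... | y , y>0 , p = subst R₃ (sym (reflect-+ s l X y p)) (
      ( shiftEquation (12 * (y * s)) (reflect-eq₁ s l y) (reflect-eq₂ s X y p) e
      , trans (cong (λ z → odd (l + z)) (sym (monus X y p))) ev
      , subst (3 * s + y <_) (sym (*-distribˡ-+ 3 l y)) (+-mono-<-≤ (*-monoʳ-< 3 s<l) (m≤n*m y 3))
      , subst (3 * s + y <_) (3+3 s) (+-monoʳ-< (3 * s) (subst (y <_) p (m<n+m y (odd⇒>0 X (odd-root n s l X 8n e)))))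
      , subst (_< l + y + 2 * s) (sym (1+2 s y)) (+-monoˡ-< (2 * s) (+-monoˡ-< y s<l))
      ) , m<m+n (3 * s) y>0)
    inj : ∀ s l X s′ l′ X′ → X < 3 * s → X′ < 3 * s′ → reflect (s , l , X) ≡ reflect (s′ , l′ , X′) → (s , l , X) ≡ (s′ , l′ , X′)
    inj s l X s′ l′ X′ X< X′< e with m<n⇒∃ X< | m<n⇒∃ X′<
    ... | y , _ , p | y′ , _ , p′ with trans (sym (reflect-+ s l X y p)) (trans e (reflect-+ s′ l′ X′ y′ p′))
    ...   | e′ with cong (proj₁ ∘ proj₂) e′
    ...     | refl with +-cancelˡ-≡ (3 * s) y y′ (cong (proj₂ ∘ proj₂) e′)
    ...       | refl = cong₂ (λ a b → s , a , b) (+-cancelʳ-≡ y l l′ (cong proj₁ e′)) (+-cancelʳ-≡ y X X′ (trans p (sym p′)))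
    backward : ∀ A C x → 12 * (A * C) ≡ m + x * x → odd A ≡ false → x < 6 * C → x < A + 2 * C → 3 * C < x →
      ∃ λ i → (T₁ m i × E₃ i) × reflect i ≡ (A , C , x)
    backward A C x e ev x<6C x< 3C<x with m<n⇒∃ 3C<x
    ... | y , y>0 , refl with m<n⇒∃ (+-cancelˡ-< (3 * C) y (3 * C) (subst (3 * C + y <_) (sym (3+3 C)) x<6C))
    ...   | X , _ , q with m<n⇒∃ (+-cancelʳ-< (2 * C) (C + y) A (subst (_< A + 2 * C) (1+2 C y) x<))
    ...     | k , k>0 , r with trans (+-comm X y) q | trans (lem C k y) r
      where
      lem : ∀ C k y → C + k + y ≡ C + y + k
      lem = solve-∀
    ...       | p | refl = (C , C + k , X) ,
      ( ( unshiftEquation (12 * (y * C)) (reflect-eq₁ C (C + k) y) (reflect-eq₂ C X y p) e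
        , subst (X <_) p (m<m+n X y>0) , m<m+n C k>0)
      , trans (cong (λ z → odd (C + k + z)) (monus X y p)) ev) , reflect-+ C (C + k) X y p

  -- On both edges `even-product` gives the evenness of A: here AC = A², and on x = 3C the number C
  -- is odd.
  Q₁-L₁ : ∀ {b} → Par (L₁ m) b → Par R₄ b
  Q₁-L₁ = par-image {Q = R₄} (λ { (A , X) → A , A , X })
    (λ { {A , X} (e , X<) → ((e , ∧-idem-false (even-product n A A X 8n e) , X< , <-≤-trans X< (*-monoˡ-≤ A {3} {6} (s≤s (s≤s (s≤s z≤n)))) , X<) , X<) , refl })
    (λ { _ _ refl → refl })
    (λ { {A , .A , x} (((e , _ , x< , _) , _) , refl) → (A , x) , (e , x<) , refl })
    where
    ∧-idem-false : ∀ {b} → b ∧ b ≡ false → b ≡ false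
    ∧-idem-false {false} _ = refl

  Q₁-L₂ : ∀ {b} → Par (L₂ m) b → Par R₅ b
  Q₁-L₂ = par-image {Q = R₅} (λ { (A , C) → A , C , 3 * C })
    (λ { {A , C} (e , C<A) → let C-odd = trans (sym (odd-* 3 C)) (odd-root n A C (3 * C) 8n e) in
      (e , trans (lem (odd A) C-odd) (even-product n A C (3 * C) 8n e) , *-monoʳ-< 3 C<A
      , subst (3 * C <_) (3+3 C) (m<m+n (3 * C) (*-monoʳ-< 3 (odd⇒>0 C C-odd))) , +-monoˡ-< (2 * C) C<A) , refl })
    (λ { _ _ refl → refl })
    (λ { {A , C , .(3 * C)} ((e , _ , x< , _) , refl) → (A , C) , (e , *-cancelˡ-< 3 C A x<) , refl })
    where
    lem : ∀ a {b} → b ≡ true → a ≡ a ∧ b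
    lem false refl = refl
    lem true  refl = refl

  par-Q₁ : ∀ {b b′} → Par (L₁ m) b → Par (L₂ m) b′ → Par (Q₁ m) (b xor b′)
  par-Q₁ {b} {b′} p₁ p₂ = par-≡ eq (par-tri (λ { (A , C , x) → x }) (λ { (A , C , x) → 3 * C })
    (par-tri (λ { (A , C , x) → A }) (λ { (A , C , x) → C }) (Q₁-E₁ (par-filter E₁? t)) (Q₁-L₁ p₁) (Q₁-E₂ (par-filter E₂? t)))
    (Q₁-L₂ p₂)
    (Q₁-E₃ (par-filter E₃? t)))
    where
    t = proj₂ (T₁-finite m)
    l = Par.elements t
    c₁ = count (does ∘ E₁?) l
    c₂ = count (does ∘ E₂?) l
    c₃ = count (does ∘ E₃?) l
    c-sum : c₁ xor (c₂ xor c₃) ≡ false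
    c-sum = begin
      c₁ xor (c₂ xor c₃)                                                          ≡⟨ cong (c₁ xor_) (count-xor (does ∘ E₂?) (does ∘ E₃?) l) ⟨
      c₁ xor count (λ i → does (E₂? i) xor does (E₃? i)) l                        ≡⟨ count-xor (does ∘ E₁?) _ l ⟨
      count (λ i → does (E₁? i) xor (does (E₂? i) xor does (E₃? i))) l            ≡⟨ count-false l (λ i∈ → two-even n 8n (Par.sound t i∈)) ⟩
      false ∎
      where open ≡-Reasoning
    open MonoidSolver (𝔹.+-commutativeMonoid) using (solve; _⊜_) renaming (_⊕_ to _:+_)
    eq : (c₁ xor (b xor c₂)) xor (b′ xor c₃) ≡ b xor b′
    eq = trans (solve 5 (λ c₁ c₂ c₃ b b′ → ((c₁ :+ (b :+ c₂)) :+ (b′ :+ c₃)) ⊜ ((c₁ :+ (c₂ :+ c₃)) :+ (b :+ b′))) refl c₁ c₂ c₃ b b′)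
      (cong (_xor (b xor b′)) c-sum)

  -- For A = 2a the inequalities of `Q₁` read x < 6a, x < 6c, x < 2a + 2c. They are symmetric in a
  -- and c, and on the diagonal the sharpest one is x < 4a.
  par-H : ∀ {b b′} → Par (L₁ m) b → Par (L₂ m) b′ → Par (H m) (b xor b′)
  par-H p₁ p₂ = par-image {P = λ i → Half i × swap i ≡ i} {Q = H m} (λ { (a , c , x) → a , x })
    (λ { {a , c , x} ((e , _ , _ , _ , x<) , s) → forward a c x (cong proj₁ s) e x< })
    (λ { {a , c , x} {a′ , c′ , x′} (_ , s) (_ , s′) e → inj (cong proj₁ s) (cong proj₁ s′) e })
    (λ { {z , x} (e , x>0 , x<) → (z , z , x) , (backward z x e x< , refl) , refl })
    (par-involution _≟₃_ swap (λ { {a , c , x} h → swap-closed a c x h }) (λ _ → refl)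
      (par-preimage {P = Half} {Q = Q₁ m} double (λ h → h)
        (λ { {a , _} {a′ , _} _ _ e → cong₂ _,_ (*-cancelˡ-≡ a a′ 2 (cong proj₁ e)) (cong proj₂ e) })
        (λ { {A , C , x} h → halve A C x h })
        (par-Q₁ p₁ p₂)))
    where
    Half : Triple → Set
    Half (a , c , x) = Q₁ m (2 * a , c , x)
    double swap : Triple → Triple
    double (a , c , x) = 2 * a , c , x
    swap (a , c , x) = c , a , x
    swap-closed : ∀ a c x → Half (a , c , x) → Half (c , a , x)
    swap-closed a c x (e , _ , x<a , x<c , x<) =
      trans (eq₁ c a) e , odd-* 2 c , subst (x <_) (eq₂ c) x<c , subst (x <_) (sym (eq₂ a)) x<a , subst (x <_) (+-comm (2 * a) (2 * c)) x<
      where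
      eq₁ : ∀ c a → 12 * (2 * c * a) ≡ 12 * (2 * a * c)
      eq₁ = solve-∀
      eq₂ : ∀ c → 6 * c ≡ 3 * (2 * c)
      eq₂ = solve-∀
    halve : ∀ A C x → Q₁ m (A , C , x) → ∃ λ i → Half i × double i ≡ (A , C , x)
    halve A C x h with even⇒ A (proj₁ (proj₂ h))
    ... | a , refl = (a , C , x) , subst (λ A → Q₁ m (A , C , x)) eq h , cong (_, C , x) (sym eq)
      where
      eq : a + a ≡ 2 * a
      eq = cong (a +_) (sym (+-identityʳ a))
    eq₁₂ : ∀ z → 12 * (2 * z * z) ≡ 24 * (z * z)
    eq₁₂ = solve-∀
    eq₂₂ : ∀ z → 2 * z + 2 * z ≡ 4 * z
    eq₂₂ = solve-∀
    forward : ∀ a c x → c ≡ a → 12 * (2 * a * c) ≡ m + x * x → x < 2 * a + 2 * c → H m (a , x)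
    forward a .a x refl e x< = trans (sym (eq₁₂ a)) e , odd⇒>0 x (odd-root n (2 * a) a x 8n e) , subst (x <_) (eq₂₂ a) x<
    inj : ∀ {a c x a′ c′ x′} → c ≡ a → c′ ≡ a′ → (a , x) ≡ (a′ , x′) → (a , c , x) ≡ (a′ , c′ , x′)
    inj refl refl refl = refl
    backward : ∀ z x → 24 * (z * z) ≡ m + x * x → x < 4 * z → Half (z , z , x)
    backward z x e x< = trans (eq₁₂ z) e , odd-* 2 z , <-≤-trans x< (≤-trans 4≤6 (≤-reflexive (eq z))) , <-≤-trans x< 4≤6 , subst (x <_) (sym (eq₂₂ z)) x<
      where
      4≤6 : 4 * z ≤ 6 * z
      4≤6 = *-monoˡ-≤ z {4} {6} (s≤s (s≤s (s≤s (s≤s z≤n))))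
      eq : ∀ z → 6 * z ≡ 3 * (2 * z)
      eq = solve-∀

-- The dissection for the prime 3

+₃ : ∀ a b {c d} → a % 3 ≡ b % 3 → c % 3 ≡ d % 3 → (a + c) % 3 ≡ (b + d) % 3
+₃ a b {c} {d} p r = trans (%-distribˡ-+ a c 3) (trans (cong₂ (λ x y → (x + y) % 3) p r) (sym (%-distribˡ-+ b d 3)))

*₃ : ∀ a b {c d} → a % 3 ≡ b % 3 → c % 3 ≡ d % 3 → (a * c) % 3 ≡ (b * d) % 3
*₃ a b {c} {d} p r = trans (%-distribˡ-* a c 3) (trans (cong₂ (λ x y → (x * y) % 3) p r) (sym (%-distribˡ-* b d 3)))

residue : ℕ → Fin 3
residue a = fromℕ< (m%n<n a 3)

[_]₃ : ℕ → ℕ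
[ a ]₃ = toℕ (residue a)

[]₃-% : ∀ a → a % 3 ≡ [ a ]₃ % 3
[]₃-% a = trans (sym (m%n%n≡m%n a 3)) (cong (_% 3) (sym (toℕ-fromℕ< (m%n<n a 3))))

-- T₂ is the triangle 0 < B < A < C in 4AC = m + B², with B = b, A = b + v and
-- C = b + v + w. The lines A = C, x = C and x = 2C cut Q₂ into four images of it;
-- the third line contains no points.
T₂ Q₂ : ℕ → Triple → Set
T₂ m (b , v , w) = 4 * ((b + v) * (b + v + w)) ≡ m + b * b × 0 < b × 0 < v × 0 < w
Q₂ m (A , C , x) = 4 * (A * C) ≡ m + x * x × A % 3 ≡ 0 × 0 < x × x < A × x < 3 * C

T₂-finite : ∀ m → ∃ (Par (T₂ m))
T₂-finite m = par-bounded₃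
  (λ { (b , v , w) → (4 * ((b + v) * (b + v + w)) ≟ m + b * b) ×-dec (0 <? b) ×-dec (0 <? v) ×-dec (0 <? w) }) (suc m)
  (λ { {b} {v} {w} (e , b>0 , v>0 , w>0) → bound b v w e b>0 v>0 w>0 })
  where
  bound : ∀ b v w → 4 * ((b + v) * (b + v + w)) ≡ m + b * b → 0 < b → 0 < v → 0 < w → b < suc m × v < suc m × w < suc m
  bound b@(suc _) v@(suc _) w@(suc _) e _ _ _ = s≤s (≤-trans (m≤m*n b b) (≤-trans (m≤m+n (b * b) (v * v + b * w)) below)) ,
    s≤s (≤-trans (m≤m*n v v) (≤-trans (m≤m+n (v * v) (b * w)) (≤-trans (m≤n+m _ (b * b)) below))) ,
    s≤s (≤-trans (m≤n*m w b) (≤-trans (m≤n+m (b * w) (v * v)) (≤-trans (m≤n+m _ (b * b)) below)))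
    where
    -- In these coordinates 4AC - B² has nonnegative coefficients only, so m bounds b² + v² + bw.
    eq : ∀ b v w → b * b + (v * v + b * w) + b * b + (2 * (b * b) + 8 * (b * v) + 3 * (v * v) + 3 * (b * w) + 4 * (v * w)) ≡ 4 * ((b + v) * (b + v + w))
    eq = solve-∀
    below : b * b + (v * v + b * w) ≤ m
    below = +-cancelʳ-≤ (b * b) _ _ (≤-trans (m≤m+n _ _) (≤-reflexive (trans (eq b v w) e)))

-- The vertices A, C and A ± x + C of a triangle, of which two are divisible by 3.
F₁ F₂ F₃ F₄ : Triple → Set
F₁ (b , v , w) = (b + v) % 3 ≡ 0
F₂ (b , v , w) = (b + v + w) % 3 ≡ 0
F₃ (b , v , w) = (2 * v + b + w) % 3 ≡ 0
F₄ (b , v , w) = (2 * (b + v) + b + w) % 3 ≡ 0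

F₁? : Decidable F₁
F₁? (b , v , w) = (b + v) % 3 ≟ 0
F₂? : Decidable F₂
F₂? (b , v , w) = (b + v + w) % 3 ≟ 0
F₃? : Decidable F₃
F₃? (b , v , w) = (2 * v + b + w) % 3 ≟ 0
F₄? : Decidable F₄
F₄? (b , v , w) = (2 * (b + v) + b + w) % 3 ≟ 0

F-parity : Triple → Bool
F-parity i = does (F₁? i) xor (does (F₂? i) xor (does (F₃? i) xor does (F₄? i)))

-- A statement about residues modulo 3, settled by evaluating all 27 triples; the 2 stands for m.
F-parity-residues : ∀ (i j k : Fin 3) → let b = toℕ i ; v = toℕ j ; w = toℕ k in
  4 * ((b + v) * (b + v + w)) % 3 ≡ (2 + b * b) % 3 → F-parity (b , v , w) ≡ false
F-parity-residues = from-yes (all? {n = 3} (λ i → all? {n = 3} (λ j → all? {n = 3} (λ k → let b = toℕ i ; v = toℕ j ; w = toℕ k in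
  (4 * ((b + v) * (b + v + w)) % 3 ≟ (2 + b * b) % 3) →-dec (F-parity (b , v , w) Bool.≟ false)))))

two-divisible : ∀ {m} → m % 3 ≡ 2 → ∀ {i} → T₂ m i → F-parity i ≡ false
two-divisible {m} m≡2 {b , v , w} (e , _) = trans (cong₂ _xor_ (at p₁) (cong₂ _xor_ (at p₂) (cong₂ _xor_ (at p₃) (at p₄))))
  (F-parity-residues (residue b) (residue v) (residue w) (begin
    4 * (([ b ]₃ + [ v ]₃) * ([ b ]₃ + [ v ]₃ + [ w ]₃)) % 3
      ≡⟨ *₃ 4 4 {(b + v) * (b + v + w)} {([ b ]₃ + [ v ]₃) * ([ b ]₃ + [ v ]₃ + [ w ]₃)} refl (*₃ (b + v) ([ b ]₃ + [ v ]₃) {b + v + w} {[ b ]₃ + [ v ]₃ + [ w ]₃} p₁ p₂) ⟨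
    4 * ((b + v) * (b + v + w)) % 3   ≡⟨ cong (_% 3) e ⟩
    (m + b * b) % 3                   ≡⟨ +₃ m 2 {b * b} {[ b ]₃ * [ b ]₃} m≡2 (*₃ b [ b ]₃ {b} {[ b ]₃} ([]₃-% b) ([]₃-% b)) ⟩
    (2 + [ b ]₃ * [ b ]₃) % 3         ∎))
  where
  open ≡-Reasoning
  p₁ : (b + v) % 3 ≡ ([ b ]₃ + [ v ]₃) % 3
  p₁ = +₃ b [ b ]₃ {v} {[ v ]₃} ([]₃-% b) ([]₃-% v)
  p₂ : (b + v + w) % 3 ≡ ([ b ]₃ + [ v ]₃ + [ w ]₃) % 3
  p₂ = +₃ (b + v) ([ b ]₃ + [ v ]₃) {w} {[ w ]₃} p₁ ([]₃-% w)
  +bw : ∀ x y → x % 3 ≡ y % 3 → (2 * x + b + w) % 3 ≡ (2 * y + [ b ]₃ + [ w ]₃) % 3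
  +bw x y p = +₃ (2 * x + b) (2 * y + [ b ]₃) {w} {[ w ]₃} (+₃ (2 * x) (2 * y) {b} {[ b ]₃} (*₃ 2 2 {x} {y} refl p) ([]₃-% b)) ([]₃-% w)
  p₃ : (2 * v + b + w) % 3 ≡ (2 * [ v ]₃ + [ b ]₃ + [ w ]₃) % 3
  p₃ = +bw v [ v ]₃ ([]₃-% v)
  p₄ : (2 * (b + v) + b + w) % 3 ≡ (2 * ([ b ]₃ + [ v ]₃) + [ b ]₃ + [ w ]₃) % 3
  p₄ = +bw (b + v) ([ b ]₃ + [ v ]₃) p₁
  at : ∀ {x y} → x ≡ y → does (x ≟ 0) ≡ does (y ≟ 0)
  at = cong (λ z → does (z ≟ 0))

L₃ L₄ Div : ℕ → ℕ × ℕ → Set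
L₃ m (A , x) = 4 * (A * A) ≡ m + x * x × 0 < x × x < A
L₄ m (A , C) = 4 * (A * C) ≡ m + C * C × C < A
Div m (d , e) = d * e ≡ m × d < e

-- Modulo 3 the edge reads A² = 2 + x², which leaves only A = 0. Together with the next lemma this
-- puts the edge points into `Q₂`.
3∣-L₃ : ∀ m A x → m % 3 ≡ 2 → 4 * (A * A) ≡ m + x * x → A % 3 ≡ 0
3∣-L₃ m A x m≡2 e = trans ([]₃-% A) (check (residue A) (residue x) (begin
  4 * ([ A ]₃ * [ A ]₃) % 3 ≡⟨ *₃ 4 4 {A * A} {[ A ]₃ * [ A ]₃} refl (*₃ A [ A ]₃ {A} {[ A ]₃} ([]₃-% A) ([]₃-% A)) ⟨
  4 * (A * A) % 3           ≡⟨ cong (_% 3) e ⟩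
  (m + x * x) % 3         ≡⟨ +₃ m 2 {x * x} {[ x ]₃ * [ x ]₃} m≡2 (*₃ x [ x ]₃ {x} {[ x ]₃} ([]₃-% x) ([]₃-% x)) ⟩
  (2 + [ x ]₃ * [ x ]₃) % 3 ∎))
  where
  open ≡-Reasoning
  check : ∀ (i j : Fin 3) → 4 * (toℕ i * toℕ i) % 3 ≡ (2 + toℕ j * toℕ j) % 3 → toℕ i % 3 ≡ 0
  check = from-yes (all? {n = 3} (λ i → all? {n = 3} (λ j → (4 * (toℕ i * toℕ i) % 3 ≟ (2 + toℕ j * toℕ j) % 3) →-dec (toℕ i % 3 ≟ 0))))

3∣-L₄ : ∀ m A C → m % 3 ≡ 2 → 4 * (A * C) ≡ m + C * C → A % 3 ≡ 0
3∣-L₄ m A C m≡2 e = trans ([]₃-% A) (check (residue A) (residue C) (begin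
  4 * ([ A ]₃ * [ C ]₃) % 3 ≡⟨ *₃ 4 4 {A * C} {[ A ]₃ * [ C ]₃} refl (*₃ A [ A ]₃ {C} {[ C ]₃} ([]₃-% A) ([]₃-% C)) ⟨
  4 * (A * C) % 3           ≡⟨ cong (_% 3) e ⟩
  (m + C * C) % 3         ≡⟨ +₃ m 2 {C * C} {[ C ]₃ * [ C ]₃} m≡2 (*₃ C [ C ]₃ {C} {[ C ]₃} ([]₃-% C) ([]₃-% C)) ⟩
  (2 + [ C ]₃ * [ C ]₃) % 3 ∎))
  where
  open ≡-Reasoning
  check : ∀ (i j : Fin 3) → 4 * (toℕ i * toℕ j) % 3 ≡ (2 + toℕ j * toℕ j) % 3 → toℕ i % 3 ≡ 0
  check = from-yes (all? {n = 3} (λ i → all? {n = 3} (λ j → (4 * (toℕ i * toℕ j) % 3 ≟ (2 + toℕ j * toℕ j) % 3) →-dec (toℕ i % 3 ≟ 0))))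

8n-1-odd : ∀ {m} n → 8 * n ≡ suc m → odd m ≡ true
8n-1-odd {m} n 8n = lem (odd m) (trans (cong odd (sym 8n)) (odd-* 8 n))
  where
  lem : ∀ b → not b ≡ false → b ≡ true
  lem true _ = refl

∧-true : ∀ a b → a ∧ b ≡ true → a ≡ true × b ≡ true
∧-true true true _ = refl , refl

odd-factors : ∀ d e → odd (d * e) ≡ true → d < e → ∃ λ x → 0 < x × e ≡ d + 2 * x × odd d ≡ true
odd-factors d e o d<e with m<n⇒∃ d<e
... | k , k>0 , refl with ∧-true (odd d) (odd (d + k)) (trans (sym (odd-* d (d + k))) o)
...   | od , oe with even⇒ k (lem (odd d) (odd k) od (trans (sym (odd-+ d k)) oe))
  where
  lem : ∀ a b → a ≡ true → a xor b ≡ true → b ≡ false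
  lem true false _ _ = refl
...     | zero , refl = ⊥-elim (<-irrefl refl k>0)
...     | x@(suc _) , refl = x , z<s , cong (d +_) (cong (x +_) (sym (+-identityʳ x))) , od

module _ {m n : ℕ} (8n : 8 * n ≡ suc m) where

  -- From de = 3 modulo 4 it follows that d + e is divisible by 4; A is the quotient, which both
  -- edge parametrisations need.
  factors-7-mod-8 : ∀ d e → d * e ≡ m → d < e → ∃ λ x → ∃ λ A → 0 < x × e ≡ d + 2 * x × d + x ≡ 2 * A
  factors-7-mod-8 d e de d<e with odd-factors d e (trans (cong odd de) (8n-1-odd n 8n)) d<e
  ... | x , x>0 , refl , od with odd x in ox
  ...   | true  = let (A , p) = even⇒ (d + x) (trans (odd-+ d x) (cong₂ _xor_ od ox)) in x , A , x>0 , refl , trans p (cong (A +_) (sym (+-identityʳ A)))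
  ...   | false with odd⇒ d od | even⇒ x ox
  ...     | i , refl | j , refl = ⊥-elim (contra (trans (sym (odd-* 4 n)) (trans (cong odd (*-cancelˡ-≡ (4 * n) (suc (2 * (i * i + i + j * suc (i + i)))) 2
      (trans (eq₁ n) (trans 8n (trans (cong suc (sym de)) (eq₂ i j)))))) (cong not (odd-* 2 (i * i + i + j * suc (i + i)))))))
    where
    contra : false ≡ true → ⊥
    contra ()
    eq₁ : ∀ n → 2 * (4 * n) ≡ 8 * n
    eq₁ = solve-∀
    eq₂ : ∀ i j → suc (suc (i + i) * (suc (i + i) + 2 * (j + j))) ≡ 2 * suc (2 * (i * i + i + j * suc (i + i)))
    eq₂ = solve-∀

  module _ (m≡2 : m % 3 ≡ 2) where

    3*k%3 : ∀ k → (3 * k) % 3 ≡ 0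
    3*k%3 k = trans (cong (_% 3) (*-comm 3 k)) (m*n%n≡0 k 3)

    -- Here m = (2A - x)(2A + x), and x < A says that e < 3d.
    L₃-Div : ∀ {b} → Par (λ i → Div m i × proj₂ i < 3 * proj₁ i) b → Par (L₃ m) b
    L₃-Div = par-preimage ψ
      (λ { {A , x} (e , x>0 , x<A) → forward A x e x>0 x<A })
      (λ { {A , x} {A′ , x′} (_ , _ , x<) (_ , _ , x′<) p → injective A x A′ x′ x< x′< p })
      (λ { {d , e} ((de , d<e) , e<) → backward d e de d<e e< })
      where
      ψ : ℕ × ℕ → ℕ × ℕ
      ψ (A , x) = 2 * A ∸ x , 2 * A + x
      ψ-+ : ∀ A x d → x + d ≡ 2 * A → ψ (A , x) ≡ (d , d + 2 * x)
      ψ-+ A x d p = cong₂ _,_ (monus x d p) (trans (cong (_+ x) (sym p)) (eq x d))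
        where
        eq : ∀ x d → x + d + x ≡ d + 2 * x
        eq = solve-∀
      A<2A : ∀ {A x} → x < A → x < 2 * A
      A<2A {A} x< = <-≤-trans x< (m≤m+n A (1 * A))
      product : ∀ A x d → x + d ≡ 2 * A → d * (d + 2 * x) + x * x ≡ 4 * (A * A)
      product A x d p = trans (eq₁ x d) (trans (cong (λ k → k * k) p) (eq₂ A))
        where
        eq₁ : ∀ x d → d * (d + 2 * x) + x * x ≡ (x + d) * (x + d)
        eq₁ = solve-∀
        eq₂ : ∀ A → 2 * A * (2 * A) ≡ 4 * (A * A)
        eq₂ = solve-∀
      forward : ∀ A x → 4 * (A * A) ≡ m + x * x → 0 < x → x < A → Div m (ψ (A , x)) × proj₂ (ψ (A , x)) < 3 * proj₁ (ψ (A , x))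
      forward A x e x>0 x<A with m<n⇒∃ (A<2A x<A)
      ... | d , _ , p = subst (λ i → Div m i × proj₂ i < 3 * proj₁ i) (sym (ψ-+ A x d p))
        ((+-cancelʳ-≡ (x * x) (d * (d + 2 * x)) m (trans (product A x d p) e) , m<m+n d (≤-trans x>0 (m≤m+n x (1 * x))))
        , +-monoʳ-< d (*-monoʳ-< 2 (+-cancelˡ-< x x d (subst (x + x <_) (sym p) (subst (_< 2 * A) (cong (x +_) (+-identityʳ x)) (*-monoʳ-< 2 x<A))))))
      injective : ∀ A x A′ x′ → x < A → x′ < A′ → ψ (A , x) ≡ ψ (A′ , x′) → (A , x) ≡ (A′ , x′)
      injective A x A′ x′ x< x′< eq with m<n⇒∃ (A<2A x<) | m<n⇒∃ (A<2A x′<)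
      ... | d , _ , p | d′ , _ , p′ with trans (sym (ψ-+ A x d p)) (trans eq (ψ-+ A′ x′ d′ p′))
      ...   | eq′ with cong proj₁ eq′
      ...     | refl with *-cancelˡ-≡ x x′ 2 (+-cancelˡ-≡ d (2 * x) (2 * x′) (cong proj₂ eq′))
      ...       | refl = cong (_, x) (*-cancelˡ-≡ A A′ 2 (trans (sym p) p′))
      backward : ∀ d e → d * e ≡ m → d < e → e < 3 * d → ∃ λ i → L₃ m i × ψ i ≡ (d , e)
      backward d e de d<e e< with factors-7-mod-8 d e de d<e
      ... | x , A , x>0 , refl , p = (A , x) , (trans (sym (product A x d p′)) (cong (_+ x * x) de) , x>0 ,
          *-cancelˡ-< 2 x A (subst (2 * x <_) p (subst (_< d + x) (cong (x +_) (sym (+-identityʳ x))) (+-monoˡ-< x (*-cancelˡ-< 2 x d (+-cancelˡ-< d (2 * x) (2 * d) e<))))))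
        , ψ-+ A x d p′
        where p′ = trans (+-comm x d) p

    -- Here m = C(4A - C), and C < A says that 3d < e: exactly the factorisations that the other
    -- edge leaves over.
    L₄-Div : ∀ {b} → Par (λ i → Div m i × 3 * proj₁ i < proj₂ i) b → Par (L₄ m) b
    L₄-Div = par-preimage ψ
      (λ { {A , C} (e , C<A) → forward A C e C<A })
      (λ { {A , C} {A′ , C′} (_ , <A) (_ , <A′) p → injective A C A′ C′ <A <A′ p })
      (λ { {d , e} ((de , d<e) , <e) → backward d e de d<e <e })
      where
      ψ : ℕ × ℕ → ℕ × ℕ
      ψ (A , C) = C , 4 * A ∸ C
      ψ-+ : ∀ A C e → C + e ≡ 4 * A → ψ (A , C) ≡ (C , e)
      ψ-+ A C e p = cong (C ,_) (monus C e p)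
      A<4A : ∀ {A x} → x < A → x < 4 * A
      A<4A {A} x< = <-≤-trans x< (m≤m+n A (3 * A))
      product : ∀ A C e → C + e ≡ 4 * A → C * e + C * C ≡ 4 * (A * C)
      product A C e p = trans (eq₁ C e) (trans (cong (_* C) p) (*-assoc 4 A C))
        where
        eq₁ : ∀ C e → C * e + C * C ≡ (C + e) * C
        eq₁ = solve-∀
      forward : ∀ A C → 4 * (A * C) ≡ m + C * C → C < A → Div m (ψ (A , C)) × 3 * proj₁ (ψ (A , C)) < proj₂ (ψ (A , C))
      forward A C eq C<A with m<n⇒∃ (A<4A C<A)
      ... | e , _ , p = subst (λ i → Div m i × 3 * proj₁ i < proj₂ i) (sym (ψ-+ A C e p))
        ((+-cancelʳ-≡ (C * C) (C * e) m (trans (product A C e p) eq) , ≤-<-trans (m≤m+n C (2 * C)) 3C<e) , 3C<e)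
        where
        3C<e : 3 * C < e
        3C<e = +-cancelˡ-< C (3 * C) e (subst (4 * C <_) (sym p) (*-monoʳ-< 4 C<A))
      injective : ∀ A C A′ C′ → C < A → C′ < A′ → ψ (A , C) ≡ ψ (A′ , C′) → (A , C) ≡ (A′ , C′)
      injective A C A′ C′ <A <A′ eq with m<n⇒∃ (A<4A <A) | m<n⇒∃ (A<4A <A′)
      ... | e , _ , p | e′ , _ , p′ with trans (sym (ψ-+ A C e p)) (trans eq (ψ-+ A′ C′ e′ p′))
      ...   | refl = cong (_, C) (*-cancelˡ-≡ A A′ 4 (trans (sym p) p′))
      backward : ∀ d e → d * e ≡ m → d < e → 3 * d < e → ∃ λ i → L₄ m i × ψ i ≡ (d , e)
      backward d e de d<e <e with factors-7-mod-8 d e de d<e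
      ... | x , A , x>0 , refl , p = (A , d) , (trans (sym (product A d (d + 2 * x) p′)) (cong (_+ d * d) de) ,
          *-cancelˡ-< 4 d A (subst (4 * d <_) p′ (+-monoʳ-< d <e))) , ψ-+ A d (d + 2 * x) p′
        where
        eq : ∀ d x → d + (d + 2 * x) ≡ 2 * (d + x)
        eq = solve-∀
        p′ : d + (d + 2 * x) ≡ 4 * A
        p′ = trans (eq d x) (trans (cong (2 *_) p) (sym (*-assoc 2 2 A)))

    Div-middle : ∀ {i} → ¬ (Div m i × proj₂ i ≡ 3 * proj₁ i)
    Div-middle {d , _} ((de , _) , refl) = contra (trans (sym (3*k%3 (d * d))) (trans (cong (_% 3) (eq d)) (trans (cong (_% 3) de) m≡2)))
      where
      contra : 0 ≡ 2 → ⊥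
      contra ()
      eq : ∀ d → 3 * (d * d) ≡ d * (3 * d)
      eq = solve-∀

    U₁ U₂ U₃ U₄ U₅ U₆ : Triple → Set
    U₁ i@(A , C , x) = (Q₂ m i × x < C) × A < C
    U₂ i@(A , C , x) = (Q₂ m i × x < C) × C < A
    U₃ i@(A , C , x) = (Q₂ m i × C < x) × x < 2 * C
    U₄ i@(A , C , x) = (Q₂ m i × C < x) × 2 * C < x
    U₅ i@(A , C , x) = (Q₂ m i × x < C) × A ≡ C
    U₆ i@(A , C , x) = Q₂ m i × x ≡ C

    x<3C : ∀ x C → x < C → x < 3 * C
    x<3C x C x<C = <-≤-trans x<C (m≤m+n C (2 * C))

    Q₂-F₁ : ∀ {b} → Par (λ i → T₂ m i × F₁ i) b → Par U₁ b
    Q₂-F₁ = par-image {Q = U₁} φ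
      (λ { {b , v , w} ((e , b>0 , v>0 , w>0) , f) → let x<A = m<m+n b v>0 ; A<C = m<m+n (b + v) w>0 ; x<C = <-trans x<A A<C in
        ((e , f , b>0 , x<A , x<3C b _ x<C) , x<C) , A<C })
      (λ { {b , v , w} {b′ , v′ , w′} _ _ p → injective b v w b′ v′ w′ p })
      (λ { {A , C , x} (((e , f , x>0 , x<A , _) , _) , A<C) → backward A C x e f x>0 x<A A<C })
      where
      φ : Triple → Triple
      φ (b , v , w) = b + v , b + v + w , b
      injective : ∀ b v w b′ v′ w′ → φ (b , v , w) ≡ φ (b′ , v′ , w′) → (b , v , w) ≡ (b′ , v′ , w′)
      injective b v w b′ v′ w′ p with cong (proj₂ ∘ proj₂) p
      ... | refl with +-cancelˡ-≡ b v v′ (cong proj₁ p)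
      ...   | refl = cong (λ z → b , v , z) (+-cancelˡ-≡ (b + v) w w′ (cong (proj₁ ∘ proj₂) p))
      backward : ∀ A C x → 4 * (A * C) ≡ m + x * x → A % 3 ≡ 0 → 0 < x → x < A → A < C → ∃ λ i → (T₂ m i × F₁ i) × φ i ≡ (A , C , x)
      backward A C x e f x>0 x<A A<C with m<n⇒∃ x<A
      ... | v , v>0 , refl with m<n⇒∃ A<C
      ...   | w , w>0 , refl = (x , v , w) , ((e , x>0 , v>0 , w>0) , f) , refl

    Q₂-F₂ : ∀ {b} → Par (λ i → T₂ m i × F₂ i) b → Par U₂ b
    Q₂-F₂ = par-image {Q = U₂} φ
      (λ { {b , v , w} ((e , b>0 , v>0 , w>0) , f) → let x<C = m<m+n b v>0 ; C<A = m<m+n (b + v) w>0 in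
        ((trans (cong (4 *_) (*-comm (b + v + w) (b + v))) e , f , b>0 , <-trans x<C C<A , x<3C b _ x<C) , x<C) , C<A })
      (λ { {b , v , w} {b′ , v′ , w′} _ _ p → injective b v w b′ v′ w′ p })
      (λ { {A , C , x} (((e , f , x>0 , _) , x<C) , C<A) → backward A C x e f x>0 x<C C<A })
      where
      φ : Triple → Triple
      φ (b , v , w) = b + v + w , b + v , b
      injective : ∀ b v w b′ v′ w′ → φ (b , v , w) ≡ φ (b′ , v′ , w′) → (b , v , w) ≡ (b′ , v′ , w′)
      injective b v w b′ v′ w′ p with cong (proj₂ ∘ proj₂) p
      ... | refl with +-cancelˡ-≡ b v v′ (cong (proj₁ ∘ proj₂) p)
      ...   | refl = cong (λ z → b , v , z) (+-cancelˡ-≡ (b + v) w w′ (cong proj₁ p))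
      backward : ∀ A C x → 4 * (A * C) ≡ m + x * x → A % 3 ≡ 0 → 0 < x → x < C → C < A → ∃ λ i → (T₂ m i × F₂ i) × φ i ≡ (A , C , x)
      backward A C x e f x>0 x<C C<A with m<n⇒∃ x<C
      ... | v , v>0 , refl with m<n⇒∃ C<A
      ...   | w , w>0 , refl = (x , v , w) , ((trans (cong (4 *_) (*-comm (x + v) (x + v + w))) e , x>0 , v>0 , w>0) , f) , refl

    -- The reflection x ↦ 2C - x in the line x = C, with the smaller vertex b + v in the place of C.
    -- Positivity of b, v, w becomes x < 2C, C < x, x < A.
    Q₂-F₃ : ∀ {b} → Par (λ i → T₂ m i × F₃ i) b → Par U₃ b
    Q₂-F₃ = par-image {Q = U₃} φ
      (λ { {b , v , w} ((e , b>0 , v>0 , w>0) , f) → let C<x = subst (b + v <_) (eq₃ b v) (m<m+n (b + v) v>0) ; x<2C = subst (2 * v + b <_) (eq₄ b v) (m<m+n (2 * v + b) b>0) in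
        ((shiftEquation (4 * (v * (b + v))) (eq₁ b v w) (eq₂ m b v) e , f , ≤-trans b>0 (m≤n+m b (2 * v)) , m<m+n (2 * v + b) w>0 ,
          <-≤-trans x<2C (*-monoˡ-≤ (b + v) {2} {3} (s≤s (s≤s z≤n)))) , C<x) , x<2C })
      (λ { {b , v , w} {b′ , v′ , w′} _ _ p → injective b v w b′ v′ w′ p })
      (λ { {A , C , x} (((e , f , x>0 , x<A , _) , C<x) , x<2C) → backward A C x e f x<A C<x x<2C })
      where
      φ : Triple → Triple
      φ (b , v , w) = 2 * v + b + w , b + v , 2 * v + b
      eq₁ : ∀ b v w → 4 * ((2 * v + b + w) * (b + v)) ≡ 4 * ((b + v) * (b + v + w)) + 4 * (v * (b + v))
      eq₁ = solve-∀
      eq₂ : ∀ m b v → m + (2 * v + b) * (2 * v + b) ≡ m + b * b + 4 * (v * (b + v))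
      eq₂ = solve-∀
      eq₃ : ∀ b v → b + v + v ≡ 2 * v + b
      eq₃ = solve-∀
      eq₄ : ∀ b v → 2 * v + b + b ≡ 2 * (b + v)
      eq₄ = solve-∀
      injective : ∀ b v w b′ v′ w′ → φ (b , v , w) ≡ φ (b′ , v′ , w′) → (b , v , w) ≡ (b′ , v′ , w′)
      injective b v w b′ v′ w′ p with +-cancelˡ-≡ (b + v) v v′ (trans (trans (eq₃ b v) (trans (cong (proj₂ ∘ proj₂) p) (sym (eq₃ b′ v′)))) (cong (_+ v′) (sym (cong (proj₁ ∘ proj₂) p))))
      ... | refl with +-cancelʳ-≡ v b b′ (cong (proj₁ ∘ proj₂) p)
      ...   | refl = cong (λ z → b , v , z) (+-cancelˡ-≡ (2 * v + b) w w′ (cong proj₁ p))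
      backward : ∀ A C x → 4 * (A * C) ≡ m + x * x → A % 3 ≡ 0 → x < A → C < x → x < 2 * C → ∃ λ i → (T₂ m i × F₃ i) × φ i ≡ (A , C , x)
      backward A C x e f x<A C<x x<2C with m<n⇒∃ C<x
      ... | v , v>0 , refl with m<n⇒∃ x<2C
      ...   | b , b>0 , q with +-cancelˡ-≡ C C (b + v) (trans (cong (C +_) (sym (+-identityʳ C))) (trans (sym q) (eq C v b)))
        where
        eq : ∀ C v b → C + v + b ≡ C + (b + v)
        eq = solve-∀
      ...     | refl with m<n⇒∃ x<A
      ...       | w , w>0 , refl = (b , v , w) , ((unshiftEquation (4 * (v * (b + v))) (eq₁ b v w) (eq₂ m b v)
                    (subst (λ z → 4 * ((z + w) * (b + v)) ≡ m + z * z) (eq₃ b v) e) , b>0 , v>0 , w>0)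
                  , trans (cong (λ z → (z + w) % 3) (sym (eq₃ b v))) f) , cong (λ z → z + w , b + v , z) (sym (eq₃ b v))

    -- The translation x ↦ x + 2C, which brings A + x + C to the first place. Positivity of b, v, w
    -- becomes 2C < x, x < 3C, x < A; this is the source of the bound x < 3C in `Q₂`.
    Q₂-F₄ : ∀ {b} → Par (λ i → T₂ m i × F₄ i) b → Par U₄ b
    Q₂-F₄ = par-image {Q = U₄} φ
      (λ { {b , v , w} ((e , b>0 , v>0 , w>0) , f) → let 2C<x = m<m+n (2 * (b + v)) b>0 in
        ((shiftEquation (4 * ((2 * b + v) * (b + v))) (eq₁ b v w) (eq₂ m b v) e , f , ≤-trans b>0 (m≤n+m b (2 * (b + v))) , m<m+n (2 * (b + v) + b) w>0 ,
          subst (2 * (b + v) + b <_) (eq₃ b v) (m<m+n (2 * (b + v) + b) v>0)) , ≤-<-trans (m≤m+n (b + v) (1 * (b + v))) 2C<x) , 2C<x })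
      (λ { {b , v , w} {b′ , v′ , w′} _ _ p → injective b v w b′ v′ w′ p })
      (λ { {A , C , x} (((e , f , _ , x<A , x<3C) , _) , 2C<x) → backward A C x e f x<A 2C<x x<3C })
      where
      φ : Triple → Triple
      φ (b , v , w) = 2 * (b + v) + b + w , b + v , 2 * (b + v) + b
      eq₁ : ∀ b v w → 4 * ((2 * (b + v) + b + w) * (b + v)) ≡ 4 * ((b + v) * (b + v + w)) + 4 * ((2 * b + v) * (b + v))
      eq₁ = solve-∀
      eq₂ : ∀ m b v → m + (2 * (b + v) + b) * (2 * (b + v) + b) ≡ m + b * b + 4 * ((2 * b + v) * (b + v))
      eq₂ = solve-∀
      eq₃ : ∀ b v → 2 * (b + v) + b + v ≡ 3 * (b + v)
      eq₃ = solve-∀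
      injective : ∀ b v w b′ v′ w′ → φ (b , v , w) ≡ φ (b′ , v′ , w′) → (b , v , w) ≡ (b′ , v′ , w′)
      injective b v w b′ v′ w′ p with +-cancelˡ-≡ (2 * (b + v)) b b′ (trans (cong (proj₂ ∘ proj₂) p) (cong (λ z → 2 * z + b′) (sym (cong (proj₁ ∘ proj₂) p))))
      ... | refl with +-cancelˡ-≡ b v v′ (cong (proj₁ ∘ proj₂) p)
      ...   | refl = cong (λ z → b , v , z) (+-cancelˡ-≡ (2 * (b + v) + b) w w′ (cong proj₁ p))
      backward : ∀ A C x → 4 * (A * C) ≡ m + x * x → A % 3 ≡ 0 → x < A → 2 * C < x → x < 3 * C → ∃ λ i → (T₂ m i × F₄ i) × φ i ≡ (A , C , x)
      backward A C x e f x<A 2C<x x<3C with m<n⇒∃ 2C<x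
      ... | b , b>0 , refl with m<n⇒∃ x<3C
      ...   | v , v>0 , q with +-cancelˡ-≡ (2 * C) C (b + v) (trans (eq C) (trans (sym q) (+-assoc (2 * C) b v)))
        where
        eq : ∀ C → 2 * C + C ≡ 3 * C
        eq = solve-∀
      ...     | refl with m<n⇒∃ x<A
      ...       | w , w>0 , refl = (b , v , w) , ((unshiftEquation (4 * ((2 * b + v) * (b + v))) (eq₁ b v w) (eq₂ m b v) e , b>0 , v>0 , w>0) , f) , refl

    Q₂-L₃ : ∀ {b} → Par (L₃ m) b → Par U₅ b
    Q₂-L₃ = par-image {Q = U₅} (λ { (A , x) → A , A , x })
      (λ { {A , x} (e , x>0 , x<A) → ((e , 3∣-L₃ m A x m≡2 e , x>0 , x<A , x<3C x A x<A) , x<A) , refl })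
      (λ { _ _ refl → refl })
      (λ { {A , .A , x} (((e , _ , x>0 , x<A , _) , _) , refl) → (A , x) , (e , x>0 , x<A) , refl })

    Q₂-L₄ : ∀ {b} → Par (L₄ m) b → Par U₆ b
    Q₂-L₄ = par-image {Q = U₆} (λ { (A , C) → A , C , C })
      (λ { {A , C} (e , C<A) → let C>0 = positive A C e in (e , 3∣-L₄ m A C m≡2 e , C>0 , C<A , m<m+n C (≤-trans C>0 (m≤m+n C (1 * C)))) , refl })
      (λ { _ _ refl → refl })
      (λ { {A , C , .C} ((e , _ , _ , C<A , _) , refl) → (A , C) , (e , C<A) , refl })
      where
      positive : ∀ A C → 4 * (A * C) ≡ m + C * C → 0 < C
      positive A (suc C) e = z<s
      positive A zero    e with trans (sym m≡2) (cong (_% 3) (trans (sym (+-identityʳ m)) (trans (sym e) (cong (4 *_) (*-zeroʳ A)))))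
      ... | ()

    par-Q₂ : ∀ {b} → Par (Div m) b → Par (Q₂ m) b
    par-Q₂ {b} δ = par-≡ eq (par-tri (λ { (A , C , x) → x }) (λ { (A , C , x) → C })
      (par-tri (λ { (A , C , x) → A }) (λ { (A , C , x) → C }) (Q₂-F₁ (par-filter F₁? t)) (Q₂-L₃ (L₃-Div δ₁)) (Q₂-F₂ (par-filter F₂? t)))
      (Q₂-L₄ (L₄-Div δ₂))
      (par-tri (λ { (A , C , x) → x }) (λ { (A , C , x) → 2 * C }) (Q₂-F₃ (par-filter F₃? t)) (par-∅ middle) (Q₂-F₄ (par-filter F₄? t))))
      where
      t = proj₂ (T₂-finite m)
      δ₁ = par-filter (λ i → proj₂ i <? 3 * proj₁ i) δ
      δ₂ = par-filter (λ i → 3 * proj₁ i <? proj₂ i) δ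
      b₁ = count (λ i → does (proj₂ i <? 3 * proj₁ i)) (Par.elements δ)
      b₂ = count (λ i → does (3 * proj₁ i <? proj₂ i)) (Par.elements δ)
      b₁₂ : b₁ xor b₂ ≡ b
      b₁₂ = par-unique (par-tri (λ i → proj₂ i) (λ i → 3 * proj₁ i) δ₁ (par-∅ Div-middle) δ₂) δ
      l = Par.elements t
      c₁ = count (does ∘ F₁?) l
      c₂ = count (does ∘ F₂?) l
      c₃ = count (does ∘ F₃?) l
      c₄ = count (does ∘ F₄?) l
      c-sum : c₁ xor (c₂ xor (c₃ xor c₄)) ≡ false
      c-sum = begin
        c₁ xor (c₂ xor (c₃ xor c₄))                                     ≡⟨ cong (λ z → c₁ xor (c₂ xor z)) (count-xor (does ∘ F₃?) (does ∘ F₄?) l) ⟨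
        c₁ xor (c₂ xor count (λ i → does (F₃? i) xor does (F₄? i)) l)   ≡⟨ cong (c₁ xor_) (count-xor (does ∘ F₂?) _ l) ⟨
        c₁ xor count (λ i → does (F₂? i) xor (does (F₃? i) xor does (F₄? i))) l ≡⟨ count-xor (does ∘ F₁?) _ l ⟨
        count F-parity l                                                ≡⟨ count-false l (λ i∈ → two-divisible m≡2 (Par.sound t i∈)) ⟩
        false ∎
        where open ≡-Reasoning
      open MonoidSolver (𝔹.+-commutativeMonoid) using (solve; _⊜_) renaming (_⊕_ to _:+_)
      eq : (c₁ xor (b₁ xor c₂)) xor (b₂ xor (c₃ xor c₄)) ≡ b
      eq = trans (solve 6 (λ c₁ c₂ c₃ c₄ b b′ → ((c₁ :+ (b :+ c₂)) :+ (b′ :+ (c₃ :+ c₄))) ⊜ ((c₁ :+ (c₂ :+ (c₃ :+ c₄))) :+ (b :+ b′))) refl c₁ c₂ c₃ c₄ b₁ b₂)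
        (trans (cong (_xor (b₁ xor b₂)) c-sum) b₁₂)
      -- On the line x = 2C the sum m + x² would be odd, as m is odd, but it equals 4AC.
      middle : ∀ {i} → ¬ ((Q₂ m i × proj₁ (proj₂ i) < proj₂ (proj₂ i)) × proj₂ (proj₂ i) ≡ 2 * proj₁ (proj₂ i))
      middle {A , C , _} (((e , _) , _) , refl) = contra (trans (sym (odd-* 4 (A * C))) (trans (cong odd e)
        (trans (odd-+ m (2 * C * (2 * C))) (cong₂ _xor_ (8n-1-odd n 8n) (trans (odd-* (2 * C) (2 * C)) (cong (_∧ odd (2 * C)) (odd-* 2 C)))))))
        where
        contra : false ≡ true → ⊥
        contra ()

    -- For A = 3a the bounds of `Q₂` are x < 3a and x < 3c, so a and c may be swapped; the diagonal
    -- a = c is the edge `L₁`.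
    par-L₁ : ∀ {b} → Par (Div m) b → Par (L₁ m) b
    par-L₁ δ = par-image {P = λ i → Third i × swap i ≡ i} {Q = L₁ m} (λ { (a , c , x) → a , x })
      (λ { {a , c , x} ((e , _ , _ , x< , _) , s) → forward a c x (cong proj₁ s) e x< })
      (λ { {a , c , x} {a′ , c′ , x′} (_ , s) (_ , s′) e → inj (cong proj₁ s) (cong proj₁ s′) e })
      (λ { {z , x} (e , x<) → (z , z , x) , ((trans (eq₁₂ z) e , 3*k%3 z , odd⇒>0 x (odd-root n z z x 8n e) , x< , x<) , refl) , refl })
      (par-involution _≟₃_ swap (λ { {a , c , x} h → swap-closed a c x h }) (λ _ → refl)
        (par-preimage {P = Third} {Q = Q₂ m} triple (λ h → h)
          (λ { {a , _} {a′ , _} _ _ e → cong₂ _,_ (*-cancelˡ-≡ a a′ 3 (cong proj₁ e)) (cong proj₂ e) })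
          (λ { {A , C , x} h → third A C x h })
          (par-Q₂ δ)))
      where
      Third : Triple → Set
      Third (a , c , x) = Q₂ m (3 * a , c , x)
      triple swap : Triple → Triple
      triple (a , c , x) = 3 * a , c , x
      swap (a , c , x) = c , a , x
      swap-closed : ∀ a c x → Third (a , c , x) → Third (c , a , x)
      swap-closed a c x (e , _ , x>0 , x<a , x<c) = trans (eq c a) e , 3*k%3 c , x>0 , x<c , x<a
        where
        eq : ∀ c a → 4 * (3 * c * a) ≡ 4 * (3 * a * c)
        eq = solve-∀
      third : ∀ A C x → Q₂ m (A , C , x) → ∃ λ i → Third i × triple i ≡ (A , C , x)
      third A C x h = (A / 3 , C , x) , subst (λ A → Q₂ m (A , C , x)) eq h , cong (_, C , x) (sym eq)
        where
        eq : A ≡ 3 * (A / 3)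
        eq = trans (m≡m%n+[m/n]*n A 3) (trans (cong (_+ A / 3 * 3) (proj₁ (proj₂ h))) (*-comm (A / 3) 3))
      eq₁₂ : ∀ z → 4 * (3 * z * z) ≡ 12 * (z * z)
      eq₁₂ = solve-∀
      forward : ∀ a c x → c ≡ a → 4 * (3 * a * c) ≡ m + x * x → x < 3 * a → L₁ m (a , x)
      forward a .a x refl e x< = trans (sym (eq₁₂ a)) e , x<
      inj : ∀ {a c x a′ c′ x′} → c ≡ a → c′ ≡ a′ → (a , x) ≡ (a′ , x′) → (a , c , x) ≡ (a′ , c′ , x′)
      inj refl refl refl = refl

-- Parity of the number of factorisations

Divs : ℕ → ℕ × ℕ → Set
Divs k (d , e) = d * e ≡ k

Divs-finite : ∀ k → 0 < k → ∃ (Par (Divs k))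
Divs-finite k k>0 = par-bounded₂ (λ { (d , e) → d * e ≟ k }) (suc k) (λ { {d} {e} p → s≤s (bound d e p) , s≤s (bound e d (trans (*-comm e d) p)) })
  where
  bound : ∀ d e → d * e ≡ k → d ≤ k
  bound d zero    p = ⊥-elim (<-irrefl (trans (sym (*-zeroʳ d)) p) k>0)
  bound d (suc e) p = subst (d ≤_) p (m≤m*n d (suc e))

-- Swapping the two factors is an involution whose fixed points are the square roots of k.
Divs-square : ∀ {k b} → Par (Divs k) b → Par (λ { (d , e) → d * e ≡ k × (e , d) ≡ (d , e) }) b
Divs-square {k} δ = par-⇔ (λ p → p) (λ p → p)
  (par-involution (≡-dec _≟_ _≟_) Product.swap (λ { {d , e} p → trans (*-comm e d) p }) (λ _ → refl) δ)

Divs-true : ∀ {k} → Par (Divs k) true → ∃ λ l → l * l ≡ k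
Divs-true δ with par-true⇒∃ (Divs-square δ)
... | (d , e) , p , s = d , trans (cong (d *_) (sym (cong proj₁ s))) p

Divs-of-square : ∀ l → 0 < l → Par (Divs (l * l)) true
Divs-of-square l l>0 = let (b , δ) = Divs-finite (l * l) (*-mono-< l>0 l>0) in
  par-≡ (par-unique (Divs-square δ) (par-singleton (l , l) (refl , refl) (λ { {d , e} (p , s) → unique d e p (cong proj₁ s) }))) δ
  where
  unique : ∀ d e → d * e ≡ l * l → e ≡ d → (d , e) ≡ (l , l)
  unique d .d p refl with <-cmp d l
  ... | tri< d<l _ _ = ⊥-elim (<-irrefl p (*-mono-< d<l d<l))
  ... | tri≈ _ refl _ = refl
  ... | tri> _ _ l<d = ⊥-elim (<-irrefl (sym p) (*-mono-< l<d l<d))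

module _ {p : ℕ} (prime : Prime p) where

  private instance
    p≢0 : NonZero p
    p≢0 = prime⇒nonZero prime

  -- Euclid's lemma, used c times, moves the whole power of p into e.
  coprime-part : ∀ c d e k → ¬ p ∣ d → d * e ≡ p ^ c * k → ∃ λ e′ → e ≡ p ^ c * e′ × d * e′ ≡ k
  coprime-part zero    d e k p∤d eq = e , sym (*-identityˡ e) , trans eq (*-identityˡ k)
  coprime-part (suc c) d e k p∤d eq with euclidsLemma d e prime (divides (p ^ c * k) (trans eq (trans (*-assoc p _ k) (*-comm p _))))
  ... | inj₁ p∣d = ⊥-elim (p∤d p∣d)
  ... | inj₂ (divides e₁ refl) with coprime-part c d e₁ k p∤d (*-cancelʳ-≡ _ _ p (trans (*-assoc d e₁ p) (trans eq (trans (*-assoc p _ k) (*-comm p _)))))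
  ...   | e′ , refl , de = e′ , trans (*-comm (p ^ c * e′) p) (sym (*-assoc p (p ^ c) e′)) , de

  Common Rest : ℕ → ℕ × ℕ → Set
  Common M (d , e) = Div M (d , e) × (p ∣ d × p ∣ e)
  Rest   M (d , e) = Div M (d , e) × ¬ (p ∣ d × p ∣ e)

  -- Removing p from both factors lowers the exponent of p by 2 and keeps the order; this drives the
  -- induction in `par-Div`.
  par-Common : ∀ {M b} → Par (Div M) b → Par (Common (p * (p * M))) b
  par-Common {M} = par-image {Q = Common (p * (p * M))} (λ { (d , e) → p * d , p * e })
    (λ { {d , e} (de , d<e) → (trans (eq₁ p d e) (cong (λ z → p * (p * z)) de) , *-monoʳ-< p d<e) , m∣m*n d , m∣m*n e })
    (λ { {d , e} {d′ , e′} _ _ q → cong₂ _,_ (*-cancelˡ-≡ d d′ p (cong proj₁ q)) (*-cancelˡ-≡ e e′ p (cong proj₂ q)) })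
    (λ { {d , e} ((de , d<e) , p∣d , p∣e) → surjective de d<e p∣d p∣e })
    where
    eq₁ : ∀ p d e → p * d * (p * e) ≡ p * (p * (d * e))
    eq₁ = solve-∀
    surjective : ∀ {d e} → d * e ≡ p * (p * M) → d < e → p ∣ d → p ∣ e → ∃ λ i → Div M i × (p * proj₁ i , p * proj₂ i) ≡ (d , e)
    surjective de d<e (divides d refl) (divides e refl) = (d , e) ,
      (*-cancelˡ-≡ _ _ p (*-cancelˡ-≡ _ _ p (trans (eq₂ p d e) de)) , *-cancelʳ-< p d e d<e) , cong₂ _,_ (*-comm p d) (*-comm p e)
      where
      eq₂ : ∀ p d e → p * (p * (d * e)) ≡ d * p * (e * p)
      eq₂ = solve-∀

  -- In Rest (p^c k) one factor d is prime to p, so the other one is p^c e with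
  -- d e = k: the unordered pair is the same as the ordered factorisation (d , e).
  sort : ℕ × ℕ → ℕ × ℕ
  sort (d , e) with d <? e
  ... | yes _ = d , e
  ... | no  _ = e , d

  sort-< : ∀ {d e} → d < e → sort (d , e) ≡ (d , e)
  sort-< {d} {e} l with d <? e
  ... | yes _ = refl
  ... | no ≮  = ⊥-elim (≮ l)

  sort-> : ∀ {d e} → e < d → sort (d , e) ≡ (e , d)
  sort-> {d} {e} l with d <? e
  ... | yes l′ = ⊥-elim (<-asym l l′)
  ... | no _   = refl

  par-Rest : ∀ c k {b} → ¬ p ∣ k → Par (Divs k) b → Par (Rest (p ^ suc c * k)) b
  par-Rest c k p∤k = par-image {Q = Rest M} φ
    (λ { {d , e} de → forward d e de })
    (λ { {d , e} {d′ , e′} de de′ q → injective d e d′ e′ de de′ q })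
    (λ { {d , e} ((de , d<e) , ¬p) → surjective d e de d<e ¬p })
    where
    M = p ^ suc c * k
    P = p ^ suc c
    φ : ℕ × ℕ → ℕ × ℕ
    φ (d , e) = sort (d , P * e)
    p∤ : ∀ d e → d * e ≡ k → ¬ p ∣ d
    p∤ d e de p∣d = p∤k (subst (p ∣_) de (∣m⇒∣m*n e p∣d))
    p∣P : ∀ e → p ∣ P * e
    p∣P e = ∣m⇒∣m*n e (m∣m*n (p ^ c))
    product-eq : ∀ P d e → d * (P * e) ≡ P * (d * e)
    product-eq = solve-∀
    cases : ∀ d e → d * e ≡ k → d < P * e × φ (d , e) ≡ (d , P * e) ⊎ P * e < d × φ (d , e) ≡ (P * e , d)
    cases d e de with <-cmp d (P * e)
    ... | tri< l _ _ = inj₁ (l , sort-< l)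
    -- A tie is impossible because p divides P e but not d.
    ... | tri≈ _ q _ = ⊥-elim (p∤ d e de (subst (p ∣_) (sym q) (p∣P e)))
    ... | tri> _ _ l = inj₂ (l , sort-> l)
    forward : ∀ d e → d * e ≡ k → Rest M (φ (d , e))
    forward d e de with cases d e de
    ... | inj₁ (l , q) = subst (Rest M) (sym q) ((trans (product-eq P d e) (cong (P *_) de) , l) , λ { (p∣d , _) → p∤ d e de p∣d })
    ... | inj₂ (l , q) = subst (Rest M) (sym q) ((trans (*-comm (P * e) d) (trans (product-eq P d e) (cong (P *_) de)) , l) , λ { (_ , p∣d) → p∤ d e de p∣d })
    instance
      P≢0 : NonZero P
      P≢0 = m^n≢0 p (suc c)
    injective : ∀ d e d′ e′ → d * e ≡ k → d′ * e′ ≡ k → φ (d , e) ≡ φ (d′ , e′) → (d , e) ≡ (d′ , e′)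
    injective d e d′ e′ de de′ q with cases d e de | cases d′ e′ de′
    ... | inj₁ (_ , r) | inj₁ (_ , r′) with trans (sym r) (trans q r′)
    ...   | s = cong₂ _,_ (cong proj₁ s) (*-cancelˡ-≡ e e′ P (cong proj₂ s))
    injective d e d′ e′ de de′ q | inj₁ (_ , r) | inj₂ (_ , r′) =
      ⊥-elim (p∤ d e de (subst (p ∣_) (sym (cong proj₁ (trans (sym r) (trans q r′)))) (p∣P e′)))
    injective d e d′ e′ de de′ q | inj₂ (_ , r) | inj₁ (_ , r′) =
      ⊥-elim (p∤ d e de (subst (p ∣_) (sym (cong proj₂ (trans (sym r) (trans q r′)))) (p∣P e′)))
    injective d e d′ e′ de de′ q | inj₂ (_ , r) | inj₂ (_ , r′) with trans (sym r) (trans q r′)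
    ...   | s = cong₂ _,_ (cong proj₂ s) (*-cancelˡ-≡ e e′ P (cong proj₁ s))
    surjective : ∀ d e → d * e ≡ M → d < e → ¬ (p ∣ d × p ∣ e) → ∃ λ i → Divs k i × φ i ≡ (d , e)
    surjective d e de d<e ¬p with p ∣? d
    ... | no p∤d with coprime-part (suc c) d e k p∤d de
    ...   | e′ , refl , de′ = (d , e′) , de′ , sort-< d<e
    surjective d e de d<e ¬p | yes p∣d with coprime-part (suc c) e d k (λ p∣e → ¬p (p∣d , p∣e)) (trans (*-comm e d) de)
    ...   | d′ , refl , ed′ = (e , d′) , ed′ , sort-> d<e

  -- With c = 2j + 1, there are (c + 1)/2 · τ(k) factorisations d < e of p^c k.
  par-Div : ∀ j k {b} → ¬ p ∣ k → Par (Divs k) b → Par (Div (p ^ suc (2 * j) * k)) (b ∧ not (odd j))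
  par-Div zero k {b} p∤k δ = par-≡ (sym (∧-identityʳ b)) (par-dec (λ { (d , e) → (p ∣? d) ×-dec (p ∣? e) }) (par-∅ none) (par-Rest 0 k p∤k δ))
    where
    none : ∀ {i} → ¬ (Div (p ^ 1 * k) i × (p ∣ proj₁ i × p ∣ proj₂ i))
    none {_ , _} ((de , _) , divides d refl , divides e refl) = p∤k (divides (d * e) (*-cancelˡ-≡ k (d * e * p) p (trans (sym (cong (_* k) (*-identityʳ p))) (trans (sym de) (eq p d e)))))
      where
      eq : ∀ p d e → d * p * (e * p) ≡ p * (d * e * p)
      eq = solve-∀
  par-Div (suc j) k {b} p∤k δ = par-≡ (lem b (odd j)) (subst (λ M → Par (Div M) ((b ∧ not (odd j)) xor b)) (sym eq)
    (par-dec (λ { (d , e) → (p ∣? d) ×-dec (p ∣? e) }) (par-Common (par-Div j k p∤k δ))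
      (subst (λ M → Par (Rest M) b) eq (par-Rest (2 * suc j) k p∤k δ))))
    where
    eq : p ^ suc (2 * suc j) * k ≡ p * (p * (p ^ suc (2 * j) * k))
    eq = trans (cong (λ c → p ^ suc c * k) (*-suc 2 j)) (trans (*-assoc p _ k) (cong (p *_) (*-assoc p _ k)))
    lem : ∀ b o → (b ∧ not o) xor b ≡ b ∧ not (not o)
    lem false o     = refl
    lem true  false = refl
    lem true  true  = refl

  extract : ∀ m → 0 < m → ∃ λ c → ∃ λ k → m ≡ p ^ c * k × ¬ p ∣ k
  extract m m>0 = go m (<-wellFounded m) m>0
    where
    go : ∀ m → Acc _<_ m → 0 < m → ∃ λ c → ∃ λ k → m ≡ p ^ c * k × ¬ p ∣ k
    go m (acc rec) m>0 with p ∣? m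
    ... | no p∤m = 0 , m , sym (*-identityˡ m) , p∤m
    ... | yes (divides zero refl) = ⊥-elim (<-irrefl refl m>0)
    ... | yes (divides m₁@(suc _) refl) with go m₁ (rec (m<m*n m₁ p (nonTrivial⇒n>1 p {{prime⇒nonTrivial prime}}))) z<s
    ...   | c , k , eq , p∤k = suc c , k , trans (*-comm m₁ p) (trans (cong (p *_) eq) (sym (*-assoc p _ k))) , p∤k

prime-factor : ∀ m → 1 < m → ∃ λ p → Prime p × p ∣ m
prime-factor m@(suc _) 1<m with factorise m
... | record { factors = [] ; isFactorisation = eq } = ⊥-elim (<-irrefl (sym eq) 1<m)
... | record { factors = p ∷ ps ; isFactorisation = eq ; factorsPrime = pp ∷ _ } = p , pp , divides (ListAction.product ps) (trans eq (*-comm p (ListAction.product ps)))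

prime∣prime^ : ∀ {p q} c → Prime p → Prime q → q ∣ p ^ c → q ≡ p
prime∣prime^ {p} {q} zero    pp pq q∣ = ⊥-elim (<-irrefl (sym (∣1⇒≡1 q∣)) (nonTrivial⇒n>1 q {{prime⇒nonTrivial pq}}))
prime∣prime^ {p} {q} (suc c) pp pq q∣ with euclidsLemma p (p ^ c) pq q∣
... | inj₂ q∣p^c = prime∣prime^ c pp pq q∣p^c
... | inj₁ q∣p with prime⇒irreducible pp q∣p
...   | inj₁ q≡1 = ⊥-elim (<-irrefl (sym q≡1) (nonTrivial⇒n>1 q {{prime⇒nonTrivial pq}}))
...   | inj₂ q≡p = q≡p

OddPower : ℕ → Set
OddPower m = ∃ λ p → ∃ λ j → ∃ λ k → Prime p × ¬ p ∣ k × m ≡ p ^ suc (2 * j) * k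

-- A prime is removed with its full exponent. If that is even, the rest is treated recursively and
-- the removed power joins the square or the cofactor; the prime r found later differs from p,
-- because r divides k and p does not.
square⊎odd-power : ∀ m → 0 < m → (∃ λ l → l * l ≡ m) ⊎ OddPower m
square⊎odd-power m m>0 = go m (<-wellFounded m) m>0
  where
  go : ∀ m → Acc _<_ m → 0 < m → (∃ λ l → l * l ≡ m) ⊎ OddPower m
  go m (acc rec) m>0 with m≤n⇒m<n∨m≡n m>0
  ... | inj₂ refl = inj₁ (1 , refl)
  ... | inj₁ 1<m with prime-factor m 1<m
  ...   | p , pp , p∣m with extract pp m m>0
  ...     | zero , k , refl , p∤k = ⊥-elim (p∤k (subst (p ∣_) (*-identityˡ k) p∣m))
  ...     | c@(suc c′) , zero , refl , p∤k = ⊥-elim (p∤k (p ∣0))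
  ...     | c@(suc c′) , k@(suc _) , refl , p∤k = by-parity c (halve c) refl
    where
    instance
      p≢0 : NonZero p
      p≢0 = prime⇒nonZero pp
    halve : ∀ c → ∃ λ j → c ≡ 2 * j ⊎ c ≡ suc (2 * j)
    halve zero = 0 , inj₁ refl
    halve (suc c) with halve c
    ... | j , inj₁ q = j , inj₂ (cong suc q)
    ... | j , inj₂ q = suc j , inj₁ (trans (cong suc q) (sym (*-suc 2 j)))
    k<m : k < p ^ c * k
    k<m = subst (k <_) (*-comm k (p ^ c)) (m<m*n k (p ^ c) (<-≤-trans (nonTrivial⇒n>1 p {{prime⇒nonTrivial pp}}) (m≤m*n p (p ^ c′) {{m^n≢0 p c′}})))
    by-parity : ∀ c₀ → (∃ λ j → c₀ ≡ 2 * j ⊎ c₀ ≡ suc (2 * j)) → c₀ ≡ c → (∃ λ l → l * l ≡ p ^ c * k) ⊎ OddPower (p ^ c * k)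
    by-parity c₀ (j , inj₂ refl) q = inj₂ (p , j , k , pp , p∤k , cong (λ c → p ^ c * k) (sym q))
    by-parity c₀ (j , inj₁ refl) q with go k (rec k<m) z<s
    ... | inj₁ (l , l²) = inj₁ (p ^ j * l , trans (eq (p ^ j) l) (cong₂ _*_ (trans (sym (^-distribˡ-+-* p j j)) (cong (p ^_) (trans (cong (j +_) (sym (+-identityʳ j))) q))) l²))
      where
      eq : ∀ x l → x * l * (x * l) ≡ x * x * (l * l)
      eq = solve-∀
    ... | inj₂ (r , i , k′ , pr , r∤k′ , k≡) = inj₂ (r , i , p ^ c * k′ , pr , r∤ , trans (cong (p ^ c *_) k≡) (eq (p ^ c) (r ^ suc (2 * i)) k′))
      where
      eq : ∀ x y z → x * (y * z) ≡ y * (x * z)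
      eq = solve-∀
      r∤ : ¬ r ∣ p ^ c * k′
      r∤ r∣ with euclidsLemma (p ^ c) k′ pr r∣
      ... | inj₂ r∣k′ = r∤k′ r∣k′
      ... | inj₁ r∣p^c with prime∣prime^ c pp pr r∣p^c
      ...   | refl = p∤k (subst (p ∣_) (sym k≡) (∣m⇒∣m*n k′ (m∣m*n (p ^ (2 * i)))))

-- Powers of 3

remainders-agree : ∀ a b r s → r < 3 → s < 3 → 3 * a + r ≡ 3 * b + s → r ≡ s
remainders-agree a b r s r<3 s<3 e = begin
  r               ≡⟨ reduce a r r<3 ⟨
  (3 * a + r) % 3 ≡⟨ cong (_% 3) e ⟩
  (3 * b + s) % 3 ≡⟨ reduce b s s<3 ⟩
  s               ∎
  where
  open ≡-Reasoning
  reduce : ∀ a r → r < 3 → (3 * a + r) % 3 ≡ r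
  reduce a r r<3 = trans (cong (_% 3) (trans (+-comm (3 * a) r) (cong (r +_) (*-comm 3 a)))) (trans ([m+kn]%n≡m%n r a 3) (m<n⇒m%n≡m r<3))

division₃ : ∀ x → ∃ λ a → x ≡ 3 * a + x % 3
division₃ x = x / 3 , trans (m≡m%n+[m/n]*n x 3) (trans (+-comm (x % 3) _) (cong (_+ x % 3) (*-comm (x / 3) 3)))

data Square₃ : ℕ → Set where
  zero₃ : ∀ y → Square₃ (3 * y)
  one₃  : ∀ {x} a → x * x ≡ 3 * a + 1 → Square₃ x

square₃ : ∀ x → Square₃ x
square₃ x = by-residue (proj₁ (division₃ x)) (x % 3) (m%n<n x 3) (proj₂ (division₃ x))
  where
  eq₁ : ∀ a → (3 * a + 1) * (3 * a + 1) ≡ 3 * (3 * (a * a) + 2 * a) + 1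
  eq₁ = solve-∀
  eq₂ : ∀ a → (3 * a + 2) * (3 * a + 2) ≡ 3 * (3 * (a * a) + 4 * a + 1) + 1
  eq₂ = solve-∀
  by-residue : ∀ {x} a r → r < 3 → x ≡ 3 * a + r → Square₃ x
  by-residue a 0 _ refl = subst Square₃ (sym (+-identityʳ (3 * a))) (zero₃ a)
  by-residue a 1 _ refl = one₃ (3 * (a * a) + 2 * a) (eq₁ a)
  by-residue a 2 _ refl = one₃ (3 * (a * a) + 4 * a + 1) (eq₂ a)
  by-residue a (suc (suc (suc _))) (s≤s (s≤s (s≤s ())))

0≢1₃ : ∀ a b → ¬ 3 * a ≡ 3 * b + 1
0≢1₃ a b e with remainders-agree a b 0 1 z<s (s≤s z<s) (trans (+-identityʳ (3 * a)) e)
... | ()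

0≢2₃ : ∀ a b → ¬ 3 * a ≡ 3 * b + 2
0≢2₃ a b e with remainders-agree a b 0 2 z<s ≤-refl (trans (+-identityʳ (3 * a)) e)
... | ()

2≢1₃ : ∀ a b → ¬ 3 * a + 2 ≡ 3 * b + 1
2≢1₃ a b e with remainders-agree a b 2 1 ≤-refl (s≤s z<s) e
... | ()

-- Modulo 3 the equation becomes 0 = 1 + x², and -1 is not a square.
par-H-≡1 : ∀ {k} a → k ≡ 3 * a + 1 → Par (H k) false
par-H-≡1 a refl = par-∅ (λ { {z , x} (e , _) → none z x (square₃ x) e })
  where
  none : ∀ z x → Square₃ x → ¬ 24 * (z * z) ≡ 3 * a + 1 + x * x
  none z _ (zero₃ y) e = 0≢1₃ (8 * (z * z)) (a + 3 * (y * y)) (trans (eq₁ z) (trans e (eq₂ a y)))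
    where
    eq₁ : ∀ z → 3 * (8 * (z * z)) ≡ 24 * (z * z)
    eq₁ = solve-∀
    eq₂ : ∀ a y → 3 * a + 1 + 3 * y * (3 * y) ≡ 3 * (a + 3 * (y * y)) + 1
    eq₂ = solve-∀
  none z x (one₃ b x²) e = 0≢2₃ (8 * (z * z)) (a + b) (trans (eq₁ z) (trans e (trans (cong (3 * a + 1 +_) x²) (eq₂ a b))))
    where
    eq₁ : ∀ z → 3 * (8 * (z * z)) ≡ 24 * (z * z)
    eq₁ = solve-∀
    eq₂ : ∀ a b → 3 * a + 1 + (3 * b + 1) ≡ 3 * (a + b) + 2
    eq₂ = solve-∀

3∣root : ∀ a m x → 3 * a ≡ 3 * m + x * x → ∃ λ y → x ≡ 3 * y × a ≡ m + 3 * (y * y)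
3∣root a m x e with square₃ x
... | zero₃ y   = y , refl , *-cancelˡ-≡ a (m + 3 * (y * y)) 3 (trans e (eq m y))
  where
  eq : ∀ m y → 3 * m + 3 * y * (3 * y) ≡ 3 * (m + 3 * (y * y))
  eq = solve-∀
... | one₃ b x² = ⊥-elim (0≢1₃ a (m + b) (trans e (trans (cong (3 * m +_) x²) (eq m b))))
  where
  eq : ∀ m b → 3 * m + (3 * b + 1) ≡ 3 * (m + b) + 1
  eq = solve-∀

24≡3*8 : ∀ z → 24 * (z * z) ≡ 3 * (8 * (z * z))
24≡3*8 = solve-∀

-- Here x = 3y, and 8z² = k + 3y² would make 2z² equal to 1 modulo 3.
par-H-3·≡1 : ∀ {k} a → k ≡ 3 * a + 1 → Par (H (3 * k)) false
par-H-3·≡1 {k} a k≡ = par-∅ (λ { {z , x} (e , _) → none z (square₃ z) (3∣root (8 * (z * z)) k x (trans (sym (24≡3*8 z)) e)) })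
  where
  eq₁ : ∀ w → 3 * (24 * (w * w)) ≡ 8 * (3 * w * (3 * w))
  eq₁ = solve-∀
  eq₂ : ∀ b → 3 * (8 * b + 2) + 2 ≡ 8 * (3 * b + 1)
  eq₂ = solve-∀
  eq₃ : ∀ a y → 3 * a + 1 + 3 * (y * y) ≡ 3 * (a + y * y) + 1
  eq₃ = solve-∀
  none : ∀ {x} z → Square₃ z → ¬ (∃ λ y → x ≡ 3 * y × 8 * (z * z) ≡ k + 3 * (y * y))
  none _ (zero₃ w)   (y , _ , e) = 0≢1₃ (24 * (w * w)) (a + y * y) (trans (eq₁ w) (trans e (trans (cong (_+ 3 * (y * y)) k≡) (eq₃ a y))))
  none z (one₃ b z²) (y , _ , e) = 2≢1₃ (8 * b + 2) (a + y * y) (trans (eq₂ b) (trans (cong (8 *_) (sym z²)) (trans e (trans (cong (_+ 3 * (y * y)) k≡) (eq₃ a y)))))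

-- Scaling by 3 reaches every solution: 3 divides x, and after division by 3 the equation forces 3
-- to divide z.
par-H-9· : ∀ {m b} → Par (H m) b → Par (H (9 * m)) b
par-H-9· {m} = par-image {Q = H (9 * m)} (λ { (z , x) → 3 * z , 3 * x })
  (λ { {z , x} (e , x>0 , x<) → trans (eq₁ z) (trans (cong (9 *_) e) (eq₂ m x)) , *-monoʳ-< 3 x>0 , subst (3 * x <_) (eq₃ z) (*-monoʳ-< 3 x<) })
  (λ { {z , x} {z′ , x′} _ _ p → cong₂ _,_ (*-cancelˡ-≡ z z′ 3 (cong proj₁ p)) (*-cancelˡ-≡ x x′ 3 (cong proj₂ p)) })
  (λ { {z , x} (e , x>0 , x<) → surjective z x e x>0 x< })
  where
  eq₁ : ∀ z → 24 * (3 * z * (3 * z)) ≡ 9 * (24 * (z * z))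
  eq₁ = solve-∀
  eq₂ : ∀ m x → 9 * (m + x * x) ≡ 9 * m + 3 * x * (3 * x)
  eq₂ = solve-∀
  eq₃ : ∀ z → 3 * (4 * z) ≡ 4 * (3 * z)
  eq₃ = solve-∀
  eq₄ : ∀ w → 3 * (24 * (w * w)) ≡ 8 * (3 * w * (3 * w))
  eq₄ = solve-∀
  eq₅ : ∀ b → 8 * (3 * b + 1) ≡ 3 * (8 * b + 2) + 2
  eq₅ = solve-∀
  root : ∀ z x → Square₃ z → 0 < x → x < 4 * z → (∃ λ y → x ≡ 3 * y × 8 * (z * z) ≡ 3 * m + 3 * (y * y)) →
    ∃ λ i → H m i × (3 * proj₁ i , 3 * proj₂ i) ≡ (z , x)
  root _ _ (zero₃ w) x>0 x< (y , refl , e) = (w , y) ,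
    (*-cancelˡ-≡ (24 * (w * w)) (m + y * y) 3 (trans (eq₄ w) (trans e (sym (*-distribˡ-+ 3 m (y * y))))) ,
     *-cancelˡ-< 3 0 y x>0 , *-cancelˡ-< 3 y (4 * w) (subst (3 * y <_) (sym (eq₃ w)) x<)) , refl
  root z _ (one₃ b z²) x>0 x< (y , _ , e) =
    ⊥-elim (0≢2₃ (m + y * y) (8 * b + 2) (trans (*-distribˡ-+ 3 m (y * y)) (trans (sym e) (trans (cong (8 *_) z²) (eq₅ b)))))
  surjective : ∀ z x → 24 * (z * z) ≡ 9 * m + x * x → 0 < x → x < 4 * z → ∃ λ i → H m i × (3 * proj₁ i , 3 * proj₂ i) ≡ (z , x)
  surjective z x e x>0 x< = root z x (square₃ z) x>0 x<
    (3∣root (8 * (z * z)) (3 * m) x (trans (sym (24≡3*8 z)) (trans e (cong (_+ x * x) (*-assoc 3 3 m)))))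

-- The edge `L₂` is empty, since 12AC - 9C² is divisible by 3 and k is not.
par-H-≡2 : ∀ {k b} n a → 8 * n ≡ suc k → k ≡ 3 * a + 2 → Par (Div k) b → Par (H k) b
par-H-≡2 {k} {b} n a 8n k≡ δ = par-≡ (xor-identityʳ b) (par-H {n = n} 8n (par-L₁ {n = n} 8n k%3 δ) (par-∅ (λ { {A , C} (e , _) → none A C e })))
  where
  k%3 : k % 3 ≡ 2
  k%3 = trans (cong (_% 3) (trans k≡ (trans (+-comm (3 * a) 2) (cong (2 +_) (*-comm 3 a))))) ([m+kn]%n≡m%n 2 a 3)
  none : ∀ A C → ¬ 12 * (A * C) ≡ k + 3 * C * (3 * C)
  none A C e = 0≢2₃ (4 * (A * C)) (a + 3 * (C * C)) (trans (eq₁ A C) (trans e (trans (cong (_+ 3 * C * (3 * C)) k≡) (eq₂ a C))))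
    where
    eq₁ : ∀ A C → 3 * (4 * (A * C)) ≡ 12 * (A * C)
    eq₁ = solve-∀
    eq₂ : ∀ a C → 3 * a + 2 + 3 * C * (3 * C) ≡ 3 * (a + 3 * (C * C)) + 2
    eq₂ = solve-∀

-- Here k = C(4A - 3C), and C < A says that the first factor is the smaller one. Conversely 4A = 3d
-- + e is solvable because de = 1 modulo 4.
par-L₂ : ∀ {k b} n → 8 * n ≡ suc (3 * k) → Par (Div k) b → Par (L₂ (3 * k)) b
par-L₂ {k} n 8n = par-preimage {P = L₂ (3 * k)} ψ
  (λ { {A , C} (e , C<A) → forward A C e C<A })
  (λ { {A , C} {A′ , C′} (_ , <A) (_ , <A′) p → injective A C A′ C′ <A <A′ p })
  (λ { {d , e} (de , d<e) → backward d e de d<e })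
  where
  ψ : ℕ × ℕ → ℕ × ℕ
  ψ (A , C) = C , 4 * A ∸ 3 * C
  ψ-+ : ∀ A C e → 3 * C + e ≡ 4 * A → ψ (A , C) ≡ (C , e)
  ψ-+ A C e p = cong (C ,_) (monus (3 * C) e p)
  3C<4A : ∀ {C A} → C < A → 3 * C < 4 * A
  3C<4A {C} {A} l = <-≤-trans (*-monoʳ-< 3 l) (m≤n+m (3 * A) A)
  product : ∀ A C e → 3 * C + e ≡ 4 * A → 3 * (C * e) + 3 * C * (3 * C) ≡ 12 * (A * C)
  product A C e p = trans (eq₁ C e) (trans (cong (λ z → 3 * (z * C)) p) (eq₂ A C))
    where
    eq₁ : ∀ C e → 3 * (C * e) + 3 * C * (3 * C) ≡ 3 * ((3 * C + e) * C)
    eq₁ = solve-∀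
    eq₂ : ∀ A C → 3 * (4 * A * C) ≡ 12 * (A * C)
    eq₂ = solve-∀
  forward : ∀ A C → 12 * (A * C) ≡ 3 * k + 3 * C * (3 * C) → C < A → Div k (ψ (A , C))
  forward A C eq C<A with m<n⇒∃ (3C<4A C<A)
  ... | e , _ , p = subst (Div k) (sym (ψ-+ A C e p))
    (*-cancelˡ-≡ (C * e) k 3 (+-cancelʳ-≡ (3 * C * (3 * C)) (3 * (C * e)) (3 * k) (trans (product A C e p) eq)) ,
     +-cancelˡ-< (3 * C) C e (subst (3 * C + C <_) (sym p) (subst (_< 4 * A) (+-comm C (3 * C)) (*-monoʳ-< 4 C<A))))
  injective : ∀ A C A′ C′ → C < A → C′ < A′ → ψ (A , C) ≡ ψ (A′ , C′) → (A , C) ≡ (A′ , C′)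
  injective A C A′ C′ <A <A′ eq with m<n⇒∃ (3C<4A <A) | m<n⇒∃ (3C<4A <A′)
  ... | e , _ , p | e′ , _ , p′ with trans (sym (ψ-+ A C e p)) (trans eq (ψ-+ A′ C′ e′ p′))
  ...   | refl = cong (_, C) (*-cancelˡ-≡ A A′ 4 (trans (sym p) p′))
  k-odd : odd k ≡ true
  k-odd = trans (sym (odd-* 3 k)) (8n-1-odd n 8n)
  backward : ∀ d e → d * e ≡ k → d < e → ∃ λ i → L₂ (3 * k) i × ψ i ≡ (d , e)
  backward d e de d<e with odd-factors d e (trans (cong odd de) k-odd) d<e
  ... | x , x>0 , refl , od with odd x in ox
  ...   | false with even⇒ x ox
  ...     | y , refl = (d + y , d) , (trans (sym (product (d + y) d _ p)) (cong (λ z → 3 * z + 3 * d * (3 * d)) de) , m<m+n d (positive y x>0)) , ψ-+ (d + y) d _ p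
    where
    positive : ∀ y → 0 < y + y → 0 < y
    positive (suc y) _ = z<s
    eq : ∀ d y → 3 * d + (d + 2 * (y + y)) ≡ 4 * (d + y)
    eq = solve-∀
    p : 3 * d + (d + 2 * (y + y)) ≡ 4 * (d + y)
    p = eq d y
  backward d e de d<e | x , x>0 , refl , od | true with odd⇒ d od | odd⇒ x ox
  -- For odd x the product de would be 3 modulo 4 and 3de + 1 would be 2 modulo 4, but it equals 8n.
  ...     | i , refl | j , refl = ⊥-elim (contra (trans (sym (odd-* 4 n)) (trans (cong odd (*-cancelˡ-≡ (4 * n) (suc (2 * r)) 2
      (trans (eq₁ n) (trans 8n (trans (cong (λ z → suc (3 * z)) (sym de)) (eq₂ i j)))))) (cong not (odd-* 2 r)))))
    where
    r = 3 * (i * i + 2 * i + j * suc (i + i)) + 2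
    contra : false ≡ true → ⊥
    contra ()
    eq₁ : ∀ n → 2 * (4 * n) ≡ 8 * n
    eq₁ = solve-∀
    eq₂ : ∀ i j → suc (3 * (suc (i + i) * (suc (i + i) + 2 * suc (j + j)))) ≡ 2 * suc (2 * (3 * (i * i + 2 * i + j * suc (i + i)) + 2))
    eq₂ = solve-∀

-- Now `L₁` is the empty edge: X = 3y leads to 4A² = k + 3y², so A² would be 2 modulo 3.
par-H-3·≡2 : ∀ {k b} n a → 8 * n ≡ suc (3 * k) → k ≡ 3 * a + 2 → Par (Div k) b → Par (H (3 * k)) b
par-H-3·≡2 {k} n a 8n k≡ δ = par-H {n = n} 8n
  (par-∅ (λ { {A , X} (e , _) → none A (square₃ A) (3∣root (4 * (A * A)) k X (trans (sym (*-assoc 3 4 (A * A))) e)) })) (par-L₂ n 8n δ)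
  where
  eq₁ : ∀ w → 3 * (12 * (w * w)) ≡ 4 * (3 * w * (3 * w))
  eq₁ = solve-∀
  eq₂ : ∀ a y → 3 * a + 2 + 3 * (y * y) ≡ 3 * (a + y * y) + 2
  eq₂ = solve-∀
  eq₃ : ∀ b → 4 * (3 * b + 1) ≡ 3 * (4 * b + 1) + 1
  eq₃ = solve-∀
  none : ∀ {X} A → Square₃ A → ¬ (∃ λ y → X ≡ 3 * y × 4 * (A * A) ≡ k + 3 * (y * y))
  none _ (zero₃ w)   (y , _ , e) = 0≢2₃ (12 * (w * w)) (a + y * y) (trans (eq₁ w) (trans e (trans (cong (_+ 3 * (y * y)) k≡) (eq₂ a y))))
  none A (one₃ b A²) (y , _ , e) = 2≢1₃ (a + y * y) (4 * b + 1)
    (trans (sym (eq₂ a y)) (trans (cong (_+ 3 * (y * y)) (sym k≡)) (trans (sym e) (trans (cong (4 *_) A²) (eq₃ b)))))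

-- When the number of factorisations is odd

Form : ℕ → Set
Form k = ∃ λ p → ∃ λ j → ∃ λ l → Prime p × ¬ p ∣ l × k ≡ p ^ suc (2 * (2 * j)) * (l * l)

par-Div-Form : ∀ {k} → Form k → Par (Div k) true
par-Div-Form (p , j , l , pp , p∤l , refl) = par-≡ (cong not (odd-* 2 j)) (par-Div pp (2 * j) (l * l) p∤l² (Divs-of-square l l>0))
  where
  p∤l² : ¬ p ∣ l * l
  p∤l² d with euclidsLemma l l pp d
  ... | inj₁ x = p∤l x
  ... | inj₂ x = p∤l x
  l>0 : 0 < l
  l>0 = n≢0⇒n>0 (λ { refl → p∤l (p ∣0) })

-- A number that is 2 modulo 3 is not a square, so some prime p has odd exponent 2j + 1 in it. Any
-- such p serves: the count (j + 1) τ(m) is odd only if j is even and the cofactor m is a square.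
par-Div-decide : ∀ {k} a → k ≡ 3 * a + 2 → ∃ λ b → Par (Div k) b × (b ≡ true → Form k)
par-Div-decide {k} a k≡ with square⊎odd-power k (subst (0 <_) (sym (trans k≡ (+-comm (3 * a) 2))) z<s)
... | inj₁ (l , l²) = ⊥-elim (none l (square₃ l) (trans l² k≡))
  where
  none : ∀ l → Square₃ l → ¬ l * l ≡ 3 * a + 2
  none _ (zero₃ y)   e = 0≢2₃ (3 * (y * y)) a (trans (eq y) e)
    where
    eq : ∀ y → 3 * (3 * (y * y)) ≡ 3 * y * (3 * y)
    eq = solve-∀
  none l (one₃ b l²) e = 2≢1₃ a b (trans (sym e) l²)
... | inj₂ (p , j , m , pp , p∤m , refl) with Divs-finite m (n≢0⇒n>0 (λ { refl → p∤m (p ∣0) }))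
...   | b , δ = _ , par-Div pp j m p∤m δ , form b δ (odd j) refl
  where
  form : ∀ b → Par (Divs m) b → ∀ o → odd j ≡ o → b ∧ not o ≡ true → Form (p ^ suc (2 * j) * m)
  form true δ false oj _ with Divs-true δ | even j oj
    where
    even : ∀ j → odd j ≡ false → ∃ λ i → j ≡ 2 * i
    even j o with even⇒ j o
    ... | i , e = i , trans e (cong (i +_) (sym (+-identityʳ i)))
  ... | l , refl | i , refl = p , i , l , pp , (λ p∣l → p∤m (∣m⇒∣m*n l p∣l)) , refl

-- Residues modulo 3 and 24

classify : ∀ k → ¬ 3 ∣ k → ∃ λ a → k ≡ 3 * a + 1 ⊎ k ≡ 3 * a + 2
classify k 3∤k = by-residue (proj₁ (division₃ k)) (k % 3) (m%n<n k 3) (proj₂ (division₃ k))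
  where
  by-residue : ∀ a r → r < 3 → k ≡ 3 * a + r → ∃ λ a → k ≡ 3 * a + 1 ⊎ k ≡ 3 * a + 2
  by-residue a 0 _ e = ⊥-elim (3∤k (divides a (trans e (trans (+-identityʳ (3 * a)) (*-comm 3 a)))))
  by-residue a 1 _ e = a , inj₁ e
  by-residue a 2 _ e = a , inj₂ e
  by-residue a (suc (suc (suc _))) (s≤s (s≤s (s≤s ())))

-- For 3^b k ≡ 7 modulo 8 with k ≡ 2 modulo 3, the two cases are b odd and b even.
Residue : ℕ → Set
Residue k = k % 24 ≡ 5 ⊎ k % 24 ≡ 23

-- The witness is n - m, as 9m + 1 - 8m = m + 1.
descend : ∀ {m} n → 8 * n ≡ suc (9 * m) → ∃ λ n′ → 8 * n′ ≡ suc m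
descend {m} n e with m<n⇒∃ (*-cancelˡ-< 8 m n (subst (8 * m <_) (sym e) (s≤s (*-monoˡ-≤ m {8} {9} (n≤1+n 8)))))
... | n′ , _ , refl = n′ , +-cancelˡ-≡ (8 * m) (8 * n′) (suc m) (trans (sym (*-distribˡ-+ 8 m n′)) (trans e (eq m)))
  where
  eq : ∀ m → suc (9 * m) ≡ 8 * m + suc m
  eq = solve-∀

par-H-9^· : ∀ i {m n} → 8 * n ≡ suc (9 ^ i * m) → (∃ λ n′ → 8 * n′ ≡ suc m) × (∀ {b} → Par (H m) b → Par (H (9 ^ i * m)) b)
par-H-9^· zero {m} {n} e = (n , trans e (cong suc (*-identityˡ m))) , λ {b} → subst (λ z → Par (H z) b) (sym (*-identityˡ m))
par-H-9^· (suc i) {m} {n} e with descend n (trans e (cong suc (*-assoc 9 (9 ^ i) m)))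
... | n₁ , e₁ with par-H-9^· i {m} {n₁} e₁
...   | r , f = r , λ {b} δ → subst (λ z → Par (H z) b) (sym (*-assoc 9 (9 ^ i) m)) (par-H-9· (f δ))

-- k is -1 both modulo 8 and modulo 3.
residue-23 : ∀ {k} n a → 8 * n ≡ suc k → k ≡ 3 * a + 2 → k % 24 ≡ 23
residue-23 {k} n a 8n k≡ = by-residue (proj₁ (division₃ n)) (n % 3) (m%n<n n 3) (proj₂ (division₃ n))
  where
  8n′ : ∀ a → suc (3 * a + 2) ≡ 3 * suc a
  8n′ = solve-∀
  e : 3 * suc a ≡ 8 * n
  e = trans (sym (8n′ a)) (trans (cong suc (sym k≡)) (sym 8n))
  by-residue : ∀ b r → r < 3 → n ≡ 3 * b + r → k % 24 ≡ 23
  by-residue zero 0 _ refl with trans e refl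
  ... | ()
  by-residue (suc b) 0 _ n≡ = trans (cong (_% 24) (suc-injective (trans (sym 8n) (trans (cong (8 *_) n≡) (eq b))))) ([m+kn]%n≡m%n 23 b 24)
    where
    eq : ∀ b → 8 * (3 * suc b + 0) ≡ suc (23 + b * 24)
    eq = solve-∀
  by-residue b 1 _ n≡ = ⊥-elim (0≢2₃ (suc a) (8 * b + 2) (trans e (trans (cong (8 *_) n≡) (eq b))))
    where
    eq : ∀ b → 8 * (3 * b + 1) ≡ 3 * (8 * b + 2) + 2
    eq = solve-∀
  by-residue b 2 _ n≡ = ⊥-elim (0≢1₃ (suc a) (8 * b + 5) (trans e (trans (cong (8 *_) n≡) (eq b))))
    where
    eq : ∀ b → 8 * (3 * b + 2) ≡ 3 * (8 * b + 5) + 1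
    eq = solve-∀
  by-residue b (suc (suc (suc _))) (s≤s (s≤s (s≤s ())))

residue-5 : ∀ {k} n a → 8 * n ≡ suc (3 * k) → k ≡ 3 * a + 2 → k % 24 ≡ 5
residue-5 {k} n a 8n k≡ with m<n⇒∃ (*-cancelˡ-< 8 a n (subst (8 * a <_) (sym e) (m<m+n (8 * a) (<-≤-trans z<s (m≤n+m 7 a)))))
  where
  eq : ∀ a → suc (3 * (3 * a + 2)) ≡ 8 * a + (a + 7)
  eq = solve-∀
  e : 8 * n ≡ 8 * a + (a + 7)
  e = trans 8n (trans (cong (λ z → suc (3 * z)) k≡) (eq a))
-- From 8(n - a) = a + 7 with n - a = b + 1 comes a = 8b + 1, hence k = 24b + 5.
... | suc b , _ , refl = trans (cong (_% 24) (trans k≡ (trans (cong (λ z → 3 * z + 2) a≡) (eq₂ b)))) ([m+kn]%n≡m%n 5 b 24)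
  where
  eq : ∀ a → suc (3 * (3 * a + 2)) ≡ 8 * a + (a + 7)
  eq = solve-∀
  eq₁ : ∀ b → 8 * suc b ≡ suc (8 * b) + 7
  eq₁ = solve-∀
  eq₂ : ∀ b → 3 * suc (8 * b) + 2 ≡ 5 + b * 24
  eq₂ = solve-∀
  a≡ : a ≡ suc (8 * b)
  a≡ = +-cancelʳ-≡ 7 a (suc (8 * b)) (trans (sym (+-cancelˡ-≡ (8 * a) (8 * suc b) (a + 7)
    (trans (sym (*-distribˡ-+ 8 a (suc b))) (trans 8n (trans (cong (λ z → suc (3 * z)) k≡) (eq a)))))) (eq₁ b))

Form-square : ∀ p j l → p ^ suc (2 * (2 * j)) * (l * l) ≡ p * (p ^ (2 * j) * l * (p ^ (2 * j) * l))
Form-square p j l = trans (cong (λ z → p * z * (l * l)) (trans (cong (λ i → p ^ (2 * j + i)) (+-identityʳ (2 * j))) (^-distribˡ-+-* p (2 * j) (2 * j)))) (eq p (p ^ (2 * j)) l)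
  where
  eq : ∀ p s l → p * (s * s) * (l * l) ≡ p * (s * l * (s * l))
  eq = solve-∀

mod-square : ∀ n .{{_ : NonZero n}} p s → (p * (s * s)) % n ≡ (p % n * (s % n * (s % n))) % n
mod-square n p s = begin
  (p * (s * s)) % n                     ≡⟨ %-distribˡ-* p (s * s) n ⟩
  (p % n * ((s * s) % n)) % n           ≡⟨ cong (λ z → (p % n * z) % n) (%-distribˡ-* s s n) ⟩
  (p % n * ((s % n * (s % n)) % n)) % n ≡⟨ cong (λ z → (z * ((s % n * (s % n)) % n)) % n) (m%n%n≡m%n p n) ⟨
  (p % n % n * ((s % n * (s % n)) % n)) % n ≡⟨ %-distribˡ-* (p % n) (s % n * (s % n)) n ⟨
  (p % n * (s % n * (s % n))) % n       ∎
  where open ≡-Reasoning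

mod-square-Fin : ∀ n .{{_ : NonZero n}} p s → (p * (s * s)) % n ≡ (toℕ (fromℕ< (m%n<n p n)) * (toℕ (fromℕ< (m%n<n s n)) * toℕ (fromℕ< (m%n<n s n)))) % n
mod-square-Fin n p s = trans (mod-square n p s) (cong₂ (λ x y → (x * (y * y)) % n) (sym (toℕ-fromℕ< (m%n<n p n))) (sym (toℕ-fromℕ< (m%n<n s n))))

-- Squares prime to 24 are 1 modulo 24.
units-24 : ∀ (i j : Fin 24) →
  ((toℕ i * (toℕ j * toℕ j)) % 24 ≡ 5 → toℕ i ≡ 5) × ((toℕ i * (toℕ j * toℕ j)) % 24 ≡ 23 → toℕ i ≡ 23)
units-24 = from-yes (all? {n = 24} (λ i → all? {n = 24} (λ j →
  (((toℕ i * (toℕ j * toℕ j)) % 24 ≟ 5) →-dec (toℕ i ≟ 5)) ×-dec (((toℕ i * (toℕ j * toℕ j)) % 24 ≟ 23) →-dec (toℕ i ≟ 23)))))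

-- The number is p times a square s², and since 5 and 23 are units modulo 24, s is one too and s² =
-- 1.
prime-residue : ∀ p j l → Residue (p ^ suc (2 * (2 * j)) * (l * l)) → Residue p
prime-residue p j l r = residue′ (subst Residue (Form-square p j l) r)
  where
  s = p ^ (2 * j) * l
  i₂₄ : ℕ → Fin 24
  i₂₄ x = fromℕ< (m%n<n x 24)
  residue′ : Residue (p * (s * s)) → Residue p
  residue′ (inj₁ e) = inj₁ (trans (sym (toℕ-fromℕ< (m%n<n p 24))) (proj₁ (units-24 (i₂₄ p) (i₂₄ s)) (trans (sym (mod-square-Fin 24 p s)) e)))
  residue′ (inj₂ e) = inj₂ (trans (sym (toℕ-fromℕ< (m%n<n p 24))) (proj₂ (units-24 (i₂₄ p) (i₂₄ s)) (trans (sym (mod-square-Fin 24 p s)) e)))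

Residue-%3 : ∀ p → Residue p → p % 3 ≡ 2
Residue-%3 p r = trans (sym (m∣n⇒o%n%m≡o%m 3 24 p (divides 8 refl))) (reduce r)
  where
  reduce : Residue p → p % 24 % 3 ≡ 2
  reduce (inj₁ e) = cong (_% 3) e
  reduce (inj₂ e) = cong (_% 3) e

not-1₃ : ∀ a p s → p % 3 ≡ 2 → ¬ p * (s * s) ≡ 3 * a + 1
not-1₃ a p s p%3 = none s (square₃ s)
  where
  q = proj₁ (division₃ p)
  p≡ : p ≡ 3 * q + 2
  p≡ = trans (proj₂ (division₃ p)) (cong (3 * q +_) p%3)
  eq₁ : ∀ p y → 3 * (p * (3 * (y * y))) ≡ p * (3 * y * (3 * y))
  eq₁ = solve-∀
  eq₂ : ∀ q b → 3 * (q * (3 * b + 1) + 2 * b) + 2 ≡ (3 * q + 2) * (3 * b + 1)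
  eq₂ = solve-∀
  none : ∀ s → Square₃ s → ¬ p * (s * s) ≡ 3 * a + 1
  none _ (zero₃ y)   e = 0≢1₃ (p * (3 * (y * y))) a (trans (eq₁ p y) e)
  none s (one₃ b s²) e = 2≢1₃ (q * (3 * b + 1) + 2 * b) a (trans (eq₂ q b) (trans (sym (cong₂ _*_ p≡ s²)) e))

prime-3 : Prime 3
prime-3 = from-yes (prime? 3)

3-adic-unique : ∀ b c k k′ → ¬ 3 ∣ k → ¬ 3 ∣ k′ → 3 ^ b * k ≡ 3 ^ c * k′ → k ≡ k′
3-adic-unique zero    zero    k k′ p p′ e = trans (sym (*-identityˡ k)) (trans e (*-identityˡ k′))
3-adic-unique zero    (suc c) k k′ p p′ e = ⊥-elim (p (subst (3 ∣_) (trans (sym e) (*-identityˡ k)) (∣m⇒∣m*n k′ (m∣m*n (3 ^ c)))))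
3-adic-unique (suc b) zero    k k′ p p′ e = ⊥-elim (p′ (subst (3 ∣_) (trans e (*-identityˡ k′)) (∣m⇒∣m*n k (m∣m*n (3 ^ b)))))
3-adic-unique (suc b) (suc c) k k′ p p′ e = 3-adic-unique b c k k′ p p′
  (*-cancelˡ-≡ (3 ^ b * k) (3 ^ c * k′) 3 (trans (sym (*-assoc 3 (3 ^ b) k)) (trans e (*-assoc 3 (3 ^ c) k′))))

-- Assembling the criterion

RightForm : ℕ → Set
RightForm m = ∃ λ b → ∃ λ l → ∃ λ p → ∃ λ c → Prime p × Residue p × ¬ p ∣ l × l ≥ 1 × c % 4 ≡ 1 × m ≡ 3 ^ b * l ^ 2 * p ^ c

-- Factors 3 may hide in ℓ; they are moved to the power of 3, so that k is the part of m prime to 3.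
-- As p is 2 modulo 3, it is not 3 itself, and k is not 1 modulo 3.
normalise : ∀ {m} → RightForm m → ∃ λ b → ∃ λ k → m ≡ 3 ^ b * k × ¬ 3 ∣ k × Form k × (∀ a → ¬ k ≡ 3 * a + 1)
normalise {m} (b , l , p , c , pp , rp , p∤l , l≥1 , c≡1 , m≡) with extract prime-3 l l≥1
... | i , l′ , refl , 3∤l′ = b + (i + i) , k , trans m≡ (trans (cong (λ c → 3 ^ b * (3 ^ i * l′) ^ 2 * p ^ c) c≡)
      (trans (eq (3 ^ b) (3 ^ i) l′ (p ^ c′)) (cong (_* k) (sym (trans (^-distribˡ-+-* 3 b (i + i)) (cong (3 ^ b *_) (^-distribˡ-+-* 3 i i)))))))
    , 3∤k , (p , j , l′ , pp , (λ p∣l′ → p∤l (∣n⇒∣m*n (3 ^ i) p∣l′)) , refl)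
    , λ a e → not-1₃ a p (p ^ (2 * j) * l′) (Residue-%3 p rp) (trans (sym (Form-square p j l′)) e)
  where
  j = c / 4
  c′ = suc (2 * (2 * j))
  k = p ^ c′ * (l′ * l′)
  eq₄ : ∀ j → j * 4 ≡ 2 * (2 * j)
  eq₄ = solve-∀
  c≡ : c ≡ c′
  c≡ = trans (m≡m%n+[m/n]*n c 4) (cong₂ _+_ c≡1 (eq₄ j))
  eq : ∀ x y l z → x * (y * l * (y * l * 1)) * z ≡ x * (y * y) * (z * (l * l))
  eq = solve-∀
  3≢p : ¬ 3 ≡ p
  3≢p 3≡p with trans (cong (_% 3) 3≡p) (Residue-%3 p rp)
  ... | ()
  3∤k : ¬ 3 ∣ k
  3∤k d with euclidsLemma (p ^ c′) (l′ * l′) prime-3 d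
  ... | inj₁ x = 3≢p (prime∣prime^ c′ pp prime-3 x)
  ... | inj₂ x with euclidsLemma l′ l′ prime-3 x
  ...   | inj₁ y = 3∤l′ y
  ...   | inj₂ y = 3∤l′ y

denormalise : ∀ {k} b → Form k → Residue k → RightForm (3 ^ b * k)
denormalise b (p , j , l , pp , p∤l , refl) r = b , l , p , suc (2 * (2 * j)) , pp , prime-residue p j l r , p∤l ,
  n≢0⇒n>0 (λ { refl → p∤l (p ∣0) }) , trans (cong (λ z → suc z % 4) (eq₄ j)) ([m+kn]%n≡m%n 1 j 4) , eq (3 ^ b) (p ^ suc (2 * (2 * j))) l
  where
  eq₄ : ∀ j → 2 * (2 * j) ≡ j * 4
  eq₄ = solve-∀
  eq : ∀ x z l → x * (z * (l * l)) ≡ x * (l * (l * 1)) * z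
  eq = solve-∀

-- The last implication excludes k = 1 modulo 3, because then `H m` is empty even when k has the
-- shape `Form`.
Decided : ℕ → ℕ → Set
Decided m k = ∃ λ b → Par (H m) b × (b ≡ true → Form k × Residue k) × (Form k → (∀ a → ¬ k ≡ 3 * a + 1) → b ≡ true)

decide-even : ∀ {k} n → 8 * n ≡ suc k → ¬ 3 ∣ k → Decided k k
decide-even {k} n 8n 3∤k with classify k 3∤k
... | a , inj₁ k≡ = false , par-H-≡1 a k≡ , (λ ()) , (λ _ f → ⊥-elim (f a k≡))
... | a , inj₂ k≡ with par-Div-decide a k≡
...   | b , δ , f = b , par-H-≡2 n a 8n k≡ δ , (λ e → f e , inj₂ (residue-23 n a 8n k≡)) , (λ g _ → par-unique δ (par-Div-Form g))

decide-odd : ∀ {k} n → 8 * n ≡ suc (3 * k) → ¬ 3 ∣ k → Decided (3 * k) k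
decide-odd {k} n 8n 3∤k with classify k 3∤k
... | a , inj₁ k≡ = false , par-H-3·≡1 a k≡ , (λ ()) , (λ _ f → ⊥-elim (f a k≡))
... | a , inj₂ k≡ with par-Div-decide a k≡
...   | b , δ , f = b , par-H-3·≡2 n a 8n k≡ δ , (λ e → f e , inj₁ (residue-5 n a 8n k≡)) , (λ g _ → par-unique δ (par-Div-Form g))

3^2* : ∀ i → 3 ^ (i + i) ≡ 9 ^ i
3^2* i = trans (cong (3 ^_) (cong (i +_) (sym (+-identityʳ i)))) (sym (^-*-assoc 3 2 i))

3^odd : ∀ i k → 3 ^ suc (i + i) * k ≡ 9 ^ i * (3 * k)
3^odd i k = trans (cong (λ z → 3 * z * k) (3^2* i)) (trans (cong (_* k) (*-comm 3 (9 ^ i))) (*-assoc (9 ^ i) 3 k))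

decide : ∀ c k n → 8 * n ≡ suc (3 ^ c * k) → ¬ 3 ∣ k → Decided (3 ^ c * k) k
decide c k n 8n 3∤k with odd c in oc
... | false with even⇒ c oc
...   | i , refl with par-H-9^· i {k} {n} (trans 8n (cong (λ z → suc (z * k)) (3^2* i)))
...     | (n′ , 8n′) , lift with decide-even n′ 8n′ 3∤k
...       | b , δ , rest = b , subst (λ z → Par (H (z * k)) b) (sym (3^2* i)) (lift δ) , rest
decide c k n 8n 3∤k | true with odd⇒ c oc
...   | i , refl with par-H-9^· i {3 * k} {n} (trans 8n (cong suc (3^odd i k)))
...     | (n′ , 8n′) , lift with decide-odd n′ 8n′ 3∤k
...       | b , δ , rest = b , subst (λ z → Par (H z) b) (sym (3^odd i k)) (lift δ) , rest

odd⇒%2 : ∀ n → odd n ≡ true → n % 2 ≡ 1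
odd⇒%2 n o with odd⇒ n o
... | k , refl = trans (cong (λ z → suc z % 2) (eq k)) ([m+kn]%n≡m%n 1 k 2)
  where
  eq : ∀ k → k + k ≡ k * 2
  eq = solve-∀

%2⇒odd : ∀ n → n % 2 ≡ 1 → odd n ≡ true
%2⇒odd n e = trans (cong odd (trans (m≡m%n+[m/n]*n n 2) (cong (_+ n / 2 * 2) e))) (cong not (trans (odd-* (n / 2) 2) (∧-zeroʳ (odd (n / 2)))))

odd-u2⇔ : ∀ m n → 8 * n ≡ suc m → (odd (u2 n) ≡ true → RightForm m) × (RightForm m → odd (u2 n) ≡ true)
odd-u2⇔ m n 8n with extract prime-3 m (n≢0⇒n>0 (λ { refl → 8n≢1 n 8n }))
  where
  8n≢1 : ∀ n → ¬ 8 * n ≡ 1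
  8n≢1 n e with trans (sym (odd-* 8 n)) (cong odd e)
  ... | ()
... | c , k , refl , 3∤k with decide c k n 8n 3∤k
...   | b , δ , to , from = (λ o → let (f , r) = to (trans (par-unique δ (par-u2 _ n 8n)) o) in denormalise c f r) , back
  where
  back : RightForm (3 ^ c * k) → odd (u2 n) ≡ true
  back r with normalise r
  -- Both decompositions split off the full power of 3, so their cofactors agree.
  ... | b′ , k′ , e , 3∤k′ , f , no1 with 3-adic-unique c b′ k k′ 3∤k 3∤k′ e
  ...   | refl = trans (par-unique (par-u2 _ n 8n) δ) (from f no1)

theorem1p3 : (n : ℕ) →
    (u2 n % 2 ≡ 1) ⇔
    Σ ℕ (λ b → Σ ℕ (λ ℓ → Σ ℕ (λ p → Σ ℕ (λ c →
    Prime p × (p % 24 ≡ 5 ⊎ p % 24 ≡ 23) × ¬ (p ∣ ℓ) × ℓ ≥ 1 ×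
    c % 4 ≡ 1 × 8 * n ≡ 3 ^ b * ℓ ^ 2 * p ^ c + 1))))
theorem1p3 n = mk⇔ (to n) from
  where
  Represented : ℕ → Set
  Represented n = ∃ λ b → ∃ λ ℓ → ∃ λ p → ∃ λ c → Prime p × Residue p × ¬ (p ∣ ℓ) × ℓ ≥ 1 × c % 4 ≡ 1 × 8 * n ≡ 3 ^ b * ℓ ^ 2 * p ^ c + 1
  to : ∀ n → u2 n % 2 ≡ 1 → Represented n
  -- For n = 0 there is no natural number m = 8n - 1; here `u2 0` computes to 0.
  to zero    ()
  to (suc n) e with proj₁ (odd-u2⇔ (7 + 8 * n) (suc n) (*-suc 8 n)) (%2⇒odd (u2 (suc n)) e)
  ... | b , ℓ , p , c , pp , rp , p∤ℓ , ℓ≥1 , c≡1 , m≡ = b , ℓ , p , c , pp , rp , p∤ℓ , ℓ≥1 , c≡1 ,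
    trans (*-suc 8 n) (trans (cong suc m≡) (+-comm 1 (3 ^ b * ℓ ^ 2 * p ^ c)))
  from : Represented n → u2 n % 2 ≡ 1
  from (b , ℓ , p , c , pp , rp , p∤ℓ , ℓ≥1 , c≡1 , e) = odd⇒%2 (u2 n)
    (proj₂ (odd-u2⇔ (3 ^ b * ℓ ^ 2 * p ^ c) n (trans e (+-comm (3 ^ b * ℓ ^ 2 * p ^ c) 1))) (b , ℓ , p , c , pp , rp , p∤ℓ , ℓ≥1 , c≡1 , refl))
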